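{- The average-energy problem for one-player games is in $\mathsf{PTIME}$: there is a polynomial-time algorithm which, given a game $G=(S_1,S_2,E,w)$ with $S_1=\emptyset$ or $S_2=\emptyset$, an initial state $s_{\mathrm{init}}\in S$ and a threshold $t\in\mathbb{Q}$, decides whether player 1 has a winning strategy from $s_{\mathrm{init}}$ for the objective $\mathsf{AvgEnergy}(t)$.
   Context: A game is a tuple $G=(S_1,S_2,E,w)$ where $S_1,S_2$ are disjoint finite sets of states belonging to player 1 and player 2, $S=S_1\uplus S_2$, $E\subseteq S\times S$ is a finite set of edges such that every state has at least one outgoing edge, and $w\colon E\to\mathbb{Z}$ is an integer weight function. $G$ is one-player if $S_1=\emptyset$ or $S_2=\emptyset$. A play from $s_{\mathrm{init}}$ is an infinite sequence $\pi=s_0s_1s_2\dots$ with $s_0=s_{\mathrm{init}}$ and $(s_i,s_{i+1})\in E$ for all $i\ge 0$; $\pi(n)=s_0\dots s_n$ is its prefix up to position $n$. A strategy for player $i$ is a function mapping each finite prefix ending in a state of $S_i$ to a successor (along an edge) of its last state. Strategies of the two players and $s_{\mathrm{init}}$ determine a unique play, the outcome. The energy level is $\mathrm{EL}(\pi(n))=\sum_{i=0}^{n-1}w(s_i,s_{i+1})$, and the average-energy of $\pi$ is $\overline{AE}(\pi)=\limsup_{n\to\infty}\frac1n\sum_{i=1}^{n}\mathrm{EL}(\pi(i))$. For $t\in\mathbb{Q}$, $\mathsf{AvgEnergy}(t)$ is the set of plays $\pi$ with $\overline{AE}(\pi)\le t$. A strategy of player 1 is winning from $s_{\mathrm{init}}$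 for an objective $\mathcal W$ (a set of plays) if, for every strategy of player 2, the outcome lies in $\mathcal W$. Weights and thresholds are encoded in binary. -}

module Defs where

open import Data.Bool using (if_then_else_)
open import Data.Fin using (Fin; toℕ)
open import Data.Integer as ℤ using (ℤ; +_; 0ℤ; 1ℤ; ∣_∣)
open import Data.List using (List; []; _∷_; _++_; map; sum; allFin; concatMap)
open import Data.Maybe using (Maybe; just; nothing; Is-just; to-witness)
open import Data.Nat as ℕ using (ℕ; zero; suc; _≟_)
open import Data.Nat.Logarithm using (⌊log₂_⌋)
open import Data.Product using (Σ; _×_; _,_; ∃-syntax; proj₁; proj₂)
open import Data.Rational as ℚ using (ℚ; 0ℚ; ↥_; ↧_)
open import Data.Sum using (_⊎_)
open import Function using (_⇔_; _∘_)
open import Level using (0ℓ)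
open import Relation.Binary.PropositionalEquality using (_≡_; refl)
open import Relation.Nullary using (does)
open import Relation.Unary using (Pred)

------------------------------------------------------------------------
-- Games

data Player : Set where
  player₁ player₂ : Player

-- S₁ and S₂ are the two fibres of owner.  The partial function weight
-- carries both the edge set (its domain of definition) and w : E → ℤ.
record Game : Set where
  field
    #states : ℕ
    owner   : Fin #states → Player
    weight  : Fin #states → Fin #states → Maybe ℤ

  State : Set
  State = Fin #states

  -- Is-just is proof-irrelevant: there is at most one edge from s to s′.
  Edge : State → State → Set
  Edge s s′ = Is-just (weight s s′)

  field
    total : ∀ s → ∃[ s′ ] Edge s s′

  w : ∀ {s s′} → Edge s s′ → ℤ
  w = to-witness

  record Play : Set where
    field
      state : ℕ → State
      step  : ∀ i → Edge (state i) (state (suc i))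

  data Prefix (s₀ : State) : State → Set where
    start : Prefix s₀ s₀
    _∷ʳ_  : ∀ {s s′} → Prefix s₀ s → Edge s s′ → Prefix s₀ s′

  Strategy : Player → Set
  Strategy p = ∀ s₀ s → Prefix s₀ s → owner s ≡ p → ∃[ s′ ] Edge s s′

  module _ (σ₁ : Strategy player₁) (σ₂ : Strategy player₂) where

    move : ∀ {s₀ s} → Prefix s₀ s → ∀ p → owner s ≡ p → ∃[ s′ ] Edge s s′
    move h player₁ = σ₁ _ _ h
    move h player₂ = σ₂ _ _ h

    next : ∀ {s₀ s} → Prefix s₀ s → ∃[ s′ ] Edge s s′
    next {s = s} h = move h (owner s) refl

    outcomePrefix : ∀ s₀ → ℕ → Σ State (Prefix s₀)
    outcomePrefix s₀ zero    = s₀ , start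
    outcomePrefix s₀ (suc i) =
      let h = proj₂ (outcomePrefix s₀ i) in
      proj₁ (next h) , h ∷ʳ proj₂ (next h)

    outcome : State → Play
    outcome s₀ = record
      { state = λ i → proj₁ (outcomePrefix s₀ i)
      ; step  = λ i → proj₂ (next (proj₂ (outcomePrefix s₀ i)))
      }

  Objective : Set₁
  Objective = Pred Play 0ℓ

  Winning : Objective → State → Strategy player₁ → Set
  Winning W s σ₁ = ∀ (σ₂ : Strategy player₂) → W (outcome σ₁ σ₂ s)

OnePlayer : Game → Set
OnePlayer G = (∀ s → owner s ≡ player₂) ⊎ (∀ s → owner s ≡ player₁)
  where open Game G

------------------------------------------------------------------------
-- Average-energy

-- An element of ℝ ∪ {±∞}, given by an upward closed set of rationals of
-- which it is the infimum.
UpperReal : Set₁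
UpperReal = Pred ℚ 0ℓ

_≤ᵘ_ : UpperReal → ℚ → Set
P ≤ᵘ t = ∀ ε → 0ℚ ℚ.< ε → P (t ℚ.+ ε)

-- The eventual upper bounds of u are upward closed, with infimum lim sup u.
limsup : (ℕ → ℚ) → UpperReal
limsup u q = ∃[ N ] (∀ n → N ℕ.≤ n → u n ℚ.≤ q)

-- ∑< n f = f 0 + … + f (n − 1)
∑< : ℕ → (ℕ → ℤ) → ℤ
∑< zero    f = 0ℤ
∑< (suc n) f = ∑< n f ℤ.+ f n

module _ (G : Game) where
  open Game G

  EL : Play → ℕ → ℤ
  EL π n = ∑< n (λ i → w (Play.step π i))

  -- The term at index m is (1/n) ∑_{i=1}^{n} EL(π(i)) for n = suc m.
  averages : Play → ℕ → ℚ
  averages π m = ∑< (suc m) (λ i → EL π (suc i)) ℚ./ suc m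

  AE : Play → UpperReal
  AE π = limsup (averages π)

  AvgEnergy : ℚ → Objective
  AvgEnergy t π = AE π ≤ᵘ t

------------------------------------------------------------------------
-- Random access machines with logarithmic cost
--
-- The instruction set and cost criterion of Cook and Reckhow (Time
-- bounded random access machines, 1973), with structured control flow
-- in place of jumps.  There is no multiplication.  Polynomial time on
-- this machine is polynomial time on Turing machines.

data Program : Set where
  skip       : Program
  _⨾_        : Program → Program → Program
  const      : ℕ → ℤ → Program
  add sub    : ℕ → ℕ → ℕ → Program
  load store : ℕ → ℕ → Program
  read       : ℕ → Program
  ifPos      : ℕ → Program → Program → Program
  whilePos   : ℕ → Program → Program

infixr 5 _⨾_

Memory : Set
Memory = ℕ → ℤ

_[_≔_] : Memory → ℕ → ℤ → Memory
(μ [ i ≔ x ]) j = if does (j ≟ i) then x else μ j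

-- Register contents and the unread part of the input.
Config : Set
Config = Memory × List ℤ

bitLength : ℤ → ℕ
bitLength x = suc ⌊log₂ ∣ x ∣ ⌋

-- Run P c T c′: started in c, the program P halts in c′ at cost T.
-- Execution is stuck on negative addresses and on reading past the end
-- of the input.
data Run : Program → Config → ℕ → Config → Set where
  skip  : ∀ {c} → Run skip c 0 c
  seq   : ∀ {P Q c c′ c″ T U} → Run P c T c′ → Run Q c′ U c″ →
          Run (P ⨾ Q) c (T ℕ.+ U) c″
  const : ∀ {i x μ ins} →
          Run (const i x) (μ , ins) (bitLength x) (μ [ i ≔ x ] , ins)
  add   : ∀ {i j k μ ins} →
          Run (add i j k) (μ , ins)
              (bitLength (μ j) ℕ.+ bitLength (μ k))
              (μ [ i ≔ μ j ℤ.+ μ k ] , ins)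
  sub   : ∀ {i j k μ ins} →
          Run (sub i j k) (μ , ins)
              (bitLength (μ j) ℕ.+ bitLength (μ k))
              (μ [ i ≔ μ j ℤ.- μ k ] , ins)
  load  : ∀ {i j a μ ins} → μ j ≡ + a →
          Run (load i j) (μ , ins)
              (bitLength (μ j) ℕ.+ bitLength (μ a))
              (μ [ i ≔ μ a ] , ins)
  store : ∀ {i j a μ ins} → μ i ≡ + a →
          Run (store i j) (μ , ins)
              (bitLength (μ i) ℕ.+ bitLength (μ j))
              (μ [ a ≔ μ j ] , ins)
  read  : ∀ {i x μ ins} →
          Run (read i) (μ , x ∷ ins) (bitLength x) (μ [ i ≔ x ] , ins)
  then′ : ∀ {i P Q μ ins c T} → 0ℤ ℤ.< μ i → Run P (μ , ins) T c →
          Run (ifPos i P Q) (μ , ins) (bitLength (μ i) ℕ.+ T) c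
  else′ : ∀ {i P Q μ ins c T} → μ i ℤ.≤ 0ℤ → Run Q (μ , ins) T c →
          Run (ifPos i P Q) (μ , ins) (bitLength (μ i) ℕ.+ T) c
  loop  : ∀ {i P μ ins c c′ T U} → 0ℤ ℤ.< μ i →
          Run P (μ , ins) T c → Run (whilePos i P) c U c′ →
          Run (whilePos i P) (μ , ins) (bitLength (μ i) ℕ.+ T ℕ.+ U) c′
  exit  : ∀ {i P μ ins} → μ i ℤ.≤ 0ℤ →
          Run (whilePos i P) (μ , ins) (bitLength (μ i)) (μ , ins)

initial : List ℤ → Config
initial ins = (λ _ → 0ℤ) , ins

Accepting : Config → Set
Accepting (μ , _) = 0ℤ ℤ.< μ 0

inputSize : List ℤ → ℕ
inputSize = sum ∘ map bitLength

-- Membership in PTIME of the decision problem Yes, whose instances are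
-- presented to the machine by encode.
InPTIME : {A : Set} → (A → List ℤ) → Pred A 0ℓ → Set
InPTIME encode Yes =
  ∃[ P ] ∃[ k ] ∃[ d ] ∀ a → ∃[ T ] ∃[ c ]
    Run P (initial (encode a)) T c ×
    T ℕ.≤ k ℕ.* inputSize (encode a) ℕ.^ d ℕ.+ k ×
    (Accepting c ⇔ Yes a)

------------------------------------------------------------------------
-- The average-energy problem for one-player games

record Instance : Set where
  field
    game      : Game
    onePlayer : OnePlayer game
    init      : Game.State game
    threshold : ℚ

encodePlayer : Player → ℤ
encodePlayer player₁ = + 1
encodePlayer player₂ = + 2

encodeEdge : Maybe ℤ → List ℤ
encodeEdge nothing  = 0ℤ ∷ []
encodeEdge (just x) = 1ℤ ∷ x ∷ []

-- Number of states, owners, and the weighted adjacency matrix by rows.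
encodeGame : Game → List ℤ
encodeGame G =
  + #states ∷
  map (encodePlayer ∘ owner) (allFin #states) ++
  concatMap (λ s → concatMap (λ s′ → encodeEdge (weight s s′))
                             (allFin #states))
            (allFin #states)
  where open Game G

encodeInstance : Instance → List ℤ
encodeInstance I =
  ↥ threshold ∷ ↧ threshold ∷ + toℕ init ∷ encodeGame game
  where open Instance I

AverageEnergyProblem : Pred Instance 0ℓ
AverageEnergyProblem I =
  ∃[ σ₁ ] Winning (AvgEnergy game threshold) init σ₁
  where
  open Instance I
  open Game game

{-# OPTIONS --safe #-}

-- With a single player the question is whether some play has a small average-energy: for
-- player 1 mean energy at most t, and for player 2, after negating all weights, a play that
-- violates t.  If a negative cycle is reachable, the energy can be driven to -∞.  Otherwise let
-- h s be the least energy with which s can be reached.  Along any play the energy is h plus a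
-- non-decreasing slack, and a good play eventually takes only the edges that leave the slack
-- unchanged, the tight ones; every state is reachable with slack 0, so a good play exists iff
-- the tight edges contain a cycle on which the mean of h is small enough.  Both tests are
-- negative cycle detections, hence two runs of Bellman-Ford, the second with weights
-- n (d h - num) - bias, where t = num / d and n is the number of states.
--
-- A round r + 1 that still lowers the distance of a vertex was preceded by a round that lowered
-- the distance of a predecessor; so a change in round n yields a chain of n + 1 vertices, and
-- its repeated vertex spans a negative cycle, since distances only decrease.
--
-- For a play on which no cycle is found the partial sums are bounded uniformly: a potential for
-- the tight edges pays for tight steps, the other steps increase the slack, and once the slack
-- is large every term is non-negative.
--
-- The algorithm is written in a small language of arrays with bounded loops, compiled to the
-- random access machine.  As the machine cannot multiply, the cost is polynomial as soon as the
-- number of steps is.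
module Submission where

-- The exact threshold is decidable because of a gap. Sum the values d E - num along a play. For
-- player 1 either some play keeps n times this sum bounded above, or on every play it grows at
-- least like m after m steps; a slope of at least 1 / n leaves room for an ε in between. For player
-- 2 the sums are negated and the margin lies on the other side. One parameter b, 1 or 0 according
-- to the player, covers both: `Low` says that n S + (1 - b) m is bounded above on some path, `high`
-- that n S - b m is bounded below on every path. Integrality supplies the unit of margin. Each
-- alternative is read off from the final flag of a Bellman-Ford run, so a lasso or a potential is
-- always at hand and nothing has to be said about optimal strategies. On the machine two loop
-- bounds suffice, n and the binary length of d. Multiplication by n may be repeated addition, since
-- the input lists n owners; d can be exponential in the input size and is processed digit by digit.

-- Logarithmic cost in terms of the number of instructions

module StepCost where
  open import Defs
  open import Data.Bool using (true; false)
  open import Data.Integer using (∣_∣)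
  open import Data.Integer.Properties using (∣i+j∣≤∣i∣+∣j∣; ∣i-j∣≤∣i∣+∣j∣)
  open import Data.List using (_∷_)
  open import Data.List.Relation.Unary.All as All using (All; _∷_)
  open import Data.Nat
  open import Data.Nat.Logarithm using (⌊log₂⌋-mono-≤; ⌊log₂[2^n]⌋≡n)
  open import Data.Nat.Properties
  open import Data.Product using (_×_; _,_; proj₁; proj₂)
  open import Relation.Binary.PropositionalEquality

  steps : ∀ {P c T c′} → Run P c T c′ → ℕ
  steps skip        = 0
  steps (seq r q)   = steps r + steps q
  steps const       = 1
  steps add         = 1
  steps sub         = 1
  steps (load _)    = 1
  steps (store _)   = 1
  steps read        = 1
  steps (then′ _ r) = suc (steps r)
  steps (else′ _ r) = suc (steps r)
  steps (loop _ r q) = suc (steps r + steps q)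
  steps (exit _)    = 1

  -- Constants are the only numbers that a program creates from nothing; their sum is a crude bound
  -- on each of them.
  consts : Program → ℕ
  consts (P ⨾ Q)       = consts P + consts Q
  consts (const _ x)   = ∣ x ∣
  consts (ifPos _ P Q) = consts P + consts Q
  consts (whilePos _ P) = consts P
  consts _             = 0

  n≤2^n : ∀ n → n ≤ 2 ^ n
  n≤2^n zero    = z≤n
  n≤2^n (suc n) = begin
    1 + n           ≤⟨ +-mono-≤ (m^n>0 2 n) (n≤2^n n) ⟩
    2 ^ n + 2 ^ n   ≡⟨ cong (2 ^ n +_) (+-identityʳ (2 ^ n)) ⟨
    2 ^ suc n       ∎
    where open ≤-Reasoning

  bitLength-≤ : ∀ {x b} → ∣ x ∣ ≤ 2 ^ b → bitLength x ≤ suc b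
  bitLength-≤ {b = b} p = s≤s (≤-trans (⌊log₂⌋-mono-≤ p) (≤-reflexive (⌊log₂[2^n]⌋≡n b)))

  -- The unread input is bounded along with the memory because `read` moves its entries there.
  record Bounded (b : ℕ) (c : Config) : Set where
    constructor bounded
    field
      memory : ∀ a → ∣ proj₁ c a ∣ ≤ 2 ^ b
      input  : All (λ x → ∣ x ∣ ≤ 2 ^ b) (proj₂ c)

  bounded-mono : ∀ {b b′ c} → b ≤ b′ → Bounded b c → Bounded b′ c
  bounded-mono b≤ (bounded m i) =
    bounded (λ a → ≤-trans (m a) 2^≤) (All.map (λ p → ≤-trans p 2^≤) i)
    where 2^≤ = ^-monoʳ-≤ 2 b≤

  bounded-write : ∀ {b μ ins x} i → Bounded b (μ , ins) → ∣ x ∣ ≤ 2 ^ b →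
                  Bounded b (μ [ i ≔ x ] , ins)
  bounded-write {μ = μ} {x = x} i (bounded m is) p = bounded bound is
    where
    bound : ∀ a → ∣ (μ [ i ≔ x ]) a ∣ ≤ _
    bound a with a ≡ᵇ i
    ... | true  = p
    ... | false = m a

  double : ∀ b {x y} → x ≤ 2 ^ b → y ≤ 2 ^ b → x + y ≤ 2 ^ (b + 1)
  double b {x} {y} p q = begin
    x + y                ≤⟨ +-mono-≤ p q ⟩
    2 ^ b + 2 ^ b        ≡⟨ cong (2 ^ b +_) (+-identityʳ (2 ^ b)) ⟨
    2 ^ suc b            ≡⟨ cong (2 ^_) (+-comm 1 b) ⟩
    2 ^ (b + 1)          ∎
    where open ≤-Reasoning

  -- An instruction pays for at most two numbers, each of `bitLength` at most `suc b`.
  rate : ℕ → ℕ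
  rate b = 2 * suc b

  rate-mono : ∀ {b b′} → b ≤ b′ → rate b ≤ rate b′
  rate-mono p = *-monoʳ-≤ 2 (s≤s p)

  private
    one : ∀ {b x} → x ≤ suc b → x ≤ 1 * rate (b + 1)
    one {b} {x} p = begin
      x                  ≤⟨ p ⟩
      suc b              ≤⟨ m≤m+n (suc b) _ ⟩
      rate b             ≤⟨ rate-mono (m≤m+n b 1) ⟩
      rate (b + 1)       ≡⟨ *-identityˡ (rate (b + 1)) ⟨
      1 * rate (b + 1)   ∎
      where open ≤-Reasoning

    two : ∀ {b x y} → x ≤ suc b → y ≤ suc b → x + y ≤ 1 * rate (b + 1)
    two {b} {x} {y} p q = begin
      x + y              ≤⟨ +-mono-≤ p q ⟩
      suc b + suc b      ≡⟨ cong (suc b +_) (+-identityʳ (suc b)) ⟨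
      rate b             ≤⟨ rate-mono (m≤m+n b 1) ⟩
      rate (b + 1)       ≡⟨ *-identityˡ (rate (b + 1)) ⟨
      1 * rate (b + 1)   ∎
      where open ≤-Reasoning

    -- Both parts are charged at the final rate, which is the largest.
    chain : ∀ b s t {T U} → T ≤ s * rate (b + s) → U ≤ t * rate ((b + s) + t) →
            T + U ≤ (s + t) * rate (b + (s + t))
    chain b s t {T} {U} p q = begin
      T + U  ≤⟨ +-mono-≤ p q ⟩
      s * rate (b + s) + t * rate (b + s + t)
        ≤⟨ +-monoˡ-≤ _ (*-monoʳ-≤ s (rate-mono (m≤m+n (b + s) t))) ⟩
      s * rate (b + s + t) + t * rate (b + s + t)
        ≡⟨ *-distribʳ-+ (rate (b + s + t)) s t ⟨
      (s + t) * rate (b + s + t)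
        ≡⟨ cong (λ z → (s + t) * rate z) (+-assoc b s t) ⟩
      (s + t) * rate (b + (s + t)) ∎
      where open ≤-Reasoning

    later : ∀ b s {c} → Bounded (b + 1 + s) c → Bounded (b + suc s) c
    later b s = bounded-mono (≤-reflexive (+-assoc b 1 s))

  -- There is no multiplication, so an instruction adds at most one bit to the largest
  -- number in memory: the logarithmic cost is polynomial in the number of steps.
  cost-bound : ∀ {P c T c′} b (r : Run P c T c′) → Bounded b c → consts P ≤ b →
               T ≤ steps r * rate (b + steps r) × Bounded (b + steps r) c′
  cost-bound b skip B _ = z≤n , bounded-mono (m≤m+n b 0) B
  cost-bound b (seq {P} {Q} r q) B C
    with p , B′ ← cost-bound b r B (≤-trans (m≤m+n (consts P) _) C)
    with p′ , B″ ← cost-bound (b + steps r) q B′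
                     (≤-trans (≤-trans (m≤n+m (consts Q) _) C) (m≤m+n b _))
    = chain b (steps r) (steps q) p p′ ,
      bounded-mono (≤-reflexive (+-assoc b (steps r) (steps q))) B″
  cost-bound b (const {i} {x}) B C =
    one (bitLength-≤ {x} x≤) , bounded-mono (m≤m+n b 1) (bounded-write i B x≤)
    where x≤ = ≤-trans C (n≤2^n b)
  cost-bound b (add {i} {j} {k} {μ}) B@(bounded m _) C =
    two (bitLength-≤ {μ j} (m j)) (bitLength-≤ {μ k} (m k)) ,
    bounded-write i (bounded-mono (m≤m+n b 1) B)
      (≤-trans (∣i+j∣≤∣i∣+∣j∣ (μ j) (μ k)) (double b (m j) (m k)))
  cost-bound b (sub {i} {j} {k} {μ}) B@(bounded m _) C =
    two (bitLength-≤ {μ j} (m j)) (bitLength-≤ {μ k} (m k)) ,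
    bounded-write i (bounded-mono (m≤m+n b 1) B)
      (≤-trans (∣i-j∣≤∣i∣+∣j∣ (μ j) (μ k)) (double b (m j) (m k)))
  cost-bound b (load {i} {j} {a} {μ} _) B@(bounded m _) C =
    two (bitLength-≤ {μ j} (m j)) (bitLength-≤ {μ a} (m a)) ,
    bounded-mono (m≤m+n b 1) (bounded-write i B (m a))
  cost-bound b (store {i} {j} {a} {μ} _) B@(bounded m _) C =
    two (bitLength-≤ {μ i} (m i)) (bitLength-≤ {μ j} (m j)) ,
    bounded-mono (m≤m+n b 1) (bounded-write a B (m j))
  cost-bound b (read {i} {x}) (bounded m (p ∷ ps)) C =
    one (bitLength-≤ {x} p) , bounded-mono (m≤m+n b 1) (bounded-write i (bounded m ps) p)
  cost-bound b (then′ {i} {P} {Q} {μ} _ r) B@(bounded m _) C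
    with p , B′ ← cost-bound (b + 1) r (bounded-mono (m≤m+n b 1) B)
                    (≤-trans (≤-trans (m≤m+n (consts P) _) C) (m≤m+n b 1))
    = chain b 1 (steps r) (one (bitLength-≤ {μ i} (m i))) p , later b (steps r) B′
  cost-bound b (else′ {i} {P} {Q} {μ} _ r) B@(bounded m _) C
    with p , B′ ← cost-bound (b + 1) r (bounded-mono (m≤m+n b 1) B)
                    (≤-trans (≤-trans (m≤n+m (consts Q) _) C) (m≤m+n b 1))
    = chain b 1 (steps r) (one (bitLength-≤ {μ i} (m i))) p , later b (steps r) B′
  cost-bound b (loop {i} {P} {μ} {T = T} {U} _ r q) B@(bounded m _) C
    with p , B′ ← cost-bound (b + 1) r (bounded-mono (m≤m+n b 1) B) (≤-trans C (m≤m+n b 1))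
    with p′ , B″ ← cost-bound (b + 1 + steps r) q B′
                     (≤-trans C (≤-trans (m≤m+n b 1) (m≤m+n (b + 1) _)))
    = subst (_≤ suc (steps r + steps q) * rate (b + suc (steps r + steps q)))
        (sym (+-assoc (bitLength (μ i)) T U))
        (chain b 1 (steps r + steps q) (one (bitLength-≤ {μ i} (m i)))
          (chain (b + 1) (steps r) (steps q) p p′)) ,
      later b (steps r + steps q)
        (bounded-mono (≤-reflexive (+-assoc (b + 1) (steps r) (steps q))) B″)
  cost-bound b (exit {i} {P} {μ} _) B@(bounded m _) C =
    one (bitLength-≤ {μ i} (m i)) , bounded-mono (m≤m+n b 1) B

-- A language of arrays with bounded loops, and its memory layout

module Language where
  open import Defs
  open StepCost
  open import Data.Bool using (Bool; true; false; if_then_else_; _∧_; T)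
  open import Data.Empty using (⊥-elim)
  open import Data.Integer as ℤ using (ℤ; +_; +[1+_]; ∣_∣)
  open import Data.List using (List; _∷_)
  open import Data.Maybe using (Maybe; just; nothing)
  open import Data.Fin using (Fin; toℕ; #_)
  open import Data.Fin.Properties using (toℕ<n; toℕ-injective)
  open import Data.Nat
  open import Data.Nat.DivMod using (_%_; [m+kn]%n≡m%n; m<n⇒m%n≡m)
  open import Data.Nat.Properties
  open import Data.Product using (_,_)
  open import Data.Unit using (tt)
  open import Function using (_∘_; case_of_)
  open import Relation.Binary.PropositionalEquality

  -- Addresses are split by their residue modulo 64: residues below 32 belong to the arrays, 32 to
  -- temporaries, 33 to loop counters, 34 and 35 to the loop bounds.
  Var : Set
  Var = Fin 32

  -- `result` has code 0 because acceptance inspects register 0, the address of its entry at index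
  -- 0.
  result num den source order player edges weights dist reach dist′ reach′ changed bestR bestD
    active arc row col ptr height seen gain power digits digit accum remain aux : Var
  result  = # 0
  num     = # 1
  den     = # 2
  source  = # 3
  order   = # 4
  player  = # 5
  edges   = # 6
  weights = # 7
  dist    = # 8
  reach   = # 9
  dist′   = # 10
  reach′  = # 11
  changed = # 12
  bestR   = # 13
  bestD   = # 14
  active  = # 15
  arc     = # 16
  row     = # 17
  col     = # 18
  ptr     = # 19
  height  = # 20
  seen    = # 21
  gain    = # 22
  power   = # 23
  digits  = # 24
  digit   = # 25
  accum   = # 26
  remain  = # 27
  aux     = # 28

  data Bound : Set where
    states bits : Bound

  code : Var → ℕ
  code = toℕ

  boundCode : Bound → ℕ
  boundCode states = 34
  boundCode bits   = 35

  -- Every variable is an infinite array, a scalar being the entry at index 0; the array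
  -- element vis a i is stored at address code a + 64 i.  Indices are taken in absolute value.
  data Exp : Set where
    lit     : ℤ → Exp
    _[_]    : Var → Exp → Exp
    _⊕_ _⊖_ : Exp → Exp → Exp

  infixl 8 _⊕_ _⊖_

  infix  6 _[_]≔_
  infixr 5 _⨾_

  -- The loop bounds live in registers that no command can write, which makes the cost of a
  -- command a polynomial in them.
  data Cmd : Set where
    skip   : Cmd
    _⨾_    : Cmd → Cmd → Cmd
    _[_]≔_ : Var → Exp → Exp → Cmd
    read   : Var → Cmd
    ifPos  : Exp → Cmd → Cmd → Cmd
    loop   : Bound → Cmd → Cmd

  Store : Set
  Store = Var → ℕ → ℤ

  infixl 5 _⟨_,_⟩≔_

  -- Codes are compared by a Boolean test, so writes to two named variables are told apart by
  -- computation alone.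
  _⟨_,_⟩≔_ : Store → Var → ℕ → ℤ → Store
  (s ⟨ a , n ⟩≔ v) b m = if (code b ≡ᵇ code a) ∧ (m ≡ᵇ n) then v else s b m

  -- The input component is nothing once the program has read past the end.
  record State : Set where
    constructor state
    field
      mem : Store
      inp : Maybe (List ℤ)
  open State public

  eval : Exp → Store → ℤ
  eval (lit v)   s = v
  eval (a [ f ]) s = s a ∣ eval f s ∣
  eval (f ⊕ g)   s = eval f s ℤ.+ eval g s
  eval (f ⊖ g)   s = eval f s ℤ.- eval g s

  positive : ℤ → Bool
  positive +[1+ _ ] = true
  positive _        = false

  iter : ∀ {A : Set} → ℕ → (A → A) → A → A
  iter zero    f a = a
  iter (suc n) f a = iter n f (f a)

  -- Abstract, so that comparing the meanings of two programs does not unroll their loops.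
  abstract
    repeat : ∀ {A : Set} → ℕ → (A → A) → A → A
    repeat = iter

    repeat≡ : ∀ {A : Set} n (f : A → A) a → repeat n f a ≡ iter n f a
    repeat≡ n f a = refl

  input : Var → State → State
  input a (state s (just (v ∷ vs))) = state (s ⟨ a , 0 ⟩≔ v) (just vs)
  input a (state s _)               = state s nothing

  module Semantics (β : Bound → ℕ) where

    ⟦_⟧ : Cmd → State → State
    ⟦ skip ⟧ st        = st
    ⟦ P ⨾ Q ⟧ st       = ⟦ Q ⟧ (⟦ P ⟧ st)
    ⟦ a [ f ]≔ g ⟧ st  = state (mem st ⟨ a , ∣ eval f (mem st) ∣ ⟩≔ eval g (mem st)) (inp st)
    ⟦ read a ⟧ st      = input a st
    ⟦ ifPos f P Q ⟧ st = if positive (eval f (mem st)) then ⟦ P ⟧ st else ⟦ Q ⟧ st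
    ⟦ loop b P ⟧ st    = repeat (β b) ⟦ P ⟧ st

    -- Failure to read is permanent. A hypothesis on the final input therefore guarantees every
    -- intermediate read.
    failed : ∀ c {st} → inp st ≡ nothing → inp (⟦ c ⟧ st) ≡ nothing
    failed skip p = p
    failed (P ⨾ Q) p = failed Q (failed P p)
    failed (a [ f ]≔ g) p = p
    failed (read a) {state s nothing} p = refl
    failed (ifPos f P Q) {st} p with positive (eval f (mem st))
    ... | true  = failed P p
    ... | false = failed Q p
    failed (loop b P) {st} p = trans (cong inp (repeat≡ (β b) ⟦ P ⟧ st)) (go (β b) p)
      where
      go : ∀ n {st} → inp st ≡ nothing → inp (iter n ⟦ P ⟧ st) ≡ nothing
      go zero    p = p
      go (suc n) p = go n (failed P p)

  abstract
    execute : (Bound → ℕ) → Cmd → State → State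
    execute = Semantics.⟦_⟧

    execute≡ : ∀ β c st → execute β c st ≡ Semantics.⟦_⟧ β c st
    execute≡ β c st = refl

  -- Temporaries are numbered by the depth of an expression, counters by the nesting depth of loops.
  data Loc : Set where
    vis     : Var → ℕ → Loc
    tmp cnt : ℕ → Loc
    bnd     : Bound → Loc

  residue index addr : Loc → ℕ
  residue (vis a _) = code a
  residue (tmp _)   = 32
  residue (cnt _)   = 33
  residue (bnd b)   = boundCode b
  index (vis _ n) = n
  index (tmp n)   = n
  index (cnt n)   = n
  index (bnd _)   = 0
  addr ℓ = residue ℓ + index ℓ * 64

  residue<64 : ∀ ℓ → residue ℓ < 64
  residue<64 (vis a _)    = ≤-trans (toℕ<n a) (m≤m+n 32 32)
  residue<64 (tmp _)      = m≤m+n 33 31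
  residue<64 (cnt _)      = m≤m+n 34 30
  residue<64 (bnd states) = m≤m+n 35 29
  residue<64 (bnd bits)   = m≤m+n 36 28

  residue-index-injective : ∀ ℓ ℓ′ → residue ℓ ≡ residue ℓ′ → index ℓ ≡ index ℓ′ → ℓ ≡ ℓ′
  residue-index-injective (vis a _) (vis b _) p refl = cong (λ z → vis z _) (toℕ-injective p)
  residue-index-injective (vis a _) (tmp _) p _ = ⊥-elim (<⇒≢ (toℕ<n a) p)
  residue-index-injective (vis a _) (cnt _) p _ = ⊥-elim (<⇒≢ (≤-trans (toℕ<n a) (m≤m+n 32 1)) p)
  residue-index-injective (vis a _) (bnd states) p _ =
    ⊥-elim (<⇒≢ (≤-trans (toℕ<n a) (m≤m+n 32 2)) p)
  residue-index-injective (vis a _) (bnd bits) p _ =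
    ⊥-elim (<⇒≢ (≤-trans (toℕ<n a) (m≤m+n 32 3)) p)
  residue-index-injective (tmp _) (vis b _) p _ = ⊥-elim (<⇒≢ (toℕ<n b) (sym p))
  residue-index-injective (cnt _) (vis b _) p _ =
    ⊥-elim (<⇒≢ (≤-trans (toℕ<n b) (m≤m+n 32 1)) (sym p))
  residue-index-injective (bnd states) (vis b _) p _ =
    ⊥-elim (<⇒≢ (≤-trans (toℕ<n b) (m≤m+n 32 2)) (sym p))
  residue-index-injective (bnd bits) (vis b _) p _ =
    ⊥-elim (<⇒≢ (≤-trans (toℕ<n b) (m≤m+n 32 3)) (sym p))
  residue-index-injective (tmp _) (tmp _) _ refl = refl
  residue-index-injective (cnt _) (cnt _) _ refl = refl
  residue-index-injective (bnd states) (bnd states) _ _ = refl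
  residue-index-injective (bnd bits) (bnd bits) _ _ = refl
  residue-index-injective (tmp _) (bnd states) ()
  residue-index-injective (tmp _) (bnd bits) ()
  residue-index-injective (cnt _) (bnd states) ()
  residue-index-injective (cnt _) (bnd bits) ()
  residue-index-injective (bnd states) (tmp _) ()
  residue-index-injective (bnd bits) (tmp _) ()
  residue-index-injective (bnd states) (cnt _) ()
  residue-index-injective (bnd bits) (cnt _) ()

  addr-injective : ∀ {ℓ ℓ′} → addr ℓ ≡ addr ℓ′ → ℓ ≡ ℓ′
  addr-injective {ℓ} {ℓ′} p = residue-index-injective ℓ ℓ′ r≡
      (*-cancelʳ-≡ (index ℓ) (index ℓ′) 64
        (+-cancelˡ-≡ (residue ℓ) _ _ (trans p (cong (_+ index ℓ′ * 64) (sym r≡)))))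
    where
    mod : ∀ ℓ → addr ℓ % 64 ≡ residue ℓ
    mod ℓ = trans ([m+kn]%n≡m%n (residue ℓ) (index ℓ) 64) (m<n⇒m%n≡m (residue<64 ℓ))
    r≡ = trans (sym (mod ℓ)) (trans (cong (_% 64) p) (mod ℓ′))

  ≡ᵇ-refl : ∀ n → (n ≡ᵇ n) ≡ true
  ≡ᵇ-refl zero    = refl
  ≡ᵇ-refl (suc n) = ≡ᵇ-refl n

  ≢⇒≡ᵇ : ∀ {m n} → m ≢ n → (m ≡ᵇ n) ≡ false
  ≢⇒≡ᵇ {m} {n} p with m ≡ᵇ n in eq
  ... | false = refl
  ... | true  = ⊥-elim (p (≡ᵇ⇒≡ m n (subst T (sym eq) tt)))

  written : ∀ (μ : Memory) {v} a → (μ [ a ≔ v ]) a ≡ v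
  written μ a rewrite ≡ᵇ-refl a = refl

  unwritten : ∀ (μ : Memory) {v ℓ} ℓ′ → ℓ′ ≢ ℓ → (μ [ addr ℓ ≔ v ]) (addr ℓ′) ≡ μ (addr ℓ′)
  unwritten μ {v} {ℓ} ℓ′ p rewrite ≢⇒≡ᵇ {addr ℓ′} {addr ℓ} (p ∘ addr-injective {ℓ′} {ℓ}) = refl

  record Represents (μ : Memory) (s : Store) : Set where
    constructor representing
    field
      entry : ∀ a n → μ (addr (vis a n)) ≡ s a n
  open Represents public

  represents-write : ∀ {μ s} a n v → Represents μ s →
                     Represents (μ [ addr (vis a n) ≔ v ]) (s ⟨ a , n ⟩≔ v)
  represents-write {μ} {s} a n v R = representing write
    where
    write : ∀ b m → (μ [ addr (vis a n) ≔ v ]) (addr (vis b m)) ≡ (s ⟨ a , n ⟩≔ v) b m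
    write b m with code b ≡ᵇ code a in p | m ≡ᵇ n in q
    ... | true  | true
      rewrite toℕ-injective {i = b} {a} (≡ᵇ⇒≡ _ _ (subst T (sym p) tt))
            | ≡ᵇ⇒≡ m n (subst T (sym q) tt) = written μ (addr (vis a n))
    ... | true  | false = trans (unwritten μ {v} {vis a n} (vis b m)
                            λ { refl → case trans (sym q) (≡ᵇ-refl m) of λ () }) (entry R b m)
    ... | false | _     = trans (unwritten μ {v} {vis a n} (vis b m)
                            λ { refl → case trans (sym p) (≡ᵇ-refl (code b)) of λ () }) (entry R b m)

  represents-cong : ∀ {μ μ′ s} → (∀ a n → μ′ (addr (vis a n)) ≡ μ (addr (vis a n))) →
                    Represents μ s → Represents μ′ s
  represents-cong p R = representing λ a n → trans (p a n) (entry R a n)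

-- Compilation to the random access machine

module Compiler where
  open import Defs
  open StepCost
  open Language
  open import Data.Bool using (true; false)
  open import Data.Integer as ℤ using (ℤ; +_; +[1+_]; -[1+_]; 0ℤ; 1ℤ; ∣_∣; +<+; -≤+)
  import Data.Integer.Properties as ℤ
  open import Data.List using (List; _∷_)
  open import Data.Maybe using (just; nothing)
  open import Data.Nat
  open import Data.Nat.Properties
  open import Data.Product using (_,_)
  open import Function using (case_of_)
  open import Relation.Binary.PropositionalEquality
  open import Relation.Nullary using (¬_)

  τ κ : ℕ → ℕ
  τ n = addr (tmp n)
  κ n = addr (cnt n)

  -- Address computation multiplies only by 64, that is, doubles six times.
  shift : ℕ → ℕ → Program
  shift zero    d = skip
  shift (suc n) d = add (τ d) (τ d) (τ d) ⨾ shift n d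

  absolute : ℕ → Program
  absolute d = ifPos (τ d) skip (const (τ (suc d)) 0ℤ ⨾ sub (τ d) (τ (suc d)) (τ d))

  -- The value of an expression is left in τ d, that of an index as an address.
  compileExp   : Exp → ℕ → Program
  compileIndex : Var → Exp → ℕ → Program
  compileExp (lit v)   d = const (τ d) v
  compileExp (a [ f ]) d = compileIndex a f d ⨾ load (τ d) (τ d)
  compileExp (f ⊕ g)   d =
    compileExp f d ⨾ compileExp g (suc d) ⨾ add (τ d) (τ d) (τ (suc d))
  compileExp (f ⊖ g)   d =
    compileExp f d ⨾ compileExp g (suc d) ⨾ sub (τ d) (τ d) (τ (suc d))
  compileIndex a f d =
    compileExp f d ⨾ absolute d ⨾ shift 6 d ⨾
    const (τ (suc d)) (+ code a) ⨾ add (τ d) (τ d) (τ (suc d))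

  compile : Cmd → ℕ → Program
  compile skip           d = skip
  compile (P ⨾ Q)        d = compile P d ⨾ compile Q d
  compile (a [ f ]≔ g)   d = compileIndex a f 0 ⨾ compileExp g 1 ⨾ store (τ 0) (τ 1)
  compile (read a)       d = read (addr (vis a 0))
  compile (ifPos f P Q)  d = compileExp f 0 ⨾ ifPos (τ 0) (compile P d) (compile Q d)
  compile (loop b P)     d =
    -- The machine has no move instruction: the bound is copied by adding 0.
    const (τ 0) 0ℤ ⨾ add (κ d) (addr (bnd b)) (τ 0) ⨾
    whilePos (κ d) (const (τ 0) 1ℤ ⨾ sub (κ d) (κ d) (τ 0) ⨾ compile P (suc d))

  -- A total correctness triple that also bounds the number of instructions.
  record Exec (P : Program) (μ : Memory) (ins : List ℤ) (n : ℕ) (ins′ : List ℤ)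
              (Φ : Memory → Set) : Set where
    constructor exec
    field
      {time} : ℕ
      {end}  : Memory
      run    : Run P (μ , ins) time (end , ins′)
      steps≤ : steps run ≤ n
      post   : Φ end
  open Exec public

  bind : ∀ {P Q μ ins ins′ ins″ m n Φ Ψ} → Exec P μ ins m ins′ Φ →
         (∀ {μ′} → Φ μ′ → Exec Q μ′ ins′ n ins″ Ψ) → Exec (P ⨾ Q) μ ins (m + n) ins″ Ψ
  bind (exec r p φ) f with f φ
  ... | exec r′ p′ ψ = exec (seq r r′) (+-mono-≤ p p′) ψ

  map-post : ∀ {P μ ins ins′ n} {Φ Ψ : Memory → Set} → (∀ {μ′} → Φ μ′ → Ψ μ′) →
             Exec P μ ins n ins′ Φ → Exec P μ ins n ins′ Ψ
  map-post f (exec r q φ) = exec r q (f φ)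

  exec-const : ∀ {i v μ ins} → Exec (const i v) μ ins 1 ins (_≡ μ [ i ≔ v ])
  exec-const = exec const ≤-refl refl

  exec-add : ∀ {i j k μ ins} → Exec (add i j k) μ ins 1 ins (_≡ μ [ i ≔ μ j ℤ.+ μ k ])
  exec-add = exec add ≤-refl refl

  exec-sub : ∀ {i j k μ ins} → Exec (sub i j k) μ ins 1 ins (_≡ μ [ i ≔ μ j ℤ.- μ k ])
  exec-sub = exec sub ≤-refl refl

  -- Evaluation at depth d may overwrite the temporaries from d upwards, so a left operand kept at d
  -- survives the evaluation of the right one at `suc d`.
  data Scratch (d : ℕ) : Loc → Set where
    scratch : ∀ {n} → d ≤ n → Scratch d (tmp n)

  record Evaluated (d : ℕ) (v : ℤ) (μ μ′ : Memory) : Set where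
    constructor evaluated
    field
      value : μ′ (τ d) ≡ v
      frame : ∀ ℓ → ¬ Scratch d ℓ → μ′ (addr ℓ) ≡ μ (addr ℓ)
  open Evaluated public

  not-at : ∀ {d ℓ} → ¬ Scratch d ℓ → ℓ ≢ tmp d
  not-at n refl = n (scratch ≤-refl)

  below : ∀ {d ℓ} → ¬ Scratch d ℓ → ¬ Scratch (suc d) ℓ
  below n (scratch p) = n (scratch (≤-trans (n≤1+n _) p))

  top-kept : ∀ {d} → ¬ Scratch (suc d) (tmp d)
  top-kept (scratch p) = 1+n≰n p

  evaluated-trans : ∀ {d v v′ μ μ′ μ″} → Evaluated d v μ μ′ → Evaluated d v′ μ′ μ″ →
                    Evaluated d v′ μ μ″
  evaluated-trans p q = evaluated (value q) λ ℓ n → trans (frame q ℓ n) (frame p ℓ n)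

  evaluated-write : ∀ {d v} μ → Evaluated d v μ (μ [ τ d ≔ v ])
  evaluated-write {d} μ = evaluated (written μ (τ d)) λ ℓ n → unwritten μ {ℓ = tmp d} ℓ (not-at n)

  shift-correct : ∀ n d {μ ins m} → μ (τ d) ≡ + m →
                  Exec (shift n d) μ ins n ins (Evaluated d (+ (m * 2 ^ n)) μ)
  shift-correct zero d {m = m} p =
    exec skip z≤n (evaluated (trans p (cong +_ (sym (*-identityʳ m)))) λ _ _ → refl)
  shift-correct (suc n) d {μ} {m = m} p =
    bind (exec-add {τ d} {τ d} {τ d}) λ { refl →
      map-post (λ {ν} E → subst (λ z → Evaluated d (+ z) μ ν) eq
                        (evaluated-trans (evaluated-write μ) E))
        (shift-correct n d (trans (written μ (τ d)) (cong₂ ℤ._+_ p p))) }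
    where
    eq : (m + m) * 2 ^ n ≡ m * 2 ^ suc n
    eq = trans (cong (_* 2 ^ n) (trans (cong (λ z → m + z) (sym (+-identityʳ m))) (*-comm 2 m)))
               (*-assoc m 2 (2 ^ n))

  absolute-correct : ∀ d {μ ins v} → μ (τ d) ≡ v →
                     Exec (absolute d) μ ins 3 ins (Evaluated d (+ ∣ v ∣) μ)
  absolute-correct d {μ} {ins} {v} p = cases v refl
    where
    ν = μ [ τ (suc d) ≔ 0ℤ ]

    negate : v ℤ.≤ 0ℤ → 0ℤ ℤ.- v ≡ + ∣ v ∣ →
             Exec (absolute d) μ ins 3 ins (Evaluated d (+ ∣ v ∣) μ)
    negate v≤0 eq = exec (else′ (subst (ℤ._≤ 0ℤ) (sym p) v≤0) (seq const sub)) ≤-refl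
      (evaluated
        (trans (written ν (τ d)) (trans (cong₂ ℤ._-_ (written μ (τ (suc d)))
          (trans (unwritten μ {ℓ = tmp (suc d)} (tmp d) λ ()) p)) eq))
        λ ℓ n → trans (unwritten ν {ℓ = tmp d} ℓ (not-at n))
                      (unwritten μ {ℓ = tmp (suc d)} ℓ (not-at (below n))))

    cases : ∀ u → u ≡ v → Exec (absolute d) μ ins 3 ins (Evaluated d (+ ∣ v ∣) μ)
    cases +[1+ n ] refl =
      exec (then′ (subst (0ℤ ℤ.<_) (sym p) (+<+ z<s)) skip) (m≤m+n 1 2) (evaluated p λ _ _ → refl)
    cases (+ zero) refl = negate ℤ.≤-refl refl
    cases -[1+ n ] refl = negate -≤+ refl

  represents-frame : ∀ {d v μ μ′ s} → Evaluated d v μ μ′ → Represents μ s → Represents μ′ s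
  represents-frame E = represents-cong λ a n → frame E (vis a n) λ ()

  expCost indexCost : Exp → ℕ
  expCost (lit _)   = 1
  expCost (_ [ f ]) = indexCost f + 1
  expCost (f ⊕ g)   = expCost f + (expCost g + 1)
  expCost (f ⊖ g)   = expCost f + (expCost g + 1)
  -- At most three instructions for `absolute`, six doublings, then the code of the array and its
  -- addition.
  indexCost f       = expCost f + (3 + (6 + (1 + 1)))

  combined : ∀ {d u v μ₀ μ₁} (_∙_ : ℤ → ℤ → ℤ) {μ} → Evaluated d u μ₀ μ₁ → Evaluated (suc d) v μ₁ μ →
             Evaluated d (u ∙ v) μ₀ (μ [ τ d ≔ μ (τ d) ∙ μ (τ (suc d)) ])
  combined {d} _∙_ {μ} E E′ = evaluated
    (trans (written μ (τ d)) (cong₂ _∙_ (trans (frame E′ (tmp d) top-kept) (value E)) (value E′)))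
    λ ℓ n → trans (unwritten μ {ℓ = tmp d} ℓ (not-at n)) (trans (frame E′ ℓ (below n)) (frame E ℓ n))

  exp-correct : ∀ f d {μ ins s} → Represents μ s →
                Exec (compileExp f d) μ ins (expCost f) ins (Evaluated d (eval f s) μ)
  index-correct : ∀ a f d {μ ins s} → Represents μ s →
                  Exec (compileIndex a f d) μ ins (indexCost f) ins
                       (Evaluated d (+ addr (vis a ∣ eval f s ∣)) μ)

  exp-correct (lit v) d {μ} R = map-post (λ { refl → evaluated-write μ }) exec-const
  exp-correct (a [ f ]) d {s = s} R = bind (index-correct a f d R) λ {μ} E →
    exec (load (value E)) ≤-refl
      (evaluated-trans E (subst (λ z → Evaluated d z μ (μ [ τ d ≔ μ (addr (vis a ∣ eval f s ∣)) ]))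
        (entry (represents-frame E R) a ∣ eval f s ∣) (evaluated-write μ)))
  exp-correct (f ⊕ g) d R = bind (exp-correct f d R) λ E →
    bind (exp-correct g (suc d) (represents-frame E R)) λ {μ} E′ → exec add ≤-refl (combined ℤ._+_ {μ = μ} E E′)
  exp-correct (f ⊖ g) d R = bind (exp-correct f d R) λ E →
    bind (exp-correct g (suc d) (represents-frame E R)) λ {μ} E′ → exec sub ≤-refl (combined ℤ._-_ {μ = μ} E E′)
  index-correct a f d {s = s} R = bind (exp-correct f d R) λ E₁ →
    bind (absolute-correct d (value E₁)) λ E₂ →
    bind (shift-correct 6 d (value E₂)) λ {μ₃} E₃ →
    bind exec-const λ { refl → exec add ≤-refl
      (evaluated
        (trans (written (μ₃ [ τ (suc d) ≔ + code a ]) (τ d)) (trans (cong₂ ℤ._+_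
          (trans (unwritten μ₃ {ℓ = tmp (suc d)} (tmp d) λ ()) (value E₃)) (written μ₃ (τ (suc d))))
          (cong +_ (+-comm (∣ eval f s ∣ * 64) (code a)))))
        λ ℓ n → trans (unwritten (μ₃ [ τ (suc d) ≔ + code a ]) {ℓ = tmp d} ℓ (not-at n))
               (trans (unwritten μ₃ {ℓ = tmp (suc d)} ℓ (not-at (below n)))
               (trans (frame E₃ ℓ n) (trans (frame E₂ ℓ n) (frame E₁ ℓ n))))) }

  -- Apart from the represented store, only the loop bounds and the counters of the enclosing loops
  -- have to survive a command; temporaries never live across commands.
  data Kept (d : ℕ) : Loc → Set where
    bound   : ∀ {b} → Kept d (bnd b)
    counter : ∀ {n} → n < d → Kept d (cnt n)

  kept-suc : ∀ {d ℓ} → Kept d ℓ → Kept (suc d) ℓ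
  kept-suc bound       = bound
  kept-suc (counter p) = counter (≤-trans p (n≤1+n _))

  kept-scratch : ∀ {d d′ ℓ} → Kept d ℓ → ¬ Scratch d′ ℓ
  kept-scratch bound       ()
  kept-scratch (counter _) ()

  kept≢ : ∀ {d ℓ} → Kept d ℓ → ℓ ≢ cnt d
  kept≢ (counter p) refl = 1+n≰n p

  kept≢vis : ∀ {d ℓ a n} → Kept d ℓ → ℓ ≢ vis a n
  kept≢vis () refl

  record Executed (d : ℕ) (s : Store) (μ μ′ : Memory) : Set where
    constructor executed
    field
      represents : Represents μ′ s
      keeps      : ∀ ℓ → Kept d ℓ → μ′ (addr ℓ) ≡ μ (addr ℓ)
  open Executed public

  executed-after : ∀ {d v s μ μ′ μ″} → Evaluated 0 v μ μ′ → Executed d s μ′ μ″ → Executed d s μ μ″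
  executed-after E X = executed (represents X) λ ℓ q →
    trans (keeps X ℓ q) (frame E ℓ (kept-scratch q))

  positive-pos : ∀ {v} → positive v ≡ true → 0ℤ ℤ.< v
  positive-pos {+[1+ _ ]} _ = +<+ z<s

  positive-neg : ∀ {v} → positive v ≡ false → v ℤ.≤ 0ℤ
  positive-neg {+ zero}   _ = ℤ.≤-refl
  positive-neg { -[1+ _ ]} _ = -≤+

  module Correctness (β : Bound → ℕ) where
    open Semantics β

    cmdCost : Cmd → ℕ
    cmdCost skip          = 0
    cmdCost (P ⨾ Q)       = cmdCost P + cmdCost Q
    cmdCost (_ [ f ]≔ g)  = indexCost f + (expCost g + 1)
    cmdCost (read _)      = 1
    cmdCost (ifPos f P Q) = expCost f + suc (cmdCost P + cmdCost Q)
    -- Each turn adds the test of the counter and its two-instruction decrement to the body; the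
    -- last 1 is the failing test, the first two set up the counter.
    cmdCost (loop b P)    = 1 + (1 + (β b * suc (1 + (1 + cmdCost P)) + 1))

    record HasBounds (μ : Memory) : Set where
      constructor bounds
      field
        value-of : ∀ b → μ (addr (bnd b)) ≡ + β b
    open HasBounds public

    bounds-kept : ∀ {d s μ μ′} → Executed d s μ μ′ → HasBounds μ → HasBounds μ′
    bounds-kept X H = bounds λ b → trans (keeps X (bnd b) bound) (value-of H b)

    bounds-frame : ∀ {d v μ μ′} → Evaluated d v μ μ′ → HasBounds μ → HasBounds μ′
    bounds-frame E H = bounds λ b → trans (frame E (bnd b) λ ()) (value-of H b)

    compile-correct : ∀ c d {st μ ins ins′} → Represents μ (mem st) → HasBounds μ →
      inp st ≡ just ins → inp (⟦ c ⟧ st) ≡ just ins′ →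
      Exec (compile c d) μ ins (cmdCost c) ins′ (Executed d (mem (⟦ c ⟧ st)) μ)
    compile-correct skip d R H p q with refl ← trans (sym p) q =
      exec skip ≤-refl (executed R λ _ _ → refl)
    compile-correct (P ⨾ Q) d {st} R H p q with inp (⟦ P ⟧ st) in eq
    ... | nothing = case trans (sym (failed Q eq)) q of λ ()
    ... | just _  = bind (compile-correct P d R H p eq) λ X →
      map-post (λ Y → executed (represents Y) λ ℓ k → trans (keeps Y ℓ k) (keeps X ℓ k))
        (compile-correct Q d (represents X) (bounds-kept X H) eq q)
    compile-correct (a [ f ]≔ g) d {st} {μ} R H p q with refl ← trans (sym p) q =
      bind (index-correct a f 0 R) λ E →
      bind (exp-correct g 1 (represents-frame E R)) λ {μ′} E′ →
      exec (store {i = τ 0} {j = τ 1} (trans (frame E′ (tmp 0) top-kept) (value E))) ≤-refl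
        (executed
          (subst (λ z → Represents (μ′ [ addr (vis a n) ≔ z ]) (mem (⟦ a [ f ]≔ g ⟧ st)))
            (sym (value E′))
            (represents-write a n (eval g (mem st)) (represents-frame E′ (represents-frame E R))))
          λ ℓ k → trans (unwritten μ′ {ℓ = vis a n} ℓ (kept≢vis k))
                 (trans (frame E′ ℓ (kept-scratch k)) (frame E ℓ (kept-scratch k))))
      where n = ∣ eval f (mem st) ∣
    compile-correct (read a) d {state s (just (v ∷ vs))} {μ} R H refl refl =
      exec read ≤-refl
        (executed (represents-write a 0 v R) λ ℓ k → unwritten μ {ℓ = vis a 0} ℓ (kept≢vis k))
    compile-correct (ifPos f P Q) d {st} R H p q with positive (eval f (mem st)) in eq
    ... | true  = bind (exp-correct f 0 R) λ E →
      case compile-correct P d (represents-frame E R) (bounds-frame E H) p q of λ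
        { (exec r r≤ X) →
          exec (then′ (subst (0ℤ ℤ.<_) (sym (value E)) (positive-pos eq)) r)
            (s≤s (≤-trans r≤ (m≤m+n _ _))) (executed-after E X) }
    ... | false = bind (exp-correct f 0 R) λ E →
      case compile-correct Q d (represents-frame E R) (bounds-frame E H) p q of λ
        { (exec r r≤ X) →
          exec (else′ (subst (ℤ._≤ 0ℤ) (sym (value E)) (positive-neg eq)) r)
            (s≤s (≤-trans r≤ (m≤n+m _ _))) (executed-after E X) }
    compile-correct (loop b P) d {st} {μ₀} {ins₀} {ins₁} R₀ H₀ p₀ q₀ rewrite repeat≡ (β b) ⟦ P ⟧ st =
      bind exec-const λ { refl → bind exec-add λ { refl →
        map-post
          (λ X → executed (represents X) λ ℓ k → trans (keeps X ℓ k) (initial-frame ℓ k))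
          (while (β b) st (represents-cong (λ a n → trans (unwritten μ₁ {ℓ = cnt d} (vis a n) λ ())
                                                         (unwritten μ₀ {ℓ = tmp 0} (vis a n) λ ())) R₀)
            (bounds λ b′ → trans (initial-frame (bnd b′) bound) (value-of H₀ b′))
            (trans (written μ₁ (κ d)) (trans (cong₂ ℤ._+_
               (trans (unwritten μ₀ {ℓ = tmp 0} (bnd b) λ ()) (value-of H₀ b)) (written μ₀ (τ 0)))
               (ℤ.+-identityʳ (+ β b))))
            p₀ q₀) } }
      where
      μ₁ = μ₀ [ τ 0 ≔ 0ℤ ]
      μ₂ = μ₁ [ κ d ≔ μ₁ (addr (bnd b)) ℤ.+ μ₁ (τ 0) ]

      frame₂ : ∀ μ {u v} ℓ → Kept d ℓ →
               (μ [ τ 0 ≔ u ] [ κ d ≔ v ]) (addr ℓ) ≡ μ (addr ℓ)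
      frame₂ μ {u} ℓ k = trans (unwritten (μ [ τ 0 ≔ u ]) {ℓ = cnt d} ℓ (kept≢ k))
                             (unwritten μ {ℓ = tmp 0} ℓ (not-at (kept-scratch k)))

      initial-frame : ∀ ℓ → Kept d ℓ → μ₂ (addr ℓ) ≡ μ₀ (addr ℓ)
      initial-frame = frame₂ μ₀

      body = const (τ 0) 1ℤ ⨾ sub (κ d) (κ d) (τ 0) ⨾ compile P (suc d)

      -- By induction on the counter at nesting depth `d`: the body is compiled at depth `suc d` and
      -- therefore keeps it.
      while : ∀ n st {μ ins} → Represents μ (mem st) → HasBounds μ → μ (κ d) ≡ + n →
              inp st ≡ just ins → inp (iter n ⟦ P ⟧ st) ≡ just ins₁ →
              Exec (whilePos (κ d) body) μ ins (n * suc (1 + (1 + cmdCost P)) + 1) ins₁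
                   (Executed d (mem (iter n ⟦ P ⟧ st)) μ)
      while zero st R H c p q with refl ← trans (sym p) q =
        exec (exit (subst (ℤ._≤ 0ℤ) (sym c) ℤ.≤-refl)) ≤-refl (executed R λ _ _ → refl)
      while (suc n) st {μ} {ins} R H c p q with inp (⟦ P ⟧ st) in eq
      ... | nothing = case trans (sym (stuck n (⟦ P ⟧ st) eq)) q of λ ()
        where
        stuck : ∀ n st → inp st ≡ nothing → inp (iter n ⟦ P ⟧ st) ≡ nothing
        stuck zero    st p = p
        stuck (suc n) st p = stuck n (⟦ P ⟧ st) (failed P p)
      ... | just ins′ = combine turn λ X →
            while n (⟦ P ⟧ st) (represents X) (bounds-kept X H₂)
              (trans (keeps X (cnt d) (counter ≤-refl)) (written ν₁ (κ d))) eq q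
        where
        ν₁ = μ [ τ 0 ≔ 1ℤ ]
        ν₂ = ν₁ [ κ d ≔ + n ]

        H₂ : HasBounds ν₂
        H₂ = bounds λ b′ → trans (frame₂ μ (bnd b′) bound) (value-of H b′)

        minus : (ν₁ (κ d)) ℤ.- (ν₁ (τ 0)) ≡ + n
        minus = cong₂ ℤ._-_ {u = ν₁ (τ 0)} {v = 1ℤ} (trans (unwritten μ {1ℤ} {ℓ = tmp 0} (cnt d) λ ()) c) (written μ (τ 0))

        turn : Exec body μ ins (1 + (1 + cmdCost P)) ins′
                    (Executed (suc d) (mem (⟦ P ⟧ st)) ν₂)
        turn = bind (exec-const {τ 0} {1ℤ}) λ { refl → bind (exec-sub {κ d} {κ d} {τ 0}) λ { refl →
          subst (λ z → Exec (compile P (suc d)) (ν₁ [ κ d ≔ z ]) ins (cmdCost P) ins′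
                         (Executed (suc d) (mem (⟦ P ⟧ st)) ν₂)) (sym minus)
            (compile-correct P (suc d)
              (represents-cong (λ a m → trans (unwritten ν₁ {ℓ = cnt d} (vis a m) λ ())
                                             (unwritten μ {ℓ = tmp 0} (vis a m) λ ())) R)
              H₂ p eq) } }

        combine : Exec body μ ins (1 + (1 + cmdCost P)) ins′
                       (Executed (suc d) (mem (⟦ P ⟧ st)) ν₂) →
          (∀ {ν} → Executed (suc d) (mem (⟦ P ⟧ st)) ν₂ ν →
             Exec (whilePos (κ d) body) ν ins′ (n * suc (1 + (1 + cmdCost P)) + 1) ins₁
                  (Executed d (mem (iter n ⟦ P ⟧ (⟦ P ⟧ st))) ν)) →
          Exec (whilePos (κ d) body) μ ins (suc n * suc (1 + (1 + cmdCost P)) + 1) ins₁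
               (Executed d (mem (iter n ⟦ P ⟧ (⟦ P ⟧ st))) μ)
        combine (exec r r≤ X) f with f X
        ... | exec r′ r′≤ Y = exec (loop (subst (0ℤ ℤ.<_) (sym c) (+<+ z<s)) r r′)
          (≤-trans (s≤s (+-mono-≤ r≤ r′≤))
            (≤-reflexive (sym (+-assoc (suc (1 + (1 + cmdCost P))) (n * _) 1))))
          (executed (represents Y) λ ℓ k →
            trans (keeps Y ℓ k) (trans (keeps X ℓ (kept-suc k)) (frame₂ μ ℓ k)))

-- Polynomial bounds, the loop bounds, and the reduction to a bounded-loop program

module Machine where
  open import Defs
  open StepCost
  open Language
  open Compiler
  open import Data.Integer as ℤ using (ℤ; +_; 0ℤ; 1ℤ; ∣_∣; +<+; +≤+)
  import Data.Integer.Properties as ℤ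
  open import Data.List using (List; []; _∷_; length)
  open import Data.List.Relation.Unary.All using (All; []; _∷_)
  open import Data.Maybe using (just)
  open import Data.Nat
  open import Data.Nat.Logarithm using (⌊log₂_⌋; ⌊log₂⌋-mono-≤; ⌊log₂[2^n]⌋≡n)
  open import Data.Nat.Properties
  open import Data.Product using (∃; _×_; _,_; proj₁)
  open import Function using (_⇔_)
  open import Relation.Binary.PropositionalEquality
  open import Relation.Nullary using (¬_; yes; no; contradiction)
  open import Relation.Unary using (Pred)
  open import Level using (0ℓ)

  ^-distribʳ-* : ∀ m n o → (m * n) ^ o ≡ m ^ o * n ^ o
  ^-distribʳ-* m n zero    = refl
  ^-distribʳ-* m n (suc o) =
    trans (cong (m * n *_) (^-distribʳ-* m n o)) ([m*n]*[o*p]≡[m*o]*[n*p] m n (m ^ o) (n ^ o))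

  -- The base `suc n` is at least 1, so powers grow with the exponent and sums and products need no
  -- separate treatment of 0.
  record Polynomial (f : ℕ → ℕ) : Set where
    constructor polynomial
    field
      coefficient degree : ℕ
      growth : ∀ n → f n ≤ coefficient * suc n ^ degree

  poly-const : ∀ c → Polynomial (λ _ → c)
  poly-const c = polynomial c 0 λ n → ≤-reflexive (sym (*-identityʳ c))

  poly-id : Polynomial (λ n → n)
  poly-id = polynomial 1 1 λ n → ≤-trans (n≤1+n n)
    (≤-reflexive (sym (trans (*-identityˡ (suc n ^ 1)) (^-identityʳ (suc n)))))

  poly-+ : ∀ {f g} → Polynomial f → Polynomial g → Polynomial (λ n → f n + g n)
  poly-+ {f} {g} (polynomial c d p) (polynomial c′ d′ p′) = polynomial (c + c′) (d + d′) λ n → begin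
    f n + g n                                        ≤⟨ +-mono-≤ (p n) (p′ n) ⟩
    c * suc n ^ d + c′ * suc n ^ d′
      ≤⟨ +-mono-≤ (*-monoʳ-≤ c (^-monoʳ-≤ (suc n) (m≤m+n d d′)))
                  (*-monoʳ-≤ c′ (^-monoʳ-≤ (suc n) (m≤n+m d′ d))) ⟩
    c * suc n ^ (d + d′) + c′ * suc n ^ (d + d′)     ≡⟨ *-distribʳ-+ (suc n ^ (d + d′)) c c′ ⟨
    (c + c′) * suc n ^ (d + d′)                      ∎
    where open ≤-Reasoning

  poly-* : ∀ {f g} → Polynomial f → Polynomial g → Polynomial (λ n → f n * g n)
  poly-* {f} {g} (polynomial c d p) (polynomial c′ d′ p′) = polynomial (c * c′) (d + d′) λ n → begin
    f n * g n                                 ≤⟨ *-mono-≤ (p n) (p′ n) ⟩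
    c * suc n ^ d * (c′ * suc n ^ d′)         ≡⟨ interchange c (suc n ^ d) c′ (suc n ^ d′) ⟩
    c * c′ * (suc n ^ d * suc n ^ d′)         ≡⟨ cong (c * c′ *_) (^-distribˡ-+-* (suc n) d d′) ⟨
    c * c′ * suc n ^ (d + d′)                 ∎
    where
    open ≤-Reasoning
    interchange : ∀ a b c d → a * b * (c * d) ≡ a * c * (b * d)
    interchange a b c d = [m*n]*[o*p]≡[m*o]*[n*p] a b c d

  abstract
    -- The factor `2 ^ d` pays for passing from `suc m` to `2 * m`, which yields the form of bound
    -- that `InPTIME` prescribes.
    scale power-of : ∀ {f} → Polynomial f → ℕ
    scale (polynomial c d _)    = c * 2 ^ d
    power-of (polynomial _ d _) = d

    poly-bound : ∀ {f m} (p : Polynomial f) → 1 ≤ m → f m ≤ scale p * m ^ power-of p + scale p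
    poly-bound {f} {m} (polynomial c d p) 1≤m = begin
      f m                          ≤⟨ p m ⟩
      c * suc m ^ d
        ≤⟨ *-monoʳ-≤ c (^-monoˡ-≤ d
             (≤-trans (+-monoˡ-≤ m 1≤m) (≤-reflexive (cong (λ z → m + z) (sym (+-identityʳ m)))))) ⟩
      c * (2 * m) ^ d              ≡⟨ cong (c *_) (^-distribʳ-* 2 m d) ⟩
      c * (2 ^ d * m ^ d)          ≡⟨ *-assoc c (2 ^ d) (m ^ d) ⟨
      c * 2 ^ d * m ^ d            ≤⟨ m≤m+n (c * 2 ^ d * m ^ d) (c * 2 ^ d) ⟩
      c * 2 ^ d * m ^ d + c * 2 ^ d ∎
      where open ≤-Reasoning

  module _ where
    open Correctness

    cmdCost-poly : ∀ c → Polynomial (λ n → cmdCost (λ _ → n) c)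
    cmdCost-poly skip          = poly-const 0
    cmdCost-poly (P ⨾ Q)       = poly-+ (cmdCost-poly P) (cmdCost-poly Q)
    cmdCost-poly (_ [ f ]≔ g)  = poly-const _
    cmdCost-poly (read _)      = poly-const 1
    cmdCost-poly (ifPos f P Q) = poly-+ (poly-const (expCost f))
      (poly-+ (poly-const 1) (poly-+ (cmdCost-poly P) (cmdCost-poly Q)))
    cmdCost-poly (loop b P)    = poly-+ (poly-const 2)
      (poly-+ (poly-* poly-id (poly-+ (poly-const 3) (cmdCost-poly P))) (poly-const 1))

    cmdCost-mono : ∀ c {β n} → (∀ b → β b ≤ n) → cmdCost β c ≤ cmdCost (λ _ → n) c
    cmdCost-mono skip          p = ≤-refl
    cmdCost-mono (P ⨾ Q)       p = +-mono-≤ (cmdCost-mono P p) (cmdCost-mono Q p)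
    cmdCost-mono (_ [ f ]≔ g)  p = ≤-refl
    cmdCost-mono (read _)      p = ≤-refl
    cmdCost-mono (ifPos f P Q) p =
      +-monoʳ-≤ (expCost f) (s≤s (+-mono-≤ (cmdCost-mono P p) (cmdCost-mono Q p)))
    cmdCost-mono (loop b P)    p =
      +-monoʳ-≤ 2 (+-monoˡ-≤ 1 (*-mono-≤ (p b) (+-monoʳ-≤ 3 (cmdCost-mono P p))))

  -- The loop bound bits is the least B with den < 2 ^ B.
  doubling : Program
  doubling =
    add (τ 0) (τ 0) (τ 0) ⨾
    add (addr (bnd bits)) (addr (bnd bits)) (τ 1) ⨾
    sub (τ 3) (τ 2) (τ 0)

  setBounds : Program
  setBounds =
    const (τ 0) 0ℤ ⨾ add (addr (bnd states)) (addr (vis order 0)) (τ 0) ⨾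
    const (τ 0) 1ℤ ⨾ const (τ 1) 1ℤ ⨾
    -- `τ 2` holds den + 1, so that positivity of `τ 3`, its difference with the current power of 2,
    -- says that this power is at most den.
    add (τ 2) (addr (vis den 0)) (τ 1) ⨾ sub (τ 3) (τ 2) (τ 0) ⨾
    whilePos (τ 3) doubling

  record Counted (d : ℕ) (max : ℕ) (μ μ′ : Memory) : Set where
    constructor counted
    field
      count   : ℕ
      count≤  : count ≤ max
      enough  : d < 2 ^ count
      stored  : μ′ (addr (bnd bits)) ≡ + count
      untouched : ∀ ℓ → ¬ Scratch 0 ℓ → ℓ ≢ bnd bits → μ′ (addr ℓ) ≡ μ (addr ℓ)

  -- `f` is fuel: as `d < 2 ^ (k + f)`, the doubling stops within `f` further turns, each of four
  -- instructions.
  count-bits : ∀ f k {d} μ {ins} → μ (τ 0) ≡ + (2 ^ k) → μ (τ 1) ≡ 1ℤ → μ (τ 2) ≡ + suc d →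
               μ (τ 3) ≡ + suc d ℤ.- + (2 ^ k) → μ (addr (bnd bits)) ≡ + k → d < 2 ^ (k + f) →
               Exec (whilePos (τ 3) doubling) μ ins (f * 4 + 1) ins (Counted d (k + f) μ)
  count-bits f k {d} μ {ins} p₀ p₁ p₂ p₃ pb lt with d <? 2 ^ k
  ... | yes d< = exec (exit (subst (ℤ._≤ 0ℤ) (sym p₃)
                   (ℤ.≤-trans (ℤ.+-monoˡ-≤ (ℤ.- + (2 ^ k)) (+≤+ d<))
                     (ℤ.≤-reflexive (ℤ.+-inverseʳ (+ (2 ^ k)))))))
                   (m≤n+m 1 (f * 4)) (counted k (m≤m+n k f) d< pb λ _ _ _ → refl)
  ... | no d≮ with f
  ...   | zero   = contradiction (subst (λ z → d < 2 ^ z) (+-identityʳ k) lt) d≮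
  ...   | suc f′ = again (count-bits f′ (suc k) ν
                     (trans (cong₂ ℤ._+_ p₀ p₀) (cong +_ twice)) p₁ p₂
                     (cong₂ ℤ._-_ p₂ (trans (cong₂ ℤ._+_ p₀ p₀) (cong +_ twice)))
                     (trans (cong₂ ℤ._+_ pb p₁) (cong +_ (+-comm k 1)))
                     (subst (λ z → d < 2 ^ z) (+-suc k f′) lt))
    where
    twice : 2 ^ k + 2 ^ k ≡ 2 ^ suc k
    twice = cong (λ z → 2 ^ k + z) (sym (+-identityʳ (2 ^ k)))

    ν₁ ν₂ ν : Memory
    ν₁ = μ [ τ 0 ≔ μ (τ 0) ℤ.+ μ (τ 0) ]
    ν₂ = ν₁ [ addr (bnd bits) ≔ μ (addr (bnd bits)) ℤ.+ μ (τ 1) ]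
    ν = ν₂ [ τ 3 ≔ μ (τ 2) ℤ.- (μ (τ 0) ℤ.+ μ (τ 0)) ]

    pos : 0ℤ ℤ.< μ (τ 3)
    pos = subst (0ℤ ℤ.<_) (sym p₃)
      (ℤ.≤-<-trans (ℤ.≤-reflexive (sym (ℤ.+-inverseʳ (+ (2 ^ k)))))
        (ℤ.+-monoˡ-< (ℤ.- + (2 ^ k)) (+<+ (s≤s (≮⇒≥ d≮)))))

    again : Exec (whilePos (τ 3) doubling) ν ins (f′ * 4 + 1) ins (Counted d (suc k + f′) ν) →
            Exec (whilePos (τ 3) doubling) μ ins (suc f′ * 4 + 1) ins (Counted d (k + suc f′) μ)
    again (exec r r≤ C) = exec (loop pos (seq add (seq add sub)) r) (+-monoʳ-≤ 4 r≤)
      (counted (Counted.count C) (≤-trans (Counted.count≤ C) (≤-reflexive (sym (+-suc k f′))))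
        (Counted.enough C) (Counted.stored C)
        λ ℓ n n′ → trans (Counted.untouched C ℓ n n′)
          (trans (unwritten ν₂ {ℓ = tmp 3} ℓ λ { refl → n (scratch z≤n) })
          (trans (unwritten ν₁ {ℓ = bnd bits} ℓ n′)
                 (unwritten μ {ℓ = tmp 0} ℓ λ { refl → n (scratch z≤n) }))))

  header : Cmd
  header = read num ⨾ (read den ⨾ (read source ⨾ read order))

  start : ℤ → ℕ → ℕ → ℕ → Store
  start t d s n =
    (λ _ _ → 0ℤ) ⟨ num , 0 ⟩≔ t ⟨ den , 0 ⟩≔ + d ⟨ source , 0 ⟩≔ + s ⟨ order , 0 ⟩≔ + n

  prologue : Program
  prologue = compile header 0 ⨾ setBounds

  bound-function : ℕ → ℕ → Bound → ℕ
  bound-function n b states = n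
  bound-function n b bits   = b

  record Prepared (t : ℤ) (d s n f : ℕ) (μ : Memory) : Set where
    field
      size     : ℕ
      size≤    : size ≤ f
      enough   : d < 2 ^ size
      memory   : Represents μ (start t d s n)
      bounds   : Correctness.HasBounds (bound-function n size) μ

  prologue-correct : ∀ t d s n f rest → d < 2 ^ f →
    Exec prologue (λ _ → 0ℤ) (t ∷ + d ∷ + s ∷ + n ∷ rest) (4 + (6 + (f * 4 + 1))) rest
         (Prepared t d s n f)
  prologue-correct t d s n f rest d<
    -- The registers of the loop bounds still hold 0, which matches the bound function that is
    -- constantly 0.
    with exec {end = μ} r r≤ X ← Correctness.compile-correct (λ _ → 0) header 0
           {state (λ _ _ → 0ℤ) (just (t ∷ + d ∷ + s ∷ + n ∷ rest))} {λ _ → 0ℤ}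
           (representing λ _ _ → refl) (Correctness.bounds λ { states → refl ; bits → refl }) refl refl
    = finish (count-bits f 0 μ₆ refl refl
        (trans (cong (ℤ._+ 1ℤ) (entry (represents X) den 0)) (cong +_ (+-comm d 1)))
        (cong (ℤ._- 1ℤ) (trans (cong (ℤ._+ 1ℤ) (entry (represents X) den 0)) (cong +_ (+-comm d 1))))
        (keeps X (bnd bits) bound) d<)
    where
    μ₁ μ₂ μ₃ μ₄ μ₅ μ₆ : Memory
    μ₁ = μ [ τ 0 ≔ 0ℤ ]
    μ₂ = μ₁ [ addr (bnd states) ≔ μ₁ (addr (vis order 0)) ℤ.+ μ₁ (τ 0) ]
    μ₃ = μ₂ [ τ 0 ≔ 1ℤ ]
    μ₄ = μ₃ [ τ 1 ≔ 1ℤ ]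
    μ₅ = μ₄ [ τ 2 ≔ μ₄ (addr (vis den 0)) ℤ.+ μ₄ (τ 1) ]
    μ₆ = μ₅ [ τ 3 ≔ μ₅ (τ 2) ℤ.- μ₅ (τ 0) ]

    vis-kept : ∀ a m → μ₆ (addr (vis a m)) ≡ μ (addr (vis a m))
    vis-kept a m = trans (unwritten μ₅ {ℓ = tmp 3} ℓ λ ())
      (trans (unwritten μ₄ {ℓ = tmp 2} ℓ λ ()) (trans (unwritten μ₃ {ℓ = tmp 1} ℓ λ ())
      (trans (unwritten μ₂ {ℓ = tmp 0} ℓ λ ()) (trans (unwritten μ₁ {ℓ = bnd states} ℓ λ ())
      (unwritten μ {ℓ = tmp 0} ℓ λ ())))))
      where ℓ = vis a m

    finish : Exec (whilePos (τ 3) doubling) μ₆ rest (f * 4 + 1) rest (Counted d f μ₆) →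
      Exec prologue (λ _ → 0ℤ) (t ∷ + d ∷ + s ∷ + n ∷ rest) (4 + (6 + (f * 4 + 1))) rest
           (Prepared t d s n f)
    finish (exec r′ r′≤ C) = exec
      (seq r (seq const (seq add (seq const (seq const (seq add (seq sub r′)))))))
      (+-mono-≤ r≤ (+-monoʳ-≤ 6 r′≤))
      record
        { size = Counted.count C ; size≤ = Counted.count≤ C ; enough = Counted.enough C
        ; memory = represents-cong
            (λ a m → trans (Counted.untouched C (vis a m) (λ ()) λ ()) (vis-kept a m)) (represents X)
        ; bounds = Correctness.bounds λ
            { states → trans (Counted.untouched C (bnd states) (λ ()) λ ())
                (trans (ℤ.+-identityʳ _) (entry (represents X) order 0))
            ; bits → Counted.stored C } }

  n<2^bitLength : ∀ n → n < 2 ^ bitLength (+ n)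
  n<2^bitLength n with n <? 2 ^ bitLength (+ n)
  ... | yes p = p
  ... | no ≮ = contradiction
    (subst (_≤ ⌊log₂ n ⌋) (⌊log₂[2^n]⌋≡n (bitLength (+ n))) (⌊log₂⌋-mono-≤ (≮⇒≥ ≮))) 1+n≰n

  length≤size : ∀ xs → length xs ≤ inputSize xs
  length≤size []       = z≤n
  length≤size (x ∷ xs) = s≤s (≤-trans (length≤size xs) (m≤n+m _ _))

  entry≤size : ∀ {b} xs → inputSize xs ≤ b → All (λ x → ∣ x ∣ ≤ 2 ^ b) xs
  entry≤size []       p = []
  entry≤size (x ∷ xs) p =
    ≤-trans (<⇒≤ (n<2^bitLength ∣ x ∣)) (^-monoʳ-≤ 2 (≤-trans (m≤m+n _ (inputSize xs)) p)) ∷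
    entry≤size xs (≤-trans (m≤n+m _ (bitLength x)) p)

  record Decides (c : Cmd) (t : ℤ) (d s n : ℕ) (rest : List ℤ) (Yes : Set) (b : ℕ) : Set where
    field
      remaining : List ℤ
      reads     : inp (execute (bound-function n b) c (state (start t d s n) (just rest))) ≡ just remaining
      correct   : 0ℤ ℤ.< mem (execute (bound-function n b) c (state (start t d s n) (just rest))) result 0 ⇔ Yes

  -- The number of states is written in binary, so n turns of a loop are polynomially many only
  -- because the rest of the input has at least n entries. The other bound is at most the bit length
  -- of the denominator.
  in-PTIME : (c : Cmd) {A : Set} (encode : A → List ℤ) (Yes : Pred A 0ℓ) →
    (t : A → ℤ) (d s n : A → ℕ) (rest : A → List ℤ) →
    (∀ a → encode a ≡ t a ∷ + d a ∷ + s a ∷ + n a ∷ rest a) →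
    (∀ a → n a ≤ length (rest a)) →
    (∀ a b → d a < 2 ^ b → Decides c (t a) (d a) (s a) (n a) (rest a) (Yes a) b) →
    InPTIME encode Yes
  in-PTIME c {A} encode Yes t d s n rest encode≡ n≤ decides =
    P , scale time-poly , power-of time-poly , solve
    where
    P = prologue ⨾ compile c 0

    step-bound : ℕ → ℕ
    step-bound m = 4 + (6 + (m * 4 + 1)) + Correctness.cmdCost (λ _ → m) c

    time-bound : ℕ → ℕ
    -- This is `cost-bound` at b = m + `consts P`: the inputs lie below `2 ^ m`, the constants below
    -- `2 ^ consts P`.
    time-bound m = step-bound m * (2 * (1 + (m + consts P + step-bound m)))

    step-poly : Polynomial step-bound
    step-poly = poly-+ (poly-+ (poly-const 4) (poly-+ (poly-const 6)
      (poly-+ (poly-* poly-id (poly-const 4)) (poly-const 1)))) (cmdCost-poly c)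

    time-poly : Polynomial time-bound
    time-poly = poly-* step-poly (poly-* (poly-const 2) (poly-+ (poly-const 1)
      (poly-+ (poly-+ poly-id (poly-const (consts P))) step-poly)))

    Solved : A → List ℤ → Set
    Solved a ins = ∃ λ T → ∃ λ c′ → Run P (initial ins) T c′ ×
      T ≤ scale time-poly * inputSize ins ^ power-of time-poly + scale time-poly ×
      (Accepting c′ ⇔ Yes a)

    solve : ∀ a → Solved a (encode a)
    solve a = subst (Solved a) (sym (encode≡ a)) (first (prologue-correct (t a) (d a) (s a) (n a)
                (bitLength (+ d a)) (rest a) (n<2^bitLength (d a))))
      where
      ins = t a ∷ + d a ∷ + s a ∷ + n a ∷ rest a
      L = inputSize ins

      bits≤ : bitLength (+ d a) ≤ L
      bits≤ = ≤-trans (m≤m+n _ _) (m≤n+m _ (bitLength (t a)))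

      n≤L : n a ≤ L
      n≤L = ≤-trans (n≤ a) (≤-trans (≤-trans (n≤1+n _) (≤-trans (n≤1+n _)
              (≤-trans (n≤1+n _) (n≤1+n _)))) (length≤size ins))

      time≤ : ∀ {T c′} (r : Run P (initial ins) T c′) → steps r ≤ step-bound L →
              T ≤ scale time-poly * L ^ power-of time-poly + scale time-poly
      time≤ r r≤ = ≤-trans
        (≤-trans (proj₁ (cost-bound (L + consts P) r
            (bounded (λ _ → z≤n) (entry≤size ins (m≤m+n L _))) (m≤n+m (consts P) L)))
          (*-mono-≤ r≤ (*-monoʳ-≤ 2 (s≤s (+-monoʳ-≤ (L + consts P) r≤)))))
        (poly-bound time-poly (s≤s z≤n))

      first : Exec prologue (λ _ → 0ℤ) ins (4 + (6 + (bitLength (+ d a) * 4 + 1))) (rest a)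
                   (Prepared (t a) (d a) (s a) (n a) (bitLength (+ d a))) → Solved a ins
      first (exec {end = μ} r r≤ X) = second Z (Correctness.compile-correct β c 0
          (Prepared.memory X) (Prepared.bounds X) refl
          (trans (cong inp (sym (execute≡ β c _))) (Decides.reads Z)))
        where
        β = bound-function (n a) (Prepared.size X)
        Z = decides a (Prepared.size X) (Prepared.enough X)

        second : (Z : Decides c (t a) (d a) (s a) (n a) (rest a) (Yes a) (Prepared.size X)) →
          Exec (compile c 0) μ (rest a) (Correctness.cmdCost β c) (Decides.remaining Z)
            (Executed 0 (mem (Semantics.⟦_⟧ β c
               (state (start (t a) (d a) (s a) (n a)) (just (rest a))))) μ) → Solved a ins
        second Z (exec r′ r′≤ Y) = _ , _ , seq r r′ , time≤ (seq r r′) S≤ ,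
          subst (λ z → 0ℤ ℤ.< z ⇔ Yes a) (trans (cong (λ st → mem st result 0) (execute≡ β c _)) (sym (entry (represents Y) result 0)))
            (Decides.correct Z)
          where
          S≤ : steps (seq r r′) ≤ step-bound L
          S≤ = +-mono-≤
            (≤-trans r≤ (+-monoʳ-≤ 4 (+-monoʳ-≤ 6 (+-monoˡ-≤ 1 (*-monoˡ-≤ 4 bits≤)))))
            (≤-trans r′≤ (cmdCost-mono c λ
              { states → n≤L ; bits → ≤-trans (Prepared.size≤ X) bits≤ }))

-- Walks, and negative cycles by Bellman-Ford

module Graphs where
  open import Data.Integer hiding (suc)
  open import Data.Integer.Properties
  open import Data.Integer.Tactic.RingSolver using (solve-∀)
  open import Data.Maybe using (Maybe; just; nothing)
  open import Data.Maybe.Properties using (just-injective)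
  open import Data.Nat as ℕ using (ℕ; zero; suc; z≤n; s≤s)
  import Data.Nat.Properties as ℕ
  open import Data.Fin using (Fin; zero; suc; toℕ; fromℕ<)
  open import Data.Fin.Properties using (pigeonhole; toℕ-fromℕ<; toℕ<n)
  open import Data.Product using (Σ; _×_; _,_; proj₁; proj₂; ∃-syntax)
  open import Data.Empty using (⊥-elim)
  open import Relation.Binary.PropositionalEquality
  open import Relation.Nullary using (¬_; yes; no)

  -- For linear arithmetic: an inequality follows from any other with the same difference.
  by-difference : ∀ {a b x y} → a ≤ b → y - x ≡ b - a → x ≤ y
  by-difference p q = 0≤i-j⇒j≤i (subst (0ℤ ≤_) (sym q) (i≤j⇒0≤j-i p))

  <-by-difference : ∀ {a b x y} → a < b → y - x ≡ b - a → x < y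
  <-by-difference {a} {b} {x} {y} p q =
    suc[i]≤j⇒i<j (by-difference (i<j⇒suc[i]≤j p) (trans (shift x y) (trans (cong (_- 1ℤ) q) (sym (shift a b)))))
    where
    shift : ∀ x y → y - (1ℤ + x) ≡ y - x - 1ℤ
    shift = solve-∀

  module Walks (W : ℕ → ℕ → Maybe ℤ) where

    infixr 5 _◂_
    data Walk : ℕ → ℕ → Set where
      ε   : ∀ {i} → Walk i i
      _◂_ : ∀ {i k j c} → W i k ≡ just c → Walk k j → Walk i j

    length : ∀ {i j} → Walk i j → ℕ
    length ε       = 0
    length (_ ◂ p) = suc (length p)

    total : ∀ {i j} → Walk i j → ℤ
    total ε               = 0ℤ
    total (_◂_ {c = c} _ p) = c + total p

  -- Distances, where nothing stands for +∞.
  data _≼_ : Maybe ℤ → Maybe ℤ → Set where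
    ≼∞    : ∀ {a} → a ≼ nothing
    just≤ : ∀ {u v} → u ≤ v → just u ≼ just v

  data _≺_ : Maybe ℤ → Maybe ℤ → Set where
    ≺∞    : ∀ {u} → just u ≺ nothing
    just< : ∀ {u v} → u < v → just u ≺ just v

  ≼-refl : ∀ {a} → a ≼ a
  ≼-refl {just u}  = just≤ ≤-refl
  ≼-refl {nothing} = ≼∞

  ≼-trans : ∀ {a b c} → a ≼ b → b ≼ c → a ≼ c
  ≼-trans _         ≼∞        = ≼∞
  ≼-trans (just≤ p) (just≤ q) = just≤ (≤-trans p q)

  ≺⇒≼ : ∀ {a b} → a ≺ b → a ≼ b
  ≺⇒≼ ≺∞        = ≼∞
  ≺⇒≼ (just< p) = just≤ (<⇒≤ p)

  ≺-≼-trans : ∀ {a b c} → a ≺ b → b ≼ c → a ≺ c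
  ≺-≼-trans (just< p) (just≤ q) = just< (<-≤-trans p q)
  ≺-≼-trans {just u} _ ≼∞       = ≺∞

  ≺⇒⋠ : ∀ {a b} → a ≺ b → ¬ b ≼ a
  ≺⇒⋠ (just< p) (just≤ q) = <⇒≱ p q

  just≺just : ∀ {u v} → just u ≺ just v → u < v
  just≺just (just< p) = p

  relax : Maybe ℤ → Maybe ℤ → Maybe ℤ → Maybe ℤ
  relax nothing  _        b        = b
  relax (just u) nothing  b        = b
  relax (just u) (just c) nothing  = just (u + c)
  relax (just u) (just c) (just v) with u + c <? v
  ... | yes _ = just (u + c)
  ... | no  _ = just v

  data Relaxed (d w b : Maybe ℤ) : Maybe ℤ → Set where
    kept    : Relaxed d w b b
    lowered : ∀ {u c} → d ≡ just u → w ≡ just c → just (u + c) ≺ b → Relaxed d w b (just (u + c))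

  relaxed : ∀ d w b → Relaxed d w b (relax d w b)
  relaxed nothing  _        b        = kept
  relaxed (just u) nothing  b        = kept
  relaxed (just u) (just c) nothing  = lowered refl refl ≺∞
  relaxed (just u) (just c) (just v) with u + c <? v
  ... | yes p = lowered refl refl (just< p)
  ... | no  _ = kept

  relax-≼ : ∀ d w b → relax d w b ≼ b
  relax-≼ d w b with relax d w b | relaxed d w b
  ... | _ | kept          = ≼-refl
  ... | _ | lowered _ _ p = ≺⇒≼ p

  relax-bound : ∀ u c b → relax (just u) (just c) b ≼ just (u + c)
  relax-bound u c nothing  = ≼-refl
  relax-bound u c (just v) with u + c <? v
  ... | yes _ = ≼-refl
  ... | no  p = just≤ (≮⇒≥ p)

  module BellmanFord (N : ℕ) (W : ℕ → ℕ → Maybe ℤ) (D₀ : ℕ → Maybe ℤ)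
                     (W-bounded : ∀ {i j c} → W i j ≡ just c → i ℕ.< N × j ℕ.< N) where
    open Walks W

    -- All offers use the old distances `D`. Such synchronous rounds let an improvement be traced
    -- back exactly one round at a time.
    best : (ℕ → Maybe ℤ) → ℕ → ℕ → Maybe ℤ
    best D j zero    = D j
    best D j (suc i) = relax (D i) (W i j) (best D j i)

    D : ℕ → ℕ → Maybe ℤ
    D zero    j = D₀ j
    D (suc r) j = best (D r) j N

    best-≼ : ∀ D j i → best D j i ≼ D j
    best-≼ D j zero    = ≼-refl
    best-≼ D j (suc i) = ≼-trans (relax-≼ (D i) (W i j) (best D j i)) (best-≼ D j i)

    best-bound : ∀ D {i j u c} n → i ℕ.< n → D i ≡ just u → W i j ≡ just c → best D j n ≼ just (u + c)
    best-bound D {i} {j} {u} {c} (suc n) i<n p q with i ℕ.≟ n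
    ... | yes refl rewrite p | q = relax-bound u c (best D j n)
    ... | no  i≢n  = ≼-trans (relax-≼ (D n) (W n j) (best D j n))
                       (best-bound D n (ℕ.≤∧≢⇒< (ℕ.≤-pred i<n) i≢n) p q)

    data Improvement (D : ℕ → Maybe ℤ) (j n : ℕ) : Set where
      same : best D j n ≡ D j → Improvement D j n
      via  : ∀ i u c → D i ≡ just u → W i j ≡ just c → best D j n ≡ just (u + c) →
             best D j n ≺ D j → Improvement D j n

    improvement : ∀ D j n → Improvement D j n
    improvement D j zero    = same refl
    improvement D j (suc n)
      with relax (D n) (W n j) (best D j n) in eq | relaxed (D n) (W n j) (best D j n)
    ... | _ | lowered {u} {c} p q l =
      via n u c p q eq (subst (_≺ D j) (sym eq) (≺-≼-trans l (best-≼ D j n)))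
    ... | _ | kept with improvement D j n
    ...   | same p            = same (trans eq p)
    ...   | via i u c p q r l = via i u c p q (trans eq r) (subst (_≺ D j) (sym eq) l)

    D-mono : ∀ m r j → D (m ℕ.+ r) j ≼ D r j
    D-mono zero    r j = ≼-refl
    D-mono (suc m) r j = ≼-trans (best-≼ (D (m ℕ.+ r)) j N) (D-mono m r j)

    Stable Improves : ℕ → Set
    Stable r   = ∀ j → j ℕ.< N → D (suc r) j ≡ D r j
    Improves r = ∃[ j ] D (suc r) j ≺ D r j

    feasible : ∀ r → Stable r → ∀ {i j u c} → D (suc r) i ≡ just u → W i j ≡ just c →
               D (suc r) j ≼ just (u + c)
    feasible r st {i} p q = best-bound (D r) N i<N (trans (sym (st i i<N)) p) q
      where i<N = proj₁ (W-bounded q)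

    -- `q` is an accumulator: the walk is built backwards by prepending edges, so that walks never
    -- have to be concatenated.
    origin : ∀ r {j v z} → D r j ≡ just v → (q : Walk j z) →
             ∃[ i ] ∃[ v₀ ] D₀ i ≡ just v₀ × Σ (Walk i z) λ p → v₀ + total p ≡ v + total q
    origin zero    {j} {v} p q = j , v , p , q , refl
    origin (suc r) {j} {v} p q with improvement (D r) j N
    ... | same eq = origin r (trans (sym eq) p) q
    ... | via i u c a b eq _ with refl ← just-injective (trans (sym p) eq)
      with i₀ , v₀ , start , walk , eq′ ← origin r a (b ◂ q)
      = i₀ , v₀ , start , walk , trans eq′ (sym (+-assoc u c (total q)))

    -- An unbroken line of improvements, one in every round back to the initial distances.
    data Chain : ℕ → ℕ → ℤ → Set where
      base : ∀ {j v} → D 0 j ≡ just v → Chain 0 j v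
      link : ∀ {r i j u c} → Chain r i u → W i j ≡ just c → D (suc r) j ≡ just (u + c) →
             D (suc r) j ≺ D r j → Chain (suc r) j (u + c)

    chain-value : ∀ {r j v} → Chain r j v → D r j ≡ just v
    chain-value (base p)       = p
    chain-value (link _ _ p _) = p

    -- A vertex improved in one round has a predecessor improved in the round before.
    chain : ∀ r {j} → D (suc r) j ≺ D r j → ∃[ v ] Chain (suc r) j v
    chain r {j} p with improvement (D r) j N
    ... | same eq = ⊥-elim (≺⇒⋠ (subst (_≺ D r j) eq p) ≼-refl)
    ... | via i u c a b eq l = u + c , link (predecessor r a (subst (_≺ D r j) eq l)) b eq l
      where
      predecessor : ∀ r → D r i ≡ just u → just (u + c) ≺ D r j → Chain r i u
      predecessor zero    a l = base a
      predecessor (suc r) a l with improvement (D r) i N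
      -- Had `i` kept its distance, the round before would already have offered `u + c` to `j`.
      ... | same eq = ⊥-elim (≺⇒⋠ l (best-bound (D r) N (proj₁ (W-bounded b)) (trans (sym eq) a) b))
      ... | via _ _ _ _ _ _ l′ = subst (Chain (suc r) i)
              (just-injective (trans (sym (chain-value (proj₂ (chain r l′)))) a)) (proj₂ (chain r l′))

    vertex : ∀ {r j v} → Chain r j v → Fin (suc r) → ℕ
    vertex {j = j} _         zero    = j
    vertex (link ch _ _ _)   (suc f) = vertex ch f

    vertex<N : ∀ {r j v} (ch : Chain r j v) → j ℕ.< N → ∀ f → vertex ch f ℕ.< N
    vertex<N ch              j<N zero    = j<N
    vertex<N (link ch e _ _) _   (suc f) = vertex<N ch (proj₁ (W-bounded e)) f

    -- Distances along a chain are exact sums, so the difference of two of them is the total of the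
    -- walk between. `κ` is the round to which vertex `f` of the chain belongs.
    segment : ∀ {r j v z} (ch : Chain r j v) f (q : Walk j z) →
              Σ (Walk (vertex ch f) z) λ p → ∃[ κ ] ∃[ u ] D κ (vertex ch f) ≡ just u ×
                κ ℕ.+ toℕ f ≡ r × length p ≡ toℕ f ℕ.+ length q × u + total p ≡ v + total q
    segment {r} {v = v} ch zero q = q , r , v , chain-value ch , ℕ.+-identityʳ r , refl , refl
    segment (link {u = u} {c} ch e _ _) (suc f) q
      with p , κ , u₀ , at , κ+f , len , tot ← segment ch f (e ◂ q)
      = p , κ , u₀ , at , trans (ℕ.+-suc κ (toℕ f)) (cong suc κ+f) , trans len (ℕ.+-suc (toℕ f) _) ,
        trans tot (sym (+-assoc u c (total q)))

    -- `short` will allow totals to be rounded to multiples of the number of vertices; `reached`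
    -- provides a stem that leads to the cycle.
    record NegativeCycle : Set where
      field
        {vertex₀} : ℕ
        cycle   : Walk vertex₀ vertex₀
        short   : length cycle ℕ.≤ N
        nonempty : 1 ℕ.≤ length cycle
        below-zero : total cycle < 0ℤ
        round    : ℕ
        distance : ℤ
        reached  : D round vertex₀ ≡ just distance

    cut : ∀ {r j v} (ch : Chain r j v) → r ℕ.≤ N → ∀ f g → toℕ f ℕ.< toℕ g →
          vertex ch f ≡ vertex ch g → NegativeCycle
    cut {v = v} ch@(link {r} {j = j} ch′ e at l) r≤N zero (suc g) _ eq
      with p , κ , u , at′ , κ+g , len , tot ← segment ch (suc g) ε
      = record
        { cycle = subst (λ z → Walk z j) (sym eq) p
        ; short = subst (ℕ._≤ N) (sym (trans length≡ (ℕ.+-identityʳ _)))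
                    (ℕ.≤-trans (toℕ<n g) r≤N)
        ; nonempty = subst (1 ℕ.≤_) (sym length≡) (s≤s z≤n)
        ; below-zero = <-by-difference v<u (difference u v _ (trans (cong (λ z → u + z) total≡) tot))
        ; round = κ
        ; reached = trans (cong (D κ) eq) at′
        }
      where
      length≡ : length (subst (λ z → Walk z j) (sym eq) p) ≡ suc (toℕ g ℕ.+ 0)
      length≡ = trans (length-subst eq p) len
        where
        length-subst : ∀ {a b} (eq : a ≡ b) (p : Walk b j) →
                       length (subst (λ z → Walk z j) (sym eq) p) ≡ length p
        length-subst refl p = refl

      total≡ : total (subst (λ z → Walk z j) (sym eq) p) ≡ total p
      total≡ = total-subst eq p
        where
        total-subst : ∀ {a b} (eq : a ≡ b) (p : Walk b j) →
                      total (subst (λ z → Walk z j) (sym eq) p) ≡ total p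
        total-subst refl p = refl

      -- The same vertex has distance `u` in round `κ`. No later round raises it, and the last link
      -- of the chain strictly lowers it to `v`.
      v<u : v < u
      v<u = just≺just (subst₂ _≺_ at (trans (cong (D κ) eq) at′) (≺-≼-trans l
        (subst (λ z → D z j ≼ D κ j) (trans (ℕ.+-comm (toℕ g) κ)
          (ℕ.suc-injective (trans (sym (ℕ.+-suc κ (toℕ g))) κ+g))) (D-mono (toℕ g) κ j))))

      difference : ∀ u v t → u + t ≡ v + 0ℤ → 0ℤ - t ≡ u - v
      difference u v t p = trans (lemma₁ u t) (trans (cong (λ z → u - z) p) (lemma₂ u v))
        where
        lemma₁ : ∀ u t → 0ℤ - t ≡ u - (u + t)
        lemma₁ = solve-∀
        lemma₂ : ∀ u v → u - (v + 0ℤ) ≡ u - v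
        lemma₂ = solve-∀
    cut (link ch _ _ _) r≤N (suc f) (suc g) f<g eq =
      cut ch (ℕ.≤-trans (ℕ.n≤1+n _) r≤N) f g (ℕ.≤-pred f<g) eq

    negative-cycle : ∀ {M} → N ≡ suc M → Improves M → NegativeCycle
    negative-cycle {M} refl (j , p) with improvement (D M) j N | chain M p
    ... | same eq | _ = ⊥-elim (≺⇒⋠ (subst (_≺ D M j) eq p) ≼-refl)
    ... | via _ _ _ _ e _ _ | _ , ch
      with f , g , f<g , eq ← pigeonhole (ℕ.n<1+n N) (λ f → fromℕ< (vertex<N ch (proj₂ (W-bounded e)) f))
      = cut ch ℕ.≤-refl f g f<g
          (trans (sym (toℕ-fromℕ< (vertex<N ch (proj₂ (W-bounded e)) f))) (trans (cong toℕ eq) (toℕ-fromℕ< (vertex<N ch (proj₂ (W-bounded e)) g))))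

-- Plays of low average: lassos, slack and potentials

module Energy where
  open import Defs using (∑<)
  open Graphs
  open import Data.Bool using (if_then_else_; true; T)
  open import Data.Integer hiding (suc)
  open import Data.Integer.Properties
  open import Data.Integer.Tactic.RingSolver using (solve-∀)
  open import Data.Maybe using (Maybe; just; nothing; maybe)
  open import Data.Maybe.Properties using (just-injective)
  open import Data.Nat as ℕ using (ℕ; zero; suc; z≤n; s≤s; _≡ᵇ_)
  import Data.Nat.Properties as ℕ
  open import Data.Nat.Induction using (<-rec)
  open import Data.Product using (∃; Σ; _×_; _,_; proj₁; proj₂; ∃-syntax)
  open import Data.Sum using (_⊎_; inj₁; inj₂)
  open import Data.Empty using (⊥-elim)
  open import Relation.Binary.PropositionalEquality
  open import Relation.Nullary using (Dec; yes; no)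

  BoundedAbove : (ℕ → ℤ) → Set
  BoundedAbove g = ∃[ C ] ∀ n → g n ≤ + C

  ≤-+∣∣ : ∀ v → v ≤ + ∣ v ∣
  ≤-+∣∣ (+ n)    = ≤-refl
  ≤-+∣∣ -[1+ n ] = -≤+

  prefix-bound : ∀ (g : ℕ → ℤ) K → ∃[ C ] ∀ n → n ℕ.< K → g n ≤ + C
  prefix-bound g zero    = 0 , λ _ ()
  prefix-bound g (suc K) with C , p ← prefix-bound g K = C ℕ.+ ∣ g K ∣ , bound
    where
    bound : ∀ n → n ℕ.< suc K → g n ≤ + (C ℕ.+ ∣ g K ∣)
    bound n n<sK with n ℕ.≟ K
    ... | yes refl = ≤-trans (≤-+∣∣ (g K)) (+≤+ (ℕ.m≤n+m _ C))
    ... | no  n≢K  = ≤-trans (p n (ℕ.≤∧≢⇒< (ℕ.≤-pred n<sK) n≢K)) (+≤+ (ℕ.m≤m+n C _))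

  -- Going back one period at a time never decreases the value and ends among the first `suc ℓ + K`
  -- values, which are finitely many.
  non-increasing⇒bounded : ∀ (g : ℕ → ℤ) ℓ K → (∀ m → g (suc ℓ ℕ.+ (m ℕ.+ K)) ≤ g (m ℕ.+ K)) →
                           BoundedAbove g
  non-increasing⇒bounded g ℓ K dec with C , p ← prefix-bound g (suc ℓ ℕ.+ K) =
    C , <-rec (λ n → g n ≤ + C) λ n rec → step n rec
    where
    step : ∀ n → (∀ {k} → k ℕ.< n → g k ≤ + C) → g n ≤ + C
    step n rec with n ℕ.<? suc ℓ ℕ.+ K
    ... | yes n< = p n n<
    ... | no  n≮ = subst (λ z → g z ≤ + C) n≡ (≤-trans (dec m) (rec (subst (m ℕ.+ K ℕ.<_) n≡
                     (s≤s (ℕ.m≤n+m (m ℕ.+ K) ℓ)))))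
      where
      m = n ℕ.∸ (suc ℓ ℕ.+ K)
      n≡ : suc ℓ ℕ.+ (m ℕ.+ K) ≡ n
      n≡ = trans (cong (suc ℓ ℕ.+_) (ℕ.+-comm m K))
          (trans (sym (ℕ.+-assoc (suc ℓ) K m)) (ℕ.m+[n∸m]≡n (ℕ.≮⇒≥ n≮)))

  nonpositive-tail⇒bounded : ∀ (f : ℕ → ℤ) K → (∀ m → f (m ℕ.+ K) ≤ 0ℤ) →
                             BoundedAbove (λ m → ∑< m f)
  nonpositive-tail⇒bounded f K p = non-increasing⇒bounded _ 0 K λ m →
    by-difference (p m) (lemma (∑< (m ℕ.+ K) f) (f (m ℕ.+ K)))
    where
    lemma : ∀ s x → s - (s + x) ≡ 0ℤ - x
    lemma = solve-∀

  -- A loss of 1 per period means that (ℓ + 1) g(n) + n does not increase over a period. It is thus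
  -- bounded by some C, and g(n) is at most 0 once n reaches C.
  decreasing⇒nonpositive-tail : ∀ (g : ℕ → ℤ) ℓ K →
    (∀ m → g (suc ℓ ℕ.+ (m ℕ.+ K)) + 1ℤ ≤ g (m ℕ.+ K)) → ∃[ C ] ∀ m → g (m ℕ.+ C) ≤ 0ℤ
  decreasing⇒nonpositive-tail g ℓ K dec = finish (non-increasing⇒bounded _ ℓ K decreasing)
    where
    finish : BoundedAbove (λ n → + suc ℓ * g n + + n) → ∃[ C ] ∀ m → g (m ℕ.+ C) ≤ 0ℤ
    finish (C , p) = C , λ m → *-cancelˡ-≤-pos (g (m ℕ.+ C)) 0ℤ (+ suc ℓ)
        (≤-trans (by-difference (p (m ℕ.+ C)) (lemma₂ (+ suc ℓ * g (m ℕ.+ C)) (+ (m ℕ.+ C)) (+ C)))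
                 (by-difference (+≤+ (ℕ.m≤n+m C m)) (lemma₃ (+ suc ℓ) (+ C) (+ (m ℕ.+ C)))))
      where
      lemma₂ : ∀ a n c → c - n - a ≡ c - (a + n)
      lemma₂ = solve-∀
      lemma₃ : ∀ a c n → a * 0ℤ - (c - n) ≡ n - c
      lemma₃ = solve-∀
    lemma : ∀ a x y n → a * x + n - (a * y + (a + n)) ≡ a * x - a * (y + 1ℤ)
    lemma = solve-∀
    decreasing : ∀ m → + suc ℓ * g (suc ℓ ℕ.+ (m ℕ.+ K)) + + (suc ℓ ℕ.+ (m ℕ.+ K)) ≤
                       + suc ℓ * g (m ℕ.+ K) + + (m ℕ.+ K)
    decreasing m = by-difference (*-monoˡ-≤-nonNeg (+ suc ℓ) (dec m))
      (trans (cong (λ z → + suc ℓ * g (m ℕ.+ K) + + (m ℕ.+ K) - (+ suc ℓ * g (suc ℓ ℕ.+ (m ℕ.+ K)) + z))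
               (pos-+ (suc ℓ) (m ℕ.+ K)))
             (lemma (+ suc ℓ) (g (m ℕ.+ K)) (g (suc ℓ ℕ.+ (m ℕ.+ K))) (+ (m ℕ.+ K))))

  module Lasso {W : ℕ → ℕ → Maybe ℤ} {s a} (stem : Walks.Walk W s a)
               {k c} (first : W a k ≡ just c) (rest : Walks.Walk W k a) where
    open Walks W

    -- A position is the walk that remains to the base point `a`. Once it is used up, `first` is
    -- taken and `rest` remains, so stem and cycle are traversed by the same function.
    Position : Set
    Position = ∃ λ y → Walk y a

    next : Position → Position
    next (_ , ε)     = k , rest
    next (_ , _ ◂ p) = _ , p

    cost : Position → ℤ
    cost (_ , ε)               = c
    cost (_ , _◂_ {c = c′} _ _) = c′

    next-edge : ∀ x → W (proj₁ x) (proj₁ (next x)) ≡ just (cost x)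
    next-edge (_ , ε)     = first
    next-edge (_ , e ◂ p) = e

    position : ℕ → Position
    position zero    = s , stem
    position (suc n) = next (position n)

    arc : ℕ → ℤ
    arc n = cost (position n)

    E : ℕ → ℤ
    E n = ∑< n arc

    run : ∀ {y} (q : Walk y a) n → position n ≡ (y , q) →
          position (length q ℕ.+ n) ≡ (a , ε) × E (length q ℕ.+ n) ≡ E n + total q
    run ε n p = p , sym (+-identityʳ (E n))
    run (_◂_ {c = c′} e q) n p with u , v ← run q (suc n) (cong next p) =
      trans (cong position (sym (ℕ.+-suc (length q) n))) u ,
      trans (cong E (sym (ℕ.+-suc (length q) n)))
        (trans v (trans (cong (λ z → E n + cost z + total q) p) (+-assoc (E n) c′ (total q))))

    entry period : ℕ
    entry  = length stem ℕ.+ 0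
    period = suc (length rest)

    at-entry : position entry ≡ (a , ε)
    at-entry = proj₁ (run stem 0 refl)

    E-entry : E entry ≡ total stem
    E-entry = trans (proj₂ (run stem 0 refl)) (+-identityˡ (total stem))

    around : position (period ℕ.+ entry) ≡ (a , ε) × E (period ℕ.+ entry) ≡ E entry + (c + total rest)
    around with u , v ← run rest (suc entry) (cong next at-entry) =
      trans (cong position (sym (ℕ.+-suc (length rest) entry))) u ,
      trans (cong E (sym (ℕ.+-suc (length rest) entry)))
        (trans v (trans (cong (λ z → E entry + cost z + total rest) at-entry) (+-assoc (E entry) c (total rest))))

    periodic : ∀ m → position (period ℕ.+ (m ℕ.+ entry)) ≡ position (m ℕ.+ entry)
    periodic zero    = trans (proj₁ around) (sym at-entry)
    periodic (suc m) = trans (cong position (ℕ.+-suc period (m ℕ.+ entry))) (cong next (periodic m))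

    E-periodic : ∀ m → E (period ℕ.+ (m ℕ.+ entry)) ≡ E (m ℕ.+ entry) + (c + total rest)
    E-periodic zero    = proj₂ around
    E-periodic (suc m) = trans (cong E (ℕ.+-suc period (m ℕ.+ entry)))
      (trans (cong₂ _+_ (E-periodic m) (cong cost (periodic m)))
             (lemma (E (m ℕ.+ entry)) (c + total rest) (arc (m ℕ.+ entry))))
      where
      lemma : ∀ x y z → x + y + z ≡ x + z + y
      lemma = solve-∀

  finite-bound : ∀ (D : ℕ → Maybe ℤ) (f : ℤ → ℤ) K →
                 ∃[ C ] ∀ j v → j ℕ.< K → D j ≡ just v → f v ≤ + C
  finite-bound D f K with C , p ← prefix-bound (λ j → maybe f 0ℤ (D j)) K =
    C , λ j v j<K eq → subst (λ z → maybe f 0ℤ z ≤ + C) eq (p j j<K)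

  finite : ∀ {a v} → a ≼ just v → ∃[ u ] a ≡ just u × u ≤ v
  finite (just≤ p) = _ , refl , p

  just≼just : ∀ {u v} → just u ≼ just v → u ≤ v
  just≼just (just≤ p) = p

  record Path (W : ℕ → ℕ → Maybe ℤ) (s : ℕ) : Set where
    field
      vertex : ℕ → ℕ
      arc    : ℕ → ℤ
      start  : vertex 0 ≡ s
      edge   : ∀ n → W (vertex n) (vertex (suc n)) ≡ just (arc n)

    E : ℕ → ℤ
    E n = ∑< n arc

  -- The length of the cycle is at most N, so rounding the total N σ - b ℓ < 0 to a multiple
  -- of N leaves room for ℓ.
  cycle-room : ∀ M {b T σ ℓ} → b ≡ 0ℤ ⊎ b ≡ 1ℤ → T ≡ + suc M * σ - b * ℓ → T < 0ℤ →
               ℓ ≤ + suc M → T + ℓ ≤ 0ℤ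
  cycle-room M {σ = σ} {ℓ} (inj₁ refl) refl T<0 ℓ≤n =
    by-difference (+-mono-≤ (*-monoˡ-≤-nonNeg n (i<j⇒i≤pred[j] σ<0)) ℓ≤n) (lemma n σ ℓ)
    where
    n = + suc M
    simplify : ∀ n σ ℓ → n * 0ℤ - n * σ ≡ 0ℤ - (n * σ - 0ℤ * ℓ)
    simplify = solve-∀
    σ<0 : σ < 0ℤ
    σ<0 = *-cancelˡ-<-nonNeg n (<-by-difference T<0 (simplify n σ ℓ))
    lemma : ∀ n σ ℓ → 0ℤ - (n * σ - 0ℤ * ℓ + ℓ) ≡ n * -1ℤ + n - (n * σ + ℓ)
    lemma = solve-∀
  cycle-room M {σ = σ} {ℓ} (inj₂ refl) refl T<0 ℓ≤n =
    by-difference (*-monoˡ-≤-nonNeg n (i<j⇒i≤pred[j] σ<1)) (lemma n σ ℓ)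
    where
    n = + suc M
    simplify : ∀ n σ ℓ → n * 1ℤ - n * σ ≡ 0ℤ + n - (n * σ - 1ℤ * ℓ + ℓ)
    simplify = solve-∀
    σ<1 : σ < 1ℤ
    σ<1 = *-cancelˡ-<-nonNeg n (<-by-difference (+-mono-<-≤ T<0 ℓ≤n) (simplify n σ ℓ))
    lemma : ∀ n σ ℓ → 0ℤ - (n * σ - 1ℤ * ℓ + ℓ) ≡ n * 0ℤ - n * σ
    lemma = solve-∀

  module Analysis (M : ℕ) (W : ℕ → ℕ → Maybe ℤ) (s : ℕ) (δ : ℕ) (t b : ℤ)
                  (W-bounded : ∀ {i j c} → W i j ≡ just c → i ℕ.< suc M × j ℕ.< suc M)
                  (b∈ : b ≡ 0ℤ ⊎ b ≡ 1ℤ) where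
    N : ℕ
    N = suc M

    n d : ℤ
    n = + N
    d = + suc δ

    -- With `t / d` as the threshold, `excess` compares an energy with it without denominators.
    excess gain : ℤ → ℤ
    excess v = d * v - t
    gain v   = n * excess v - b

    S : ∀ {s} → Path W s → ℕ → ℤ
    S p m = ∑< m (λ i → excess (Path.E p (suc i)))

    D₀ : ℕ → Maybe ℤ
    D₀ j = if j ≡ᵇ s then just 0ℤ else nothing

    module B₁ = BellmanFord N W D₀ W-bounded

    height : ℕ → Maybe ℤ
    height = B₁.D N

    -- The test mirrors the machine, which branches on positivity only. For stable heights the slack
    -- of an edge is never negative, so failing the test means slack 0. The gain is taken at the
    -- target because the average counts the energy after each step.
    tightened : Maybe ℤ → Maybe ℤ → Maybe ℤ → Maybe ℤ
    tightened (just c) (just u) (just v) with 0ℤ <? u + c - v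
    ... | yes _ = nothing
    ... | no  _ = just (gain v)
    tightened _ _ _ = nothing

    -- Only edges without slack, weighted by their targets.
    W₂ : ℕ → ℕ → Maybe ℤ
    W₂ i j = tightened (W i j) (height i) (height j)

    record Tight (i j : ℕ) (g : ℤ) : Set where
      constructor tight
      field
        {cost from to} : ℤ
        arc       : W i j ≡ just cost
        from-at   : height i ≡ just from
        to-at     : height j ≡ just to
        no-slack  : from + cost - to ≤ 0ℤ
        weight    : g ≡ gain to

    W₂-tight : ∀ {i j g} → W₂ i j ≡ just g → Tight i j g
    W₂-tight {i} {j} p with W i j in e₁ | height i in e₂ | height j in e₃
    ... | just c | just u | just v with 0ℤ <? u + c - v
    W₂-tight refl | just c | just u | just v | no q = tight e₁ e₂ e₃ (≮⇒≥ q) refl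

    tight-W₂ : ∀ {i j c u v} → W i j ≡ just c → height i ≡ just u → height j ≡ just v →
               u + c - v ≤ 0ℤ → W₂ i j ≡ just (gain v)
    tight-W₂ {i} {j} {c} {u} {v} p q r z rewrite p | q | r with 0ℤ <? u + c - v
    ... | yes y = ⊥-elim (<⇒≱ y z)
    ... | no  _ = refl

    W₂-bounded : ∀ {i j c} → W₂ i j ≡ just c → i ℕ.< N × j ℕ.< N
    W₂-bounded p = W-bounded (Tight.arc (W₂-tight p))

    module B₂ = BellmanFord N W₂ (λ _ → just 0ℤ) W₂-bounded

    open Walks

    -- `D₀` is finite at the source alone, so the origin of any distance is the source with value 0.
    stem : ∀ r {a v} → B₁.D r a ≡ just v → Σ (Walk W s a) λ p → total W p ≡ v
    stem r {a} {v} p with i , v₀ , eq , q , tot ← B₁.origin r p ε with i ≡ᵇ s in i≡ | eq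
    ... | true | refl with refl ← ℕ.≡ᵇ⇒≡ i s (subst T (sym i≡) _) =
      q , trans (sym (+-identityˡ _)) (trans tot (+-identityʳ v))

    -- The common form of both bounds: `e = 1 - b` serves the upper bound on a good path, `e = - b`
    -- the lower bound on all paths.
    Φ : ∀ {s} → Path W s → ℤ → ℕ → ℤ
    Φ p e m = ∑< m (λ i → n * excess (Path.E p (suc i)) + e)

    Φ≡ : ∀ {s} (p : Path W s) e m → Φ p e m ≡ n * S p m + e * + m
    Φ≡ p e zero    = lemma n e
      where
      lemma : ∀ n e → 0ℤ ≡ n * 0ℤ + e * 0ℤ
      lemma = solve-∀
    Φ≡ p e (suc m) = trans (cong (_+ (n * excess (Path.E p (suc m)) + e)) (Φ≡ p e m))
                           (lemma n (S p m) e (+ m) (excess (Path.E p (suc m))))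
      where
      lemma : ∀ n s e m x → n * s + e * m + (n * x + e) ≡ n * (s + x) + e * (1ℤ + m)
      lemma = solve-∀

    -- For `b = 1` the sums of excesses stay bounded above, which gives an average of at most the
    -- threshold. For `b = 0` they also fall linearly, the margin that a strict inequality between
    -- averages requires.
    Low : Set
    Low = Σ (Path W s) λ p → BoundedAbove (λ m → n * S p m + (1ℤ - b) * + m)

    lasso-path : ∀ {a k c} → Walk W s a → W a k ≡ just c → Walk W k a → Path W s
    lasso-path stem first rest = record
      { vertex = λ m → proj₁ (L.position m) ; arc = L.arc ; start = refl
      ; edge = λ m → L.next-edge (L.position m) }
      where module L = Lasso {W} stem first rest

    low : (p : Path W s) → BoundedAbove (Φ p (1ℤ - b)) → Low
    low p (C , bound) = p , C , λ m → subst (_≤ + C) (Φ≡ p (1ℤ - b) m) (bound m)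

    negative-cycle⇒low : B₁.NegativeCycle → Low
    negative-cycle⇒low nc with B₁.NegativeCycle.cycle nc | B₁.NegativeCycle.nonempty nc | B₁.NegativeCycle.below-zero nc
    ... | _◂_ {c = c} first rest | _ | Δ<0 =
      low path (nonpositive-tail⇒bounded _ (proj₁ tail) (proj₂ tail))
      where
      st = proj₁ (stem (B₁.NegativeCycle.round nc) (B₁.NegativeCycle.reached nc))
      module L = Lasso {W} st first rest
      path = lasso-path st first rest
      Δ = c + total W rest

      φ : ℕ → ℤ
      φ i = n * excess (L.E (suc i)) + (1ℤ - b)

      κT≤ : n * d * Δ ≤ n * d * -1ℤ
      κT≤ = *-monoˡ-≤-nonNeg (n * d) {Δ} { -1ℤ} (i<j⇒i≤pred[j] Δ<0)

      κ≥1 : 1ℤ ≤ n * d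
      κ≥1 = +≤+ (s≤s z≤n)

      -- One turn lowers the energy by at least 1, hence the summand by at least `n * d`. The
      -- summands end up non-positive, and their sums are bounded above.
      drop : ∀ m → φ (L.period ℕ.+ (m ℕ.+ L.entry)) + 1ℤ ≤ φ (m ℕ.+ L.entry)
      drop m = by-difference (+-mono-≤ κT≤ κ≥1)
        (trans (cong (λ z → φ (m ℕ.+ L.entry) - (n * excess z + (1ℤ - b) + 1ℤ))
          (trans (cong L.E (sym (ℕ.+-suc L.period (m ℕ.+ L.entry)))) (L.E-periodic (suc m))))
          (lemma n d t b (L.E (suc (m ℕ.+ L.entry))) Δ))
        where
        lemma : ∀ n d t b e Δ → n * (d * e - t) + (1ℤ - b) - (n * (d * (e + Δ) - t) + (1ℤ - b) + 1ℤ)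
                ≡ n * d * -1ℤ + n * d - (n * d * Δ + 1ℤ)
        lemma = solve-∀

      tail : ∃[ C ] ∀ m → φ (m ℕ.+ C) ≤ 0ℤ
      tail = decreasing⇒nonpositive-tail φ (length W rest) L.entry drop

    embed : ∀ {i j} → Walk W₂ i j → Walk W i j
    embed ε       = ε
    embed (e ◂ q) = Tight.arc (W₂-tight e) ◂ embed q

    length-embed : ∀ {i j} (q : Walk W₂ i j) → length W (embed q) ≡ length W₂ q
    length-embed ε       = refl
    length-embed (e ◂ q) = cong suc (length-embed q)

    -- Displays the total as a multiple of `n` minus `b` per edge, the shape that `cycle-room`
    -- rounds.
    total-W₂ : ∀ {i j} (q : Walk W₂ i j) → ∃[ σ ] total W₂ q ≡ n * σ - b * + length W₂ q
    total-W₂ ε = 0ℤ , lemma n b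
      where
      lemma : ∀ n b → 0ℤ ≡ n * 0ℤ - b * 0ℤ
      lemma = solve-∀
    total-W₂ (e ◂ q) with σ , p ← total-W₂ q =
      excess to + σ , trans (cong₂ _+_ (Tight.weight (W₂-tight e)) p) (lemma n b (excess to) σ (+ length W₂ q))
      where
      to = Tight.to (W₂-tight e)
      lemma : ∀ n b x σ l → n * x - b + (n * σ - b * l) ≡ n * (x + σ) - b * (1ℤ + l)
      lemma = solve-∀

    module _ (stable : B₁.Stable M) where

      edge-bound : ∀ {i j u v c} → height i ≡ just u → W i j ≡ just c → height j ≡ just v → v ≤ u + c
      edge-bound {u = u} {c = c} p q r = just≼just (subst (_≼ just (u + c)) r (B₁.feasible M stable p q))

      module Unrolled {a k g₀} (e : W₂ a k ≡ just g₀) (rest : Walk W₂ k a)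
                      (T<0 : total W₂ (e ◂ rest) < 0ℤ) (ℓ≤N : length W₂ (e ◂ rest) ℕ.≤ N) where
        t₀ = W₂-tight e
        st = stem N (Tight.from-at t₀)
        module L = Lasso {W} (proj₁ st) (Tight.arc t₀) (embed rest)
        path = lasso-path (proj₁ st) (Tight.arc t₀) (embed rest)
        Ψ = Φ path (1ℤ - b)

        -- Across a tight edge the energy remains equal to the height, so the summand of `Ψ` is the
        -- weight of the edge in `W₂` plus 1. This extra 1 per edge is the room that `cycle-room`
        -- provides.
        step : ∀ {i j g} (τ : Tight i j g) m → L.arc m ≡ Tight.cost τ → height i ≡ just (L.E m) →
               height j ≡ just (L.E (suc m)) × Ψ (suc m) ≡ Ψ m + (g + 1ℤ)
        step {g = g} τ m p at =
          trans to-at (cong just to≡) ,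
          cong (λ z → Ψ m + z) (trans (cong (λ z → n * excess z + (1ℤ - b)) (sym to≡))
            (trans (lemma (n * excess to) b) (cong (_+ 1ℤ) (sym weight))))
          where
          open Tight τ
          lemma : ∀ x b → x + (1ℤ - b) ≡ x - b + 1ℤ
          lemma = solve-∀
          to≡ : to ≡ L.E (suc m)
          to≡ = trans (≤-antisym (edge-bound from-at arc to-at) (i-j≤0⇒i≤j no-slack))
                      (cong₂ _+_ (just-injective (trans (sym from-at) at)) (sym p))

        run₂ : ∀ {y} (q : Walk W₂ y a) m → L.position m ≡ (y , embed q) → height y ≡ just (L.E m) →
               height a ≡ just (L.E (length W₂ q ℕ.+ m)) ×
               Ψ (length W₂ q ℕ.+ m) ≡ Ψ m + (total W₂ q + + length W₂ q)
        run₂ ε m p at = at , sym (+-identityʳ (Ψ m))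
        run₂ (_◂_ {c = g} e q) m p at =
          subst (λ z → height a ≡ just (L.E z)) (ℕ.+-suc (length W₂ q) m) (proj₁ later) ,
          trans (cong Ψ (sym (ℕ.+-suc (length W₂ q) m)))
            (trans (proj₂ later) (trans (cong (_+ (total W₂ q + + length W₂ q)) (proj₂ here))
              (lemma (Ψ m) g (total W₂ q) (+ length W₂ q))))
          where
          here = step (W₂-tight e) m (cong L.cost p) at
          later = run₂ q (suc m) (cong L.next p) (proj₁ here)
          lemma : ∀ x g y l → x + (g + 1ℤ) + (y + l) ≡ x + (g + y + (1ℤ + l))
          lemma = solve-∀

        entry-height : height a ≡ just (L.E L.entry)
        entry-height = trans (Tight.from-at t₀) (cong just (sym (trans L.E-entry (proj₂ st))))

        first-step = step t₀ L.entry (cong L.cost L.at-entry) entry-height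
        other-steps = run₂ rest (suc L.entry) (cong L.next L.at-entry) (proj₁ first-step)

        index≡ : length W₂ rest ℕ.+ suc L.entry ≡ L.period ℕ.+ L.entry
        index≡ = trans (ℕ.+-suc _ L.entry) (cong (λ z → suc z ℕ.+ L.entry) (sym (length-embed rest)))

        Δ = Tight.cost t₀ + total W (embed rest)

        -- Before and after the turn the energy equals the height of `a`.
        Δ≡0 : Δ ≡ 0ℤ
        Δ≡0 = trans (lemma (L.E L.entry) Δ) (i≡j⇒i-j≡0 (trans (sym (proj₂ L.around)) (just-injective
          (trans (sym (trans (proj₁ other-steps) (cong (λ z → just (L.E z)) index≡))) entry-height))))
          where
          lemma : ∀ x y → y ≡ x + y - x
          lemma = solve-∀

        Ψ-around : Ψ (L.period ℕ.+ L.entry) ≤ Ψ L.entry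
        Ψ-around = by-difference
          (cycle-room M {σ = proj₁ (total-W₂ (e ◂ rest))} b∈ (proj₂ (total-W₂ (e ◂ rest))) T<0 (+≤+ ℓ≤N))
          (trans (cong (λ z → Ψ L.entry - z)
            (trans (cong Ψ (sym index≡)) (trans (proj₂ other-steps)
              (cong (_+ (total W₂ rest + + length W₂ rest)) (proj₂ first-step)))))
            (lemma (Ψ L.entry) g₀ (total W₂ rest) (+ length W₂ rest)))
          where
          lemma : ∀ x g y l → x - (x + (g + 1ℤ) + (y + l)) ≡ 0ℤ - (g + y + (1ℤ + l))
          lemma = solve-∀

        -- The energy is periodic by `Δ≡0`, so both sides grow by the same summand and the
        -- comparison at the entry of the cycle persists.
        decreasing : ∀ m → Ψ (L.period ℕ.+ (m ℕ.+ L.entry)) ≤ Ψ (m ℕ.+ L.entry)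
        decreasing zero    = Ψ-around
        decreasing (suc m) = subst (_≤ Ψ (suc m ℕ.+ L.entry))
          (trans (cong (λ z → Ψ (L.period ℕ.+ (m ℕ.+ L.entry)) + (n * excess z + (1ℤ - b))) (sym E≡))
                 (cong Ψ (sym (ℕ.+-suc L.period (m ℕ.+ L.entry)))))
          (+-monoˡ-≤ (n * excess (L.E (suc (m ℕ.+ L.entry))) + (1ℤ - b)) (decreasing m))
          where
          E≡ : L.E (suc (L.period ℕ.+ (m ℕ.+ L.entry))) ≡ L.E (suc (m ℕ.+ L.entry))
          E≡ = trans (cong L.E (sym (ℕ.+-suc L.period (m ℕ.+ L.entry))))
              (trans (L.E-periodic (suc m)) (trans (cong (λ z → L.E (suc (m ℕ.+ L.entry)) + z) Δ≡0) (+-identityʳ _)))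

        conclusion : Low
        conclusion = low path (non-increasing⇒bounded Ψ (length W (embed rest)) L.entry decreasing)

      tight-cycle⇒low : B₂.NegativeCycle → Low
      tight-cycle⇒low nc = unroll (B₂.NegativeCycle.cycle nc) (B₂.NegativeCycle.nonempty nc)
                                  (B₂.NegativeCycle.below-zero nc) (B₂.NegativeCycle.short nc)
        where
        unroll : ∀ {a} (q : Walk W₂ a a) → 1 ℕ.≤ length W₂ q → total W₂ q < 0ℤ →
                 length W₂ q ℕ.≤ N → Low
        unroll (e ◂ rest) _ T<0 ℓ≤N = Unrolled.conclusion e rest T<0 ℓ≤N

      module _ (s<N : s ℕ.< N) (stable₂ : B₂.Stable M) (p : Path W s) where
        open Path p hiding (start) renaming (edge to path-edge)

        vertex<N : ∀ m → vertex m ℕ.< N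
        vertex<N m = proj₁ (W-bounded (path-edge m))

        source-height : ∃[ u ] height s ≡ just u × u ≤ 0ℤ
        source-height = finite (≼-trans (subst (λ z → B₁.D z s ≼ D₀ s) (ℕ.+-identityʳ N) (B₁.D-mono N 0 s))
          (subst (_≼ just 0ℤ) (sym (D₀-source (ℕ.≡⇒≡ᵇ s s refl))) ≼-refl))
          where
          D₀-source : T (s ≡ᵇ s) → D₀ s ≡ just 0ℤ
          D₀-source p with true ← s ≡ᵇ s = refl

        heights : ∀ m → ∃[ u ] height (vertex m) ≡ just u
        heights zero    = proj₁ source-height ,
          trans (cong height (Path.start p)) (proj₁ (proj₂ source-height))
        heights (suc m) = proj₁ next , proj₁ (proj₂ next)
          where next = finite (B₁.feasible M stable (proj₂ (heights m)) (path-edge m))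

        h : ℕ → ℤ
        h m = proj₁ (heights m)

        -- The second run starts from 0 everywhere, so each vertex has a finite potential.
        potentials : ∀ j → ∃[ v ] B₂.D N j ≡ just v
        potentials j = proj₁ value , proj₁ (proj₂ value)
          where value = finite (subst (λ z → B₂.D z j ≼ just 0ℤ) (ℕ.+-identityʳ N) (B₂.D-mono N 0 j))

        π : ℕ → ℤ
        π m = proj₁ (potentials (vertex m))

        slack : ℕ → ℤ
        slack m = E m - h m

        h-step : ∀ m → h (suc m) ≤ h m + arc m
        h-step m = edge-bound (proj₂ (heights m)) (path-edge m) (proj₂ (heights (suc m)))

        π-step : ∀ m → h m + arc m - h (suc m) ≤ 0ℤ → π (suc m) ≤ π m + gain (h (suc m))
        π-step m z = just≼just (subst (_≼ just (π m + gain (h (suc m)))) (proj₂ (potentials (vertex (suc m))))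
          (B₂.feasible M stable₂ (proj₂ (potentials (vertex m)))
            (tight-W₂ (path-edge m) (proj₂ (heights m)) (proj₂ (heights (suc m))) z)))

        π-upper : ∃[ P ] ∀ m → π m ≤ + P
        π-upper = proj₁ fb , λ m → proj₂ fb (vertex m) (π m) (vertex<N m) (proj₂ (potentials (vertex m)))
          where fb = finite-bound (B₂.D N) (λ v → v) N

        π-lower : ∃[ P ] ∀ m → - π m ≤ + P
        π-lower = proj₁ fb , λ m → proj₂ fb (vertex m) (π m) (vertex<N m) (proj₂ (potentials (vertex m)))
          where fb = finite-bound (B₂.D N) -_ N

        gain-lower : ∃[ Γ ] ∀ m → - gain (h m) ≤ + Γ
        gain-lower = proj₁ fb , λ m → proj₂ fb (vertex m) (h m) (vertex<N m) (proj₂ (heights m))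
          where fb = finite-bound height (λ v → - gain v) N

        -- `Q` is the most that a step with slack can cost: potentials differ by at most `P₁ + P₂`
        -- and a gain is at least `- Γ`. Such a step raises the slack by 1 or more, so `Q` per unit
        -- of slack suffices; while the slack is below `Γ` this amounts to at most `Q * Γ`.
        P₁ P₂ Γ Q C : ℤ
        P₁ = + proj₁ π-upper
        P₂ = + proj₁ π-lower
        Γ  = + proj₁ gain-lower
        Q  = P₁ + P₂ + Γ
        C  = P₁ + P₂ + Q * Γ

        0≤Q : 0ℤ ≤ Q
        0≤Q = +≤+ z≤n

        slack-step : ∀ m → slack m ≤ slack (suc m)
        slack-step m = by-difference (h-step m) (lemma (E m) (arc m) (h m) (h (suc m)))
          where
          lemma : ∀ e a h h′ → e + a - h′ - (e - h) ≡ h + a - h′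
          lemma = solve-∀

        slack≥0 : ∀ m → 0ℤ ≤ slack m
        slack≥0 zero    = by-difference h0≤0 (lemma (h 0))
          where
          lemma : ∀ h → 0ℤ - h - 0ℤ ≡ 0ℤ - h
          lemma = solve-∀
          h0≤0 : h 0 ≤ 0ℤ
          h0≤0 = proj₂ (proj₂ source-height)
        slack≥0 (suc m) = ≤-trans (slack≥0 m) (slack-step m)

        term : ℕ → ℤ
        term m = n * excess (E (suc m)) + - b

        -- Energy is height plus slack, and the non-negative slack enters the term with the factor
        -- `n * d`, which is at least 1.
        term≥ : ∀ m → gain (h (suc m)) + slack (suc m) ≤ term m
        term≥ m = by-difference (*-monoʳ-≤-nonNeg (slack (suc m)) {{nonNegative (slack≥0 (suc m))}} {1ℤ} {n * d} (+≤+ (s≤s z≤n)))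
          (lemma n d t b (E (suc m)) (h (suc m)))
          where
          lemma : ∀ n d t b e h → n * (d * e - t) + - b - (n * (d * h - t) - b + (e - h)) ≡
                                  n * d * (e - h) - 1ℤ * (e - h)
          lemma = solve-∀

        Ω : ℕ → ℤ
        Ω = Φ p (- b)

        -- A step without slack is paid for by the potential, any other one by the slack.
        paid : ∀ m → π (suc m) - π m - Q * (slack (suc m) - slack m) ≤ term m
        paid m = decide (0ℤ <? h m + arc m - h (suc m))
         where
         decide : Dec (0ℤ < h m + arc m - h (suc m)) →
                  π (suc m) - π m - Q * (slack (suc m) - slack m) ≤ term m
         decide (no q) = by-difference
          (+-mono-≤ (+-mono-≤ (term≥ m) (π-step m (≮⇒≥ q)))
            (+-mono-≤ (slack≥0 (suc m)) (*-monoˡ-≤-nonNeg Q {{nonNegative 0≤Q}} (slack-step m))))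
          (lemma (π (suc m)) (π m) Q (slack (suc m)) (slack m) (term m) (gain (h (suc m))))
          where
          lemma : ∀ π′ π Q s′ s x g → x - (π′ - π - Q * (s′ - s)) ≡
                  x + (π + g) + (s′ + Q * s′) - (g + s′ + π′ + (0ℤ + Q * s))
          lemma = solve-∀
         decide (yes q) = by-difference
          (+-mono-≤ (+-mono-≤ (+-mono-≤ (term≥ m) (slack≥0 (suc m)))
              (+-mono-≤ (proj₂ π-upper (suc m)) (proj₂ π-lower m)))
            (+-mono-≤ (proj₂ gain-lower (suc m)) (*-monoˡ-≤-nonNeg Q {{nonNegative 0≤Q}} one≤)))
          (lemma (π (suc m)) (π m) P₁ P₂ Γ (slack (suc m)) (slack m) (term m) (gain (h (suc m))))
          where
          one≤ : 1ℤ ≤ slack (suc m) - slack m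
          one≤ = by-difference (i<j⇒suc[i]≤j q) (lemma′ (E m) (arc m) (h m) (h (suc m)))
            where
            lemma′ : ∀ e a h h′ → e + a - h′ - (e - h) - 1ℤ ≡ h + a - h′ - (1ℤ + 0ℤ)
            lemma′ = solve-∀
          lemma : ∀ π′ π P₁ P₂ Γ s′ s x g → x - (π′ - π - (P₁ + P₂ + Γ) * (s′ - s)) ≡
                  x + s′ + (P₁ + P₂) + (Γ + (P₁ + P₂ + Γ) * (s′ - s)) -
                  (g + s′ + 0ℤ + (π′ + - π) + (- g + (P₁ + P₂ + Γ) * 1ℤ))
          lemma = solve-∀

        paid-sum : ∀ m → π m - π 0 - Q * slack m ≤ Ω m
        paid-sum zero    = by-difference (*-monoˡ-≤-nonNeg Q {{nonNegative 0≤Q}} (slack≥0 0)) (lemma (π 0) Q (slack 0))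
          where
          lemma : ∀ x q s → 0ℤ - (x - x - q * s) ≡ q * s - q * 0ℤ
          lemma = solve-∀
        paid-sum (suc m) = by-difference (+-mono-≤ (paid-sum m) (paid m))
          (lemma (Ω m) (term m) (π (suc m)) (π m) (π 0) Q (slack (suc m)) (slack m))
          where
          lemma : ∀ o x π′ π π₀ q s′ s → o + x - (π′ - π₀ - q * s′) ≡
                  o + x - (π - π₀ - q * s + (π′ - π - q * (s′ - s)))
          lemma = solve-∀

        -- The current slack decides. Below `Γ` the bound `paid-sum` applies to the whole sum; from
        -- `Γ` on the last term is non-negative and the induction hypothesis suffices.
        Ω-bound : ∀ m → - C ≤ Ω m
        Ω-bound zero    = neg-mono-≤ {0ℤ} {C} (+-mono-≤ {0ℤ} {P₁ + P₂} {0ℤ} {Q * Γ} (+≤+ z≤n)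
          (≤-trans (≤-reflexive (sym (*-zeroʳ Q))) (*-monoˡ-≤-nonNeg Q {{nonNegative 0≤Q}} {0ℤ} {Γ} (+≤+ z≤n))))
        Ω-bound (suc m) = decide (slack (suc m) <? Γ)
         where
         decide : Dec (slack (suc m) < Γ) → - C ≤ Ω (suc m)
         decide (no q) = ≤-trans (Ω-bound m) (by-difference
          (+-mono-≤ (+-mono-≤ (term≥ m) (proj₂ gain-lower (suc m))) (≮⇒≥ q))
          (lemma (Ω m) (term m) (gain (h (suc m))) (slack (suc m)) Γ))
          where
          lemma : ∀ o x g s Γ → o + x - o ≡ x + Γ + s - (g + s + - g + Γ)
          lemma = solve-∀
         decide (yes q) = by-difference
          (+-mono-≤ (+-mono-≤ (paid-sum (suc m)) (*-monoˡ-≤-nonNeg Q {{nonNegative 0≤Q}} (<⇒≤ q)))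
            (+-mono-≤ (proj₂ π-upper 0) (proj₂ π-lower (suc m))))
          (lemma (Ω (suc m)) (π (suc m)) (π 0) Q (slack (suc m)) Γ P₁ P₂)
          where
          lemma : ∀ o π′ π₀ q s Γ P₁ P₂ → o - - (P₁ + P₂ + q * Γ) ≡
                  o + q * Γ + (P₁ + P₂) - (π′ - π₀ - q * s + q * s + (π₀ + - π′))
          lemma = solve-∀

        high : ∃[ B ] ∀ m → b * + m ≤ n * S p m + + B
        high = ∣ C ∣ , λ m → by-difference (+-mono-≤ (Ω-bound m) (≤-+∣∣ C))
          (trans (lemma (n * S p m) b (+ m) C (+ ∣ C ∣))
                 (cong (λ z → z + + ∣ C ∣ - (- C + C)) (sym (Φ≡ p (- b) m))))
          where
          lemma : ∀ x b m c k → x + k - b * m ≡ x + - b * m + k - (- c + c)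
          lemma = solve-∀

-- From bounds on partial sums to limits of averages

module Averages where
  open Graphs using (by-difference)
  open import Data.Integer hiding (suc; _/_)
  open import Data.Integer.Properties
  open import Data.Integer.Tactic.RingSolver using (solve-∀)
  open import Data.Nat as ℕ using (ℕ; suc; z≤n; s≤s)
  import Data.Nat.Properties as ℕ
  open import Data.Product using (_,_; ∃-syntax; proj₁; proj₂)
  open import Data.Rational as ℚ using (ℚ; 0ℚ; toℚᵘ; fromℚᵘ; ↥_; ↧_; ↧ₙ_)
  import Data.Rational.Properties as ℚ
  open import Data.Rational.Unnormalised as ℚᵘ using (ℚᵘ; mkℚᵘ; *≤*; *<*)
  import Data.Rational.Unnormalised.Properties as ℚᵘ
  open import Data.Empty using (⊥)
  open import Relation.Binary.PropositionalEquality

  ratio-≤⁻ : ∀ a m t ε → a ℚ./ suc m ℚ.≤ t ℚ.+ fromℚᵘ ε →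
             a * (↧ t * ℚᵘ.↧ ε) ≤ (↥ t * ℚᵘ.↧ ε + ℚᵘ.↥ ε * ↧ t) * + suc m
  ratio-≤⁻ a m t@record{} ε@record{} p = ℚᵘ.drop-*≤*
    (ℚᵘ.≤-trans (ℚᵘ.≤-reflexive (ℚᵘ.≃-sym (ℚ.toℚᵘ-fromℚᵘ (mkℚᵘ a m))))
    (ℚᵘ.≤-trans (ℚ.toℚᵘ-mono-≤ p)
    (ℚᵘ.≤-trans (ℚᵘ.≤-reflexive (ℚ.toℚᵘ-homo-+ t (fromℚᵘ ε)))
                (ℚᵘ.+-monoʳ-≤ (toℚᵘ t) (ℚᵘ.≤-reflexive (ℚ.toℚᵘ-fromℚᵘ ε))))))

  ratio-≤⁺ : ∀ a m t ε → a * (↧ t * ↧ ε) ≤ (↥ t * ↧ ε + ↥ ε * ↧ t) * + suc m →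
             a ℚ./ suc m ℚ.≤ t ℚ.+ ε
  ratio-≤⁺ a m t@record{} ε@record{} p = ℚ.toℚᵘ-cancel-≤
    (ℚᵘ.≤-trans (ℚᵘ.≤-reflexive (ℚ.toℚᵘ-fromℚᵘ (mkℚᵘ a m)))
    (ℚᵘ.≤-trans (*≤* p) (ℚᵘ.≤-reflexive (ℚᵘ.≃-sym (ℚ.toℚᵘ-homo-+ t ε)))))

  below : ∀ t (A : ℕ → ℤ) M C → (∀ m → + suc M * (↧ t * A m - ↥ t * + m) ≤ + C) →
          ∀ ε → 0ℚ ℚ.< ε → ∃[ n₀ ] ∀ n → n₀ ℕ.≤ n → A (suc n) ℚ./ suc n ℚ.≤ t ℚ.+ ε
  -- The average exceeds t by at most `C` divided by the number of terms, while ε is at least 1 /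
  -- `↧ₙ ε`.
  below t@record{} A M C bound ε@record{} 0<ε = C ℕ.* ↧ₙ ε , λ n n≥ → ratio-≤⁺ (A (suc n)) n t ε
    (by-difference
      (≤-trans (*-monoˡ-≤-nonNeg (↧ ε) (small (A (suc n)) (suc n)))
        (≤-trans (≤-reflexive (trans (*-comm (↧ ε) (+ C)) (sym (pos-* C (↧ₙ ε)))))
          (≤-trans (+≤+ (ℕ.≤-trans n≥ (ℕ.n≤1+n n)))
            (≤-trans (≤-reflexive (sym (*-identityˡ (+ suc n))))
                     (*-monoʳ-≤-nonNeg (+ suc n) one≤)))))
      (lemma (A (suc n)) (↧ t) (↧ ε) (↥ t) (↥ ε) (+ suc n)))
    where
    1≤↥ε : 1ℤ ≤ ↥ ε
    1≤↥ε = i<j⇒suc[i]≤j (subst₂ _<_ (*-zeroˡ (↧ ε)) (*-identityʳ (↥ ε)) (ℚ.drop-*<* 0<ε))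

    one≤ : 1ℤ ≤ ↥ ε * ↧ t
    one≤ = ≤-trans 1≤↥ε (≤-trans (≤-reflexive (sym (*-identityʳ (↥ ε))))
      (*-monoˡ-≤-nonNeg (↥ ε) {{nonNegative (≤-trans (+≤+ z≤n) 1≤↥ε)}} {1ℤ} {↧ t} (+≤+ (s≤s z≤n))))

    small : ∀ a m → ↧ t * A m - ↥ t * + m ≤ + C
    small a m = *-cancelˡ-≤-pos (↧ t * A m - ↥ t * + m) (+ C) (+ suc M)
      (≤-trans (bound m) (≤-trans (≤-reflexive (sym (*-identityˡ (+ C))))
        (*-monoʳ-≤-nonNeg (+ C) {1ℤ} {+ suc M} (+≤+ (s≤s z≤n)))))

    lemma : ∀ a d e t ε m → (t * e + ε * d) * m - a * (d * e) ≡ ε * d * m - e * (d * a - t * m)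
    lemma = solve-∀

  -- Up to an error that vanishes like 1 / m, the averages exceed t by 1 / (`suc M` * `↧ t`), so
  -- they cannot eventually stay within half of that.
  above : ∀ t (A : ℕ → ℤ) M C → (∀ m → + m ≤ + suc M * (↧ t * A m - ↥ t * + m) + + C) →
          (∀ ε → 0ℚ ℚ.< ε → ∃[ n₀ ] ∀ n → n₀ ℕ.≤ n → A (suc n) ℚ./ suc n ℚ.≤ t ℚ.+ ε) → ⊥
  above t@record{} A M C bound avg = absurd
    (by-difference (+-mono-≤ halved (+-mono-≤ (bound m) (bound m)))
      (lemma₁ (+ suc M) (↧ t * A m - ↥ t * + m) (+ C) (+ m)))
    where
    k : ℕ
    -- With this `k`, ε = 1 / k is half of the limiting gap.
    k = 2 ℕ.* (suc M ℕ.* ↧ₙ t)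

    ε : ℚᵘ
    ε = mkℚᵘ 1ℤ (ℕ.pred k)

    0<ε : 0ℚ ℚ.< fromℚᵘ ε
    0<ε = ℚ.toℚᵘ-cancel-< (ℚᵘ.<-respʳ-≃ (ℚᵘ.≃-sym (ℚ.toℚᵘ-fromℚᵘ ε)) (*<* (+<+ (s≤s z≤n))))

    tail = avg (fromℚᵘ ε) 0<ε

    m : ℕ
    -- Write x for `↧ t * A m - ↥ t * m` and n for `suc M`. The choice of ε gives 2 n x ≤ m and the
    -- hypothesis, taken twice, 2 m ≤ 2 n x + 2 C, which is absurd for m > 2 C.
    m = suc (C ℕ.+ C ℕ.+ proj₁ tail)

    step : A m * (↧ t * + k) ≤ (↥ t * + k + 1ℤ * ↧ t) * + m
    step = ratio-≤⁻ (A m) _ t ε (proj₂ tail _ (ℕ.m≤n+m (proj₁ tail) (C ℕ.+ C)))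

    k≡ : + k ≡ + 2 * (+ suc M * ↧ t)
    k≡ = trans (pos-* 2 (suc M ℕ.* ↧ₙ t)) (cong (+ 2 *_) (pos-* (suc M) (↧ₙ t)))

    halved : + 2 * + suc M * (↧ t * A m - ↥ t * + m) ≤ + m
    halved = *-cancelˡ-≤-pos _ (+ m) (↧ t)
      (by-difference (subst (λ z → A m * (↧ t * z) ≤ (↥ t * z + 1ℤ * ↧ t) * + m) k≡ step)
        (lemma₂ (A m) (↧ t) (↥ t) (+ suc M) (+ m)))
      where
      lemma₂ : ∀ a d t M m → d * m - d * (+ 2 * M * (d * a - t * m)) ≡
               (t * (+ 2 * (M * d)) + 1ℤ * d) * m - a * (d * (+ 2 * (M * d)))
      lemma₂ = solve-∀

    lemma₁ : ∀ M x c m → c + c - m ≡ m + (M * x + c + (M * x + c)) - (+ 2 * M * x + (m + m))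
    lemma₁ = solve-∀

    absurd : + m ≤ + C + + C → ⊥
    absurd (+≤+ p) = ℕ.<-irrefl refl (ℕ.≤-trans (s≤s (ℕ.m≤m+n (C ℕ.+ C) (proj₁ tail))) p)

-- Strategies in one-player games and paths in weighted graphs

module Games where
  open import Defs
  open Graphs using (by-difference)
  open Energy
  open Averages
  open import Data.Empty using (⊥-elim)
  open import Data.Fin using (Fin; toℕ; fromℕ<)
  open import Data.Fin.Properties using (toℕ<n; fromℕ<-toℕ; toℕ-fromℕ<; toℕ-injective) renaming (_≟_ to _≟ᶠ_)
  open import Data.Integer hiding (suc; _/_)
  open import Data.Integer.Properties
  open import Data.Integer.Tactic.RingSolver using (solve-∀)
  open import Data.Maybe as Maybe using (Maybe; just; nothing; Is-just; to-witness)
  open import Data.Maybe.Properties using (just-injective)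
  open import Data.Maybe.Relation.Unary.Any using (just)
  open import Data.Nat as ℕ using (ℕ; zero; suc)
  import Data.Nat.Properties as ℕ
  open import Data.Product using (Σ; _×_; _,_; proj₁; proj₂; ∃-syntax)
  open import Data.Rational as ℚ using (ℚ; ↥_; ↧_)
  open import Data.Sum using (_⊎_; inj₁; inj₂)
  open import Relation.Binary.PropositionalEquality
  open import Relation.Nullary using (¬_; Dec; yes; no)

  sgn : Player → ℤ
  sgn player₁ = 1ℤ
  sgn player₂ = -1ℤ

  -- Player 1 is content with a cycle of mean exactly t.  Cycles have at most n edges, so charging
  -- 1 per edge against n times the excess over t makes precisely the cycles of mean ≤ t negative.
  bias : Player → ℤ
  bias player₁ = 1ℤ
  bias player₂ = 0ℤ

  bias∈ : ∀ p → bias p ≡ 0ℤ ⊎ bias p ≡ 1ℤ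
  bias∈ player₁ = inj₂ refl
  bias∈ player₂ = inj₁ refl

  ∑<-cong : ∀ m {f g : ℕ → ℤ} → (∀ i → f i ≡ g i) → ∑< m f ≡ ∑< m g
  ∑<-cong zero    p = refl
  ∑<-cong (suc m) p = cong₂ _+_ (∑<-cong m p) (p m)

  module OnePlayerGame (G : Game) (p : Player) (owned : ∀ s → Game.owner G s ≡ p)
                       (s₀ : Game.State G) (t : ℚ) where
    open Game G

    -- The two decisions are arguments, so that lemmas can match on them directly.
    weightAt : ∀ {i j} → Dec (i ℕ.< #states) → Dec (j ℕ.< #states) → Maybe ℤ
    weightAt (yes i<) (yes j<) = Maybe.map (sgn p *_) (weight (fromℕ< i<) (fromℕ< j<))
    weightAt _        _        = nothing

    -- The game from the point of view of a minimising player.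
    W : ℕ → ℕ → Maybe ℤ
    W i j = weightAt (i ℕ.<? #states) (j ℕ.<? #states)

    weightAt-toℕ : ∀ a b (x : Dec (toℕ a ℕ.< #states)) (y : Dec (toℕ b ℕ.< #states)) →
                   weightAt x y ≡ Maybe.map (sgn p *_) (weight a b)
    weightAt-toℕ a b (yes x) (yes y) =
      cong₂ (λ a b → Maybe.map (sgn p *_) (weight a b)) (fromℕ<-toℕ a x) (fromℕ<-toℕ b y)
    weightAt-toℕ a b (no x) _ = ⊥-elim (x (toℕ<n a))
    weightAt-toℕ a b (yes _) (no y) = ⊥-elim (y (toℕ<n b))

    W-toℕ : ∀ a b → W (toℕ a) (toℕ b) ≡ Maybe.map (sgn p *_) (weight a b)
    W-toℕ a b = weightAt-toℕ a b (toℕ a ℕ.<? #states) (toℕ b ℕ.<? #states)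

    witness : ∀ {x : Maybe ℤ} (e : Is-just x) → Maybe.map (sgn p *_) x ≡ just (sgn p * to-witness e)
    witness (just _) = refl

    W-edge : ∀ {a b} (e : Edge a b) → W (toℕ a) (toℕ b) ≡ just (sgn p * w e)
    W-edge {a} {b} e = trans (W-toℕ a b) (witness e)

    W-bounded′ : ∀ {i j c} → W i j ≡ just c → i ℕ.< #states × j ℕ.< #states
    W-bounded′ {i} {j} e with i ℕ.<? #states | j ℕ.<? #states
    ... | yes x | yes y = x , y

    W-Edge : ∀ {a b c} → W (toℕ a) (toℕ b) ≡ just c → Edge a b
    W-Edge {a} {b} e = invert (weight a b) (trans (sym (W-toℕ a b)) e)
      where
      invert : ∀ x {c} → Maybe.map (sgn p *_) x ≡ just c → Is-just x
      invert (just _) _ = just _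

    M δ : ℕ
    M = ℕ.pred #states
    δ = ℚ.denominator-1 t

    states≡ : #states ≡ suc M
    states≡ = positive-size s₀
      where
      positive-size : ∀ {n} → Fin n → n ≡ suc (ℕ.pred n)
      positive-size {suc n} _ = refl

    W-bounded : ∀ {i j c} → W i j ≡ just c → i ℕ.< suc M × j ℕ.< suc M
    W-bounded {i} {j} e = subst (λ z → i ℕ.< z × j ℕ.< z) states≡ (W-bounded′ e)

    open Analysis M W (toℕ s₀) δ (sgn p * ↥ t) (bias p) W-bounded (bias∈ p) public

    follows : Play → Path W (toℕ s₀) → Set
    follows o π = ∀ i → toℕ (Play.state o i) ≡ Path.vertex π i

    play-sum : Play → ℕ → ℤ
    play-sum o m = ∑< m (λ i → EL G o (suc i))

    module _ (o : Play) (π : Path W (toℕ s₀)) (o≈π : follows o π) where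

      arc≡ : ∀ i → Path.arc π i ≡ sgn p * w (Play.step o i)
      arc≡ i = just-injective (trans (sym (Path.edge π i))
        (trans (cong₂ W (sym (o≈π i)) (sym (o≈π (suc i)))) (W-edge (Play.step o i))))

      E≡ : ∀ n → Path.E π n ≡ sgn p * EL G o n
      E≡ zero    = sym (*-zeroʳ (sgn p))
      E≡ (suc n) = trans (cong₂ _+_ (E≡ n) (arc≡ n)) (sym (*-distribˡ-+ (sgn p) (EL G o n) _))

      S≡ : ∀ m → S π m ≡ sgn p * (↧ t * play-sum o m - ↥ t * + m)
      S≡ zero    = lemma (sgn p) (↧ t) (↥ t)
        where
        lemma : ∀ s d t → 0ℤ ≡ s * (d * 0ℤ - t * 0ℤ)
        lemma = solve-∀
      S≡ (suc m) = trans (cong₂ _+_ (S≡ m) (cong excess (E≡ (suc m))))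
                         (lemma (sgn p) (↧ t) (↥ t) (play-sum o m) (EL G o (suc m)) (+ m))
        where
        lemma : ∀ s d t x e m → s * (d * x - t * m) + (d * (s * e) - s * t) ≡
                s * (d * (x + e) - t * (1ℤ + m))
        lemma = solve-∀

    path-of : (o : Play) → Play.state o 0 ≡ s₀ → Σ (Path W (toℕ s₀)) (follows o)
    path-of o eq = record
      { vertex = λ i → toℕ (Play.state o i) ; arc = λ i → sgn p * w (Play.step o i)
      ; start = cong toℕ eq ; edge = λ i → W-edge (Play.step o i) } , λ _ → refl

    module _ (π : Path W (toℕ s₀)) where
      open Path π

      vertex< : ∀ i → vertex i ℕ.< #states
      vertex< i = proj₁ (W-bounded′ (edge i))

      target : ℕ → State
      target i = fromℕ< (vertex< i)

      toℕ-target : ∀ i → toℕ (target i) ≡ vertex i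
      toℕ-target i = toℕ-fromℕ< (vertex< i)

      target-edge : ∀ i → Edge (target i) (target (suc i))
      target-edge i = W-Edge (trans (cong₂ W (toℕ-target i) (toℕ-target (suc i))) (edge i))

      size : ∀ {a b} → Prefix a b → ℕ
      size start   = 0
      size (h ∷ʳ _) = suc (size h)

      choose : ∀ m s → Dec (target m ≡ s) → ∃[ s′ ] Edge s s′
      choose m s (yes eq) = target (suc m) , subst (λ z → Edge z (target (suc m))) eq (target-edge m)
      choose m s (no _)   = total s

      -- The strategy replays the path by counting the steps made so far; off the path any edge will
      -- do.
      follow : ∀ q → Strategy q
      follow q _ s h _ = choose (size h) s (target (size h) ≟ᶠ s)

      choose-target : ∀ m s d → target m ≡ s → proj₁ (choose m s d) ≡ target (suc m)
      choose-target m s (yes _) _  = refl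
      choose-target m s (no ≢)  eq = ⊥-elim (≢ eq)

      -- `plays` speaks of an arbitrary `q` equal to `p`, so that it applies at `q = owner s`, where
      -- `next` evaluates `move`.
      module _ (σ₁ : Strategy player₁) (σ₂ : Strategy player₂)
               (plays : ∀ {a s} (h : Prefix a s) q (eq : owner s ≡ q) → q ≡ p →
                        move σ₁ σ₂ h q eq ≡ follow q a s h eq) where

        outcome-size : ∀ i → size (proj₂ (outcomePrefix σ₁ σ₂ s₀ i)) ≡ i
        outcome-size zero    = refl
        outcome-size (suc i) = cong suc (outcome-size i)

        outcome-target : ∀ i → target i ≡ proj₁ (outcomePrefix σ₁ σ₂ s₀ i)
        outcome-target zero    = toℕ-injective (trans (toℕ-target 0) (Path.start π))
        outcome-target (suc i) = sym (trans (cong proj₁ (plays past (owner _) refl (owned _)))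
          (trans (choose-target (size past) s (target (size past) ≟ᶠ s) (trans (cong target (outcome-size i)) (outcome-target i)))
                 (cong (λ z → target (suc z)) (outcome-size i))))
          where
          past = proj₂ (outcomePrefix σ₁ σ₂ s₀ i)
          s = proj₁ (outcomePrefix σ₁ σ₂ s₀ i)

        outcome-follows : follows (outcome σ₁ σ₂ s₀) π
        outcome-follows i = trans (cong toℕ (sym (outcome-target i))) (toℕ-target i)

    High : Set
    High = ∀ (π : Path W (toℕ s₀)) → ∃[ B ] ∀ m → bias p * + m ≤ n * S π m + + B

    Won : Set
    Won = ∃[ σ₁ ] Winning (AvgEnergy G t) s₀ σ₁

  module Player₁ (G : Game) (owned : ∀ s → Game.owner G s ≡ player₁) (s₀ : Game.State G) (t : ℚ) where
    open Game G
    open OnePlayerGame G player₁ owned s₀ t public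

    -- With bias 1 the linear term of `Low` vanishes, and what remains is the hypothesis of `below`.
    low⇒won : Low → Won
    low⇒won (π , C , bound) = follow π player₁ , λ σ₂ →
      below t (play-sum (outcome (follow π player₁) σ₂ s₀)) M C λ m →
        ≤-trans (≤-reflexive (sym (trans
          (cong (λ z → n * z + (1ℤ - 1ℤ) * + m) (S≡ (outcome (follow π player₁) σ₂ s₀) π
            (outcome-follows π (follow π player₁) σ₂ (plays σ₂)) m))
          (lemma n (↧ t * play-sum (outcome (follow π player₁) σ₂ s₀) m - ↥ t * + m) (+ m)))))
          (bound m)
      where
      plays : ∀ σ₂ {a s} (h : Prefix a s) q (eq : owner s ≡ q) → q ≡ player₁ →
              move (follow π player₁) σ₂ h q eq ≡ follow π q a s h eq
      plays σ₂ h player₁ eq refl = refl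
      lemma : ∀ n x m → n * (1ℤ * x) + (1ℤ - 1ℤ) * m ≡ n * x
      lemma = solve-∀

    -- Every state belongs to player 1, so an arbitrary strategy of player 2 already produces a play
    -- that refutes the claim.
    high⇒lost : High → ¬ Won
    high⇒lost high (σ₁ , win) = above t (play-sum o) M (proj₁ bound) (λ m →
      ≤-trans (≤-reflexive (sym (*-identityˡ (+ m)))) (≤-trans (proj₂ bound m)
        (≤-reflexive (cong (λ z → n * z + + proj₁ bound)
          (trans (S≡ o (proj₁ path) (proj₂ path) m) (*-identityˡ _)))))) (win σ₂)
      where
      σ₂ : Strategy player₂
      σ₂ _ s _ _ = total s
      o = outcome σ₁ σ₂ s₀
      path = path-of o refl
      bound = high (proj₁ path)

  module Player₂ (G : Game) (owned : ∀ s → Game.owner G s ≡ player₂) (s₀ : Game.State G) (t : ℚ) where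
    open Game G
    open OnePlayerGame G player₂ owned s₀ t public

    -- Undoing the negation turns an upper bound with linear margin into the linear lower bound that
    -- `above` refutes.
    low⇒lost : Low → ¬ Won
    low⇒lost (π , C , bound) (σ₁ , win) = above t (play-sum o) M C (λ m → by-difference (bound m)
        (trans (lemma n (↧ t * play-sum o m - ↥ t * + m) (+ m) (+ C))
          (cong (λ z → + C - (n * z + (1ℤ - 0ℤ) * + m)) (sym (S≡ o π (outcome-follows π σ₁ σ₂ plays) m)))))
      (win σ₂)
      where
      σ₂ = follow π player₂
      o = outcome σ₁ σ₂ s₀
      plays : ∀ {a s} (h : Prefix a s) q (eq : owner s ≡ q) → q ≡ player₂ →
              move σ₁ σ₂ h q eq ≡ follow π q a s h eq
      plays h player₂ eq refl = refl
      lemma : ∀ n x m c → n * x + c - m ≡ c - (n * (-1ℤ * x) + (1ℤ - 0ℤ) * m)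
      lemma = solve-∀

    high⇒won : High → Won
    high⇒won high = (λ _ s _ _ → total s) , λ σ₂ →
      let o = outcome (λ _ s _ _ → total s) σ₂ s₀
          path = path-of o refl
          bound = high (proj₁ path)
      in below t (play-sum o) M (proj₁ bound) λ m → by-difference (proj₂ bound m)
           (trans (lemma n (↧ t * play-sum o m - ↥ t * + m) (+ m) (+ proj₁ bound))
             (cong (λ z → n * z + + proj₁ bound - 0ℤ * + m) (sym (S≡ o (proj₁ path) (proj₂ path) m))))
      where
      lemma : ∀ n x m c → c - n * x ≡ n * (-1ℤ * x) + c - 0ℤ * m
      lemma = solve-∀

-- Bellman-Ford as a program

module Algorithm where
  open Graphs
  open Language
  open import Data.Bool using (Bool; true; false; _∨_)
  open import Data.List using ([]; _∷_)
  open import Data.Integer as ℤ using (ℤ; +_; +[1+_]; -[1+_]; 0ℤ; 1ℤ; ∣_∣)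
  import Data.Integer.Properties as ℤ
  open import Data.Maybe using (Maybe; just; nothing)
  open import Data.Nat
  open import Data.Nat.Properties
  open import Data.Product using (∃-syntax; _×_; _,_; proj₁; proj₂)
  open import Relation.Binary.PropositionalEquality hiding ([_])
  open import Relation.Nullary using (¬_; yes; no)

  infix 6 _≔_
  infix 20 ‵_

  ‵_ : Var → Exp
  ‵ a = a [ lit 0ℤ ]

  _≔_ : Var → Exp → Cmd
  a ≔ f = a [ lit 0ℤ ]≔ f

  increment : Var → Cmd
  increment a = a ≔ ‵ a ⊕ lit 1ℤ

  update : Cmd
  update = bestD ≔ ‵ aux ⨾ bestR ≔ lit 1ℤ ⨾ (changed ≔ lit 1ℤ)

  improve : Cmd
  improve = ifPos (‵ active) (ifPos (reach [ ‵ row ])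
    (aux ≔ dist [ ‵ row ] ⊕ ‵ arc ⨾
     ifPos (‵ bestR) (ifPos (‵ bestD ⊖ ‵ aux) update skip) update) skip) skip

  advance : Cmd
  advance = increment row ⨾ (ptr ≔ ‵ ptr ⊕ ‵ order)

  relaxArc : Cmd → Cmd
  relaxArc arcCmd = arcCmd ⨾ improve ⨾ advance

  enter leave : Cmd
  enter = bestR ≔ reach [ ‵ col ] ⨾ bestD ≔ dist [ ‵ col ] ⨾ row ≔ lit 0ℤ ⨾ (ptr ≔ ‵ col)
  leave = reach′ [ ‵ col ]≔ ‵ bestR ⨾ dist′ [ ‵ col ]≔ ‵ bestD ⨾ increment col

  column : Cmd → Cmd
  column arcCmd = enter ⨾ loop states (relaxArc arcCmd) ⨾ leave

  copy : Cmd
  copy = reach [ ‵ col ]≔ reach′ [ ‵ col ] ⨾ dist [ ‵ col ]≔ dist′ [ ‵ col ] ⨾ increment col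

  -- The new distances go to separate arrays and are copied back after the round, which keeps rounds
  -- synchronous. `changed` is reset in each round, so at the end it reports on the last one.
  columns copies round bellmanFord : Cmd → Cmd
  columns arcCmd = changed ≔ lit 0ℤ ⨾ col ≔ lit 0ℤ ⨾ loop states (column arcCmd)
  copies _ = col ≔ lit 0ℤ ⨾ loop states copy
  round arcCmd = columns arcCmd ⨾ copies arcCmd
  bellmanFord arcCmd = loop states (round arcCmd)

  edgeArc : Cmd
  edgeArc = active ≔ edges [ ‵ ptr ] ⨾ (arc ≔ weights [ ‵ ptr ])

  tightArc : Cmd
  tightArc = active ≔ lit 0ℤ ⨾ arc ≔ gain [ ‵ col ] ⨾
    ifPos (edges [ ‵ ptr ]) (ifPos (seen [ ‵ row ]) (ifPos (seen [ ‵ col ])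
      (ifPos (height [ ‵ row ] ⊕ weights [ ‵ ptr ] ⊖ height [ ‵ col ]) skip (active ≔ lit 1ℤ))
      skip) skip) skip

  -- A computable frame condition: for a concrete command and variable, non-interference is proved
  -- by `refl`.
  writes : Cmd → Var → Bool
  writes skip          b = false
  writes (P ⨾ Q)       b = writes P b ∨ writes Q b
  writes (a [ _ ]≔ _)  b = code b ≡ᵇ code a
  writes (read a)      b = code b ≡ᵇ code a
  writes (ifPos _ P Q) b = writes P b ∨ writes Q b
  writes (loop _ P)    b = writes P b

  reads : Cmd → Bool
  reads (P ⨾ Q)       = reads P ∨ reads Q
  reads (read _)      = true
  reads (ifPos _ P Q) = reads P ∨ reads Q
  reads (loop _ P)    = reads P
  reads _             = false

  ∨-false : ∀ {x y} → x ∨ y ≡ false → x ≡ false × y ≡ false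
  ∨-false {false} p = refl , p

  positive-true : ∀ {z} → 0ℤ ℤ.< z → positive z ≡ true
  positive-true {+[1+ _ ]} _ = refl
  positive-true {+ zero} (ℤ.+<+ ())

  positive-false : ∀ {z} → z ℤ.≤ 0ℤ → positive z ≡ false
  positive-false {+ zero} _ = refl
  positive-false { -[1+ _ ]} _ = refl
  positive-false {+[1+ _ ]} (ℤ.+≤+ ())

  positive-difference : ∀ {x y} → x ℤ.< y → positive (y ℤ.- x) ≡ true
  positive-difference {x} {y} p = positive-true (<-by-difference p (ℤ.+-identityʳ (y ℤ.- x)))

  nonpositive-difference : ∀ {x y} → ¬ x ℤ.< y → positive (y ℤ.- x) ≡ false
  nonpositive-difference p = positive-false (ℤ.i≤j⇒i-j≤0 (ℤ.≮⇒≥ p))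

  suc≡ : ∀ {x} k → x ≡ + k → x ℤ.+ 1ℤ ≡ + suc k
  suc≡ k refl = cong +_ (+-comm k 1)

  -- A distance held in two memory cells, a flag and a value; the value is arbitrary for nothing.
  data Encodes : ℤ → ℤ → Maybe ℤ → Set where
    none : ∀ {f v} → f ≡ 0ℤ → Encodes f v nothing
    some : ∀ {f v u} → f ≡ 1ℤ → v ≡ u → Encodes f v (just u)

  encodes-cong : ∀ {f v f′ v′ m} → f′ ≡ f → v′ ≡ v → Encodes f v m → Encodes f′ v′ m
  encodes-cong refl refl E = E

  module Reasoning (β : Bound → ℕ) where
    open Semantics β public

    Preserves : Cmd → Var → Set
    Preserves c a = ∀ st n → mem (⟦ c ⟧ st) a n ≡ mem st a n

    preserves-⨾ : ∀ P Q {a} → Preserves P a → Preserves Q a → Preserves (P ⨾ Q) a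
    preserves-⨾ P Q p q st n = trans (q (⟦ P ⟧ st) n) (p st n)

    preserves-iter : ∀ {P a} → Preserves P a → ∀ m st n → mem (iter m ⟦ P ⟧ st) a n ≡ mem st a n
    preserves-iter p zero    st n = refl
    preserves-iter {P} p (suc m) st n = trans (preserves-iter {P} p m (⟦ P ⟧ st) n) (p st n)

    preserves-loop : ∀ b P {a} → Preserves P a → Preserves (loop b P) a
    preserves-loop b P {a} p st n =
      trans (cong (λ z → mem z a n) (repeat≡ (β b) ⟦ P ⟧ st)) (preserves-iter {P} p (β b) st n)

    preserves : ∀ c {a} → writes c a ≡ false → Preserves c a
    preserves skip p st n = refl
    preserves (P ⨾ Q) p = preserves-⨾ P Q (preserves P (proj₁ (∨-false p))) (preserves Q (proj₂ (∨-false p)))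
    preserves (a [ _ ]≔ _) p st n rewrite p = refl
    preserves (read a) p (state s nothing) n = refl
    preserves (read a) p (state s (just [])) n = refl
    preserves (read a) p (state s (just (_ ∷ _))) n rewrite p = refl
    preserves (ifPos f P Q) p st n with positive (eval f (mem st))
    ... | true  = preserves P (proj₁ (∨-false p)) st n
    ... | false = preserves Q (proj₂ (∨-false p)) st n
    preserves (loop b P) p = preserves-loop b P (preserves P p)

    branch-true : ∀ f P Q st → positive (eval f (mem st)) ≡ true → ⟦ ifPos f P Q ⟧ st ≡ ⟦ P ⟧ st
    branch-true f P Q st p rewrite p = refl

    branch-false : ∀ f P Q st → positive (eval f (mem st)) ≡ false → ⟦ ifPos f P Q ⟧ st ≡ ⟦ Q ⟧ st
    branch-false f P Q st p rewrite p = refl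

    silent : ∀ c → reads c ≡ false → ∀ st → inp (⟦ c ⟧ st) ≡ inp st
    silent skip p st = refl
    silent (P ⨾ Q) p st = trans (silent Q (proj₂ (∨-false p)) (⟦ P ⟧ st)) (silent P (proj₁ (∨-false p)) st)
    silent (a [ _ ]≔ _) p st = refl
    silent (ifPos f P Q) p st with positive (eval f (mem st))
    ... | true  = silent P (proj₁ (∨-false p)) st
    ... | false = silent Q (proj₂ (∨-false p)) st
    silent (loop b P) p st = trans (cong inp (repeat≡ (β b) ⟦ P ⟧ st)) (go (β b) st)
      where
      go : ∀ n st → inp (iter n ⟦ P ⟧ st) ≡ inp st
      go zero    st = refl
      go (suc n) st = trans (go n (⟦ P ⟧ st)) (silent P p st)

    -- The step may use that all variables preserved by the body still have their values from before
    -- the loop, which keeps frame conditions out of the invariants.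
    loop-invariant : ∀ b c (Inv : ℕ → State → Set) {st} →
      (∀ k st′ → k < β b → (∀ a → Preserves c a → ∀ n → mem st′ a n ≡ mem st a n) →
         Inv k st′ → Inv (suc k) (⟦ c ⟧ st′)) →
      Inv 0 st → Inv (β b) (⟦ loop b c ⟧ st)
    loop-invariant b c Inv {st} step base =
      subst (Inv (β b)) (sym (repeat≡ (β b) ⟦ c ⟧ st)) (go (β b) 0 refl (λ _ _ _ → refl) base)
      where
      go : ∀ m k {st′} → k + m ≡ β b → (∀ a → Preserves c a → ∀ n → mem st′ a n ≡ mem st a n) →
           Inv k st′ → Inv (β b) (iter m ⟦ c ⟧ st′)
      go zero    k {st′} eq fr i = subst (λ z → Inv z st′) (trans (sym (+-identityʳ k)) eq) i
      go (suc m) k {st′} eq fr i = go m (suc k) (trans (sym (+-suc k m)) eq)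
        (λ a p n → trans (p st′ n) (fr a p n))
        (step k st′ (subst (k <_) eq (m<m+n k z<s)) fr i)

  module Improve (β : Bound → ℕ) where
    open Reasoning β

    data Progress (b b′ : Maybe ℤ) (c c′ : ℤ) : Set where
      idle  : b′ ≡ b → c′ ≡ c → Progress b b′ c c′
      gains : b′ ≺ b → c′ ≡ 1ℤ → Progress b b′ c c′

    record Improved (b b′ : Maybe ℤ) (s s′ : Store) : Set where
      constructor improved
      field
        stored   : Encodes (s′ bestR 0) (s′ bestD 0) b′
        progress : Progress b b′ (s changed 0) (s′ changed 0)

    improve-correct : ∀ st {d w b} i → mem st row 0 ≡ + i →
      Encodes (mem st active 0) (mem st arc 0) w →
      Encodes (mem st reach i) (mem st dist i) d →
      Encodes (mem st bestR 0) (mem st bestD 0) b →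
      Improved b (relax d w b) (mem st) (mem (⟦ improve ⟧ st))
    improve-correct st {just u} i r (none a) D B rewrite a = improved B (idle refl refl)
    improve-correct st {nothing} i r (none a) D B rewrite a = improved B (idle refl refl)
    improve-correct st i r (some a c) (none z) B rewrite a | r | z = improved B (idle refl refl)
    improve-correct st i r (some a refl) (some z refl) (none b) rewrite a | r | z | b =
      improved (some refl refl) (gains ≺∞ refl)
    improve-correct st i r (some {u = c} a refl) (some {u = u} z refl) (some {u = v} b refl)
      rewrite a | r | z | b with mem st dist i ℤ.+ mem st arc 0 ℤ.<? mem st bestD 0
    ... | yes p rewrite positive-difference p = improved (some refl refl) (gains (just< p) refl)
    ... | no  p rewrite nonpositive-difference p = improved (some b refl) (idle refl refl)

  -- Variables that Bellman-Ford leaves alone. The tables from which arcs are computed live here, so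
  -- facts about them survive every round.
  data Fixed : Var → Set where
    is-order   : Fixed order
    is-edges   : Fixed edges
    is-weights : Fixed weights
    is-height  : Fixed height
    is-seen    : Fixed seen
    is-gain    : Fixed gain
    is-num     : Fixed num
    is-player  : Fixed player

  fixed-elim : ∀ {P : Var → Set} → P order → P edges → P weights → P height → P seen → P gain →
               P num → P player → ∀ {a} → Fixed a → P a
  fixed-elim o e w h s g n p is-order   = o
  fixed-elim o e w h s g n p is-edges   = e
  fixed-elim o e w h s g n p is-weights = w
  fixed-elim o e w h s g n p is-height  = h
  fixed-elim o e w h s g n p is-seen    = s
  fixed-elim o e w h s g n p is-gain    = g
  fixed-elim o e w h s g n p is-num     = n
  fixed-elim o e w h s g n p is-player  = p

  Agree : Store → Store → Set
  Agree s s′ = ∀ a n → Fixed a → s′ a n ≡ s a n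

  isArc : Var → Bool
  isArc a = (code a ≡ᵇ code active) ∨ (code a ≡ᵇ code arc)

  -- Generic in the command that fetches an arc and in an invariant `Ctx` of the tables it consults,
  -- as both runs share the loops.
  module Rounds (β : Bound → ℕ) (W : ℕ → ℕ → Maybe ℤ) (D₀ : ℕ → Maybe ℤ)
      (W-bounded : ∀ {i j c} → W i j ≡ just c → i < β states × j < β states)
      (arcCmd : Cmd)
      (arc-keeps : ∀ a → isArc a ≡ false → Reasoning.Preserves β arcCmd a)
      (Ctx : Store → Set)
      (ctx-agree : ∀ {s s′} → Ctx s → Agree s s′ → Ctx s′)
      (ctx-order : ∀ {s} → Ctx s → s order 0 ≡ + β states)
      (arc-correct : ∀ st i j → i < β states → j < β states → Ctx (mem st) →
         mem st row 0 ≡ + i → mem st col 0 ≡ + j → mem st ptr 0 ≡ + (i * β states + j) →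
         Encodes (mem (Semantics.⟦_⟧ β arcCmd st) active 0) (mem (Semantics.⟦_⟧ β arcCmd st) arc 0) (W i j))
      where
    open Reasoning β
    open Improve β

    N : ℕ
    N = β states

    open BellmanFord N W D₀ W-bounded public

    progress-trans : ∀ {b b′ b″ c c′ c″} → Progress b b′ c c′ → Progress b′ b″ c′ c″ → Progress b b″ c c″
    progress-trans (idle p q)  (idle p′ q′)  = idle (trans p′ p) (trans q′ q)
    progress-trans (idle refl q) (gains p′ q′) = gains p′ q′
    progress-trans (gains p q) (idle refl q′) = gains p (trans q′ q)
    progress-trans (gains p q) (gains p′ q′) = gains (≺-≼-trans p′ (≺⇒≼ p)) q′

    relax-keeps : ∀ a → isArc a ≡ false → writes (improve ⨾ advance) a ≡ false → Preserves (relaxArc arcCmd) a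
    relax-keeps a p q = preserves-⨾ arcCmd (improve ⨾ advance) (arc-keeps a p) (preserves (improve ⨾ advance) q)

    relax-fixed : ∀ {a} → Fixed a → Preserves (relaxArc arcCmd) a
    relax-fixed {a} f = relax-keeps a (fixed-elim {λ a → isArc a ≡ false} refl refl refl refl refl refl refl refl f)
      (fixed-elim {λ a → writes (improve ⨾ advance) a ≡ false} refl refl refl refl refl refl refl refl f)

    column-keeps : ∀ a → isArc a ≡ false → writes (improve ⨾ advance) a ≡ false →
                   writes enter a ≡ false → writes leave a ≡ false → Preserves (column arcCmd) a
    column-keeps a p q r s = preserves-⨾ enter (loop states (relaxArc arcCmd) ⨾ leave) (preserves enter r)
      (preserves-⨾ (loop states (relaxArc arcCmd)) leave (preserves-loop states (relaxArc arcCmd) (relax-keeps a p q)) (preserves leave s))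

    enter-fixed : ∀ {a} → Fixed a → Preserves enter a
    enter-fixed f = preserves enter (fixed-elim {λ a → writes enter a ≡ false} refl refl refl refl refl refl refl refl f)

    column-fixed : ∀ {a} → Fixed a → Preserves (column arcCmd) a
    column-fixed {a} f = preserves-⨾ enter (loop states (relaxArc arcCmd) ⨾ leave) (enter-fixed f)
      (preserves-⨾ (loop states (relaxArc arcCmd)) leave (preserves-loop states (relaxArc arcCmd) (relax-fixed f))
        (preserves leave (fixed-elim {λ a → writes leave a ≡ false} refl refl refl refl refl refl refl refl f)))

    Holds : (ℕ → Maybe ℤ) → Store → Set
    Holds D s = ∀ i → i < N → Encodes (s reach i) (s dist i) (D i)

    record Inner (D : ℕ → Maybe ℤ) (j : ℕ) (c₀ : ℤ) (k : ℕ) (st : State) : Set where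
      constructor inner
      field
        row≡     : mem st row 0 ≡ + k
        ptr≡     : mem st ptr 0 ≡ + (k * N + j)
        stored   : Encodes (mem st bestR 0) (mem st bestD 0) (best D j k)
        progress : Progress (D j) (best D j k) c₀ (mem st changed 0)

    relax-correct : ∀ D j c₀ k st → j < N → k < N → Ctx (mem st) → Holds D (mem st) →
      mem st col 0 ≡ + j → Inner D j c₀ k st → Inner D j c₀ (suc k) (⟦ relaxArc arcCmd ⟧ st)
    relax-correct D j c₀ k st j< k< C H c≡ (inner r p s g) = inner
      (suc≡ k (trans (preserves improve {row} refl st₁ 0) row₁))
      (trans (cong₂ ℤ._+_ (trans (preserves improve {ptr} refl st₁ 0) (trans (arc-keeps ptr refl st 0) p))
               (trans (preserves improve {order} refl st₁ 0) (trans (arc-keeps order refl st 0) (ctx-order C))))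
             (cong +_ (trans (+-assoc (k * N) j N) (trans (cong (λ z → k * N + z) (+-comm j N))
               (trans (sym (+-assoc (k * N) N j)) (cong (λ z → z + j) (+-comm (k * N) N)))))))
      (Improved.stored better)
      (progress-trans g (subst (λ z → Progress (best D j k) (best D j (suc k)) z (mem st₂ changed 0))
        (arc-keeps changed refl st 0) (Improved.progress better)))
      where
      st₁ = ⟦ arcCmd ⟧ st
      st₂ = ⟦ improve ⟧ st₁
      row₁ = trans (arc-keeps row refl st 0) r
      better = improve-correct st₁ k row₁ (arc-correct st k j k< j< C r c≡ p)
        (encodes-cong (arc-keeps reach refl st k) (arc-keeps dist refl st k) (H k k<))
        (encodes-cong (arc-keeps bestR refl st 0) (arc-keeps bestD refl st 0) s)

    record Column (D : ℕ → Maybe ℤ) (j : ℕ) (s s′ : Store) : Set where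
      field
        col≡     : s′ col 0 ≡ + suc j
        here     : Encodes (s′ reach′ j) (s′ dist′ j) (best D j N)
        others   : ∀ m → m ≢ j → s′ reach′ m ≡ s reach′ m × s′ dist′ m ≡ s dist′ m
        progress : Progress (D j) (best D j N) (s changed 0) (s′ changed 0)

    leave-at : ∀ st j → mem st col 0 ≡ + j →
      mem (⟦ leave ⟧ st) reach′ j ≡ mem st bestR 0 × mem (⟦ leave ⟧ st) dist′ j ≡ mem st bestD 0
    leave-at st j p rewrite p | ≡ᵇ-refl j = refl , refl

    leave-other : ∀ st j m → mem st col 0 ≡ + j → m ≢ j →
      mem (⟦ leave ⟧ st) reach′ m ≡ mem st reach′ m × mem (⟦ leave ⟧ st) dist′ m ≡ mem st dist′ m
    leave-other st j m p q rewrite p | ≢⇒≡ᵇ q = refl , refl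

    column-correct : ∀ D j st → j < N → Ctx (mem st) → Holds D (mem st) → mem st col 0 ≡ + j →
                     Column D j (mem st) (mem (⟦ column arcCmd ⟧ st))
    column-correct D j st j< C H c≡ = record
      { col≡ = suc≡ j col₂
      ; here = encodes-cong (proj₁ (leave-at st₂ j col₂)) (proj₂ (leave-at st₂ j col₂)) (Inner.stored I)
      ; others = λ m m≢j →
          trans (proj₁ (leave-other st₂ j m col₂ m≢j)) (preserves-loop states (relaxArc arcCmd) (relax-keeps reach′ refl refl) st₁ m) ,
          trans (proj₂ (leave-other st₂ j m col₂ m≢j)) (preserves-loop states (relaxArc arcCmd) (relax-keeps dist′ refl refl) st₁ m)
      ; progress = Inner.progress I
      }
      where
      st₁ = ⟦ enter ⟧ st
      st₂ = ⟦ loop states (relaxArc arcCmd) ⟧ st₁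
      col₂ : mem st₂ col 0 ≡ + j
      col₂ = trans (preserves-loop states (relaxArc arcCmd) (relax-keeps col refl refl) st₁ 0) c≡

      C₁ : Ctx (mem st₁)
      C₁ = ctx-agree C λ a n f → enter-fixed f st n

      I : Inner D j (mem st changed 0) N st₂
      I = loop-invariant states (relaxArc arcCmd) (Inner D j (mem st changed 0))
        (λ k st′ k< fr → relax-correct D j (mem st changed 0) k st′ j< k<
          (ctx-agree C₁ λ a n f → fr a (relax-fixed f) n)
          (λ i i< → encodes-cong (fr reach (relax-keeps reach refl refl) i) (fr dist (relax-keeps dist refl refl) i) (H i i<))
          (trans (fr col (relax-keeps col refl refl) 0) c≡))
        (inner refl c≡
          (encodes-cong (cong (λ z → mem st reach ∣ z ∣) c≡) (cong (λ z → mem st dist ∣ z ∣) c≡) (H j j<))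
          (idle refl refl))

    data Outcome (D : ℕ → Maybe ℤ) (k : ℕ) (s : Store) : Set where
      unchanged : s changed 0 ≡ 0ℤ → (∀ m → m < k → best D m N ≡ D m) → Outcome D k s
      altered   : s changed 0 ≡ 1ℤ → ∃[ m ] best D m N ≺ D m → Outcome D k s

    extend : ∀ {D k s s′} → Outcome D k s → Progress (D k) (best D k N) (s changed 0) (s′ changed 0) →
             Outcome D (suc k) s′
    extend {D} {k} (unchanged p q) (idle r r′) = unchanged (trans r′ p) same-below
      where
      same-below : ∀ m → m < suc k → best D m N ≡ D m
      same-below m m< with m ≟ k
      ... | yes refl = r
      ... | no  m≢k  = q m (≤∧≢⇒< (≤-pred m<) m≢k)
    extend (altered p q) (idle _ r) = altered (trans r p) q
    extend {k = k} _ (gains r r′) = altered r′ (k , r)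

    record Outer (D : ℕ → Maybe ℤ) (k : ℕ) (st : State) : Set where
      constructor outer
      field
        col≡    : mem st col 0 ≡ + k
        fresh   : ∀ m → m < k → Encodes (mem st reach′ m) (mem st dist′ m) (best D m N)
        outcome : Outcome D k (mem st)

    zeroes : Cmd
    zeroes = changed ≔ lit 0ℤ ⨾ col ≔ lit 0ℤ

    zeroes-fixed : ∀ {a} → Fixed a → Preserves zeroes a
    zeroes-fixed f = preserves zeroes (fixed-elim {λ a → writes zeroes a ≡ false} refl refl refl refl refl refl refl refl f)

    columns-correct : ∀ D st → Ctx (mem st) → Holds D (mem st) → Outer D N (⟦ columns arcCmd ⟧ st)
    columns-correct D st C H = loop-invariant states (column arcCmd) (Outer D) step
      (outer refl (λ _ ()) (unchanged refl λ _ ()))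
      where
      st₁ = ⟦ zeroes ⟧ st

      step : ∀ k st′ → k < N → (∀ a → Preserves (column arcCmd) a → ∀ n → mem st′ a n ≡ mem st₁ a n) →
             Outer D k st′ → Outer D (suc k) (⟦ column arcCmd ⟧ st′)
      step k st′ k< fr (outer c f o) = outer (Column.col≡ K) fresh (extend o (Column.progress K))
        where
        K : Column D k (mem st′) (mem (⟦ column arcCmd ⟧ st′))
        K = column-correct D k st′ k<
          (ctx-agree C λ a n fx → trans (fr a (column-fixed fx) n) (zeroes-fixed fx st n))
          (λ i i< → encodes-cong (fr reach (column-keeps reach refl refl refl refl) i)
                                 (fr dist (column-keeps dist refl refl refl refl) i) (H i i<)) c

        fresh : ∀ m → m < suc k → Encodes (mem (⟦ column arcCmd ⟧ st′) reach′ m)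
                                          (mem (⟦ column arcCmd ⟧ st′) dist′ m) (best D m N)
        fresh m m< with m ≟ k
        ... | yes refl = Column.here K
        ... | no  m≢k  = encodes-cong (proj₁ (Column.others K m m≢k)) (proj₂ (Column.others K m m≢k))
                           (f m (≤∧≢⇒< (≤-pred m<) m≢k))

    record Copied (D : ℕ → Maybe ℤ) (k : ℕ) (st : State) : Set where
      constructor copied
      field
        col≡ : mem st col 0 ≡ + k
        done : ∀ m → m < k → Encodes (mem st reach m) (mem st dist m) (D m)

    copy-at : ∀ st j → mem st col 0 ≡ + j →
      mem (⟦ copy ⟧ st) reach j ≡ mem st reach′ j × mem (⟦ copy ⟧ st) dist j ≡ mem st dist′ j
    copy-at st j p rewrite p | ≡ᵇ-refl j = refl , refl

    copy-other : ∀ st j m → mem st col 0 ≡ + j → m ≢ j →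
      mem (⟦ copy ⟧ st) reach m ≡ mem st reach m × mem (⟦ copy ⟧ st) dist m ≡ mem st dist m
    copy-other st j m p q rewrite p | ≢⇒≡ᵇ q = refl , refl

    copies-correct : ∀ D st → (∀ m → m < N → Encodes (mem st reach′ m) (mem st dist′ m) (D m)) →
                     Holds D (mem (⟦ copies arcCmd ⟧ st))
    copies-correct D st H = Copied.done (loop-invariant states copy (Copied D) step (copied refl λ _ ()))
      where
      st₁ = ⟦ col ≔ lit 0ℤ ⟧ st
      step : ∀ k st′ → k < N → (∀ a → Preserves copy a → ∀ n → mem st′ a n ≡ mem st₁ a n) →
             Copied D k st′ → Copied D (suc k) (⟦ copy ⟧ st′)
      step k st′ k< fr (copied c d) = copied (suc≡ k c) done
        where
        done : ∀ m → m < suc k → Encodes (mem (⟦ copy ⟧ st′) reach m) (mem (⟦ copy ⟧ st′) dist m) (D m)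
        done m m< with m ≟ k
        ... | yes refl = encodes-cong (trans (proj₁ (copy-at st′ k c)) (fr reach′ (preserves copy refl) k))
                                      (trans (proj₂ (copy-at st′ k c)) (fr dist′ (preserves copy refl) k)) (H k k<)
        ... | no  m≢k  = encodes-cong (proj₁ (copy-other st′ k m c m≢k)) (proj₂ (copy-other st′ k m c m≢k))
                           (d m (≤∧≢⇒< (≤-pred m<) m≢k))

    copies-fixed : ∀ {a} → Fixed a → Preserves (copies arcCmd) a
    copies-fixed f = preserves (copies arcCmd) (fixed-elim {λ a → writes (copies arcCmd) a ≡ false} refl refl refl refl refl refl refl refl f)

    round-fixed : ∀ {a} → Fixed a → Preserves (round arcCmd) a
    round-fixed {a} f st n = trans (copies-fixed f (⟦ columns arcCmd ⟧ st) n)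
      (trans (preserves-loop states (column arcCmd) (column-fixed f) (⟦ zeroes ⟧ st) n) (zeroes-fixed f st n))

    -- The status after round r + 1 concerns that round alone, which is all that stability or a
    -- negative cycle is derived from.
    data Status : ℕ → Store → Set where
      fresh    : ∀ {s} → Status 0 s
      stable   : ∀ {r s} → s changed 0 ≡ 0ℤ → Stable r → Status (suc r) s
      improves : ∀ {r s} → s changed 0 ≡ 1ℤ → Improves r → Status (suc r) s

    bellmanFord-correct : ∀ {st} → Ctx (mem st) → Holds D₀ (mem st) →
      Ctx (mem (⟦ bellmanFord arcCmd ⟧ st)) × Holds (D N) (mem (⟦ bellmanFord arcCmd ⟧ st)) ×
      Status N (mem (⟦ bellmanFord arcCmd ⟧ st))
    bellmanFord-correct {st} C H = loop-invariant states (round arcCmd)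
        (λ r st → Ctx (mem st) × Holds (D r) (mem st) × Status r (mem st)) step (C , H , fresh)
      where
      step : ∀ r st′ → r < N → (∀ a → Preserves (round arcCmd) a → ∀ n → mem st′ a n ≡ mem st a n) →
             Ctx (mem st′) × Holds (D r) (mem st′) × Status r (mem st′) →
             Ctx (mem (⟦ round arcCmd ⟧ st′)) × Holds (D (suc r)) (mem (⟦ round arcCmd ⟧ st′)) ×
             Status (suc r) (mem (⟦ round arcCmd ⟧ st′))
      step r st′ r< fr (C′ , H′ , _) =
        ctx-agree C′ (λ a n f → round-fixed f st′ n) ,
        copies-correct (D (suc r)) st₁ (Outer.fresh O) ,
        status (Outer.outcome O)
        where
        st₁ = ⟦ columns arcCmd ⟧ st′
        O = columns-correct (D r) st′ C′ H′
        spared = preserves (copies arcCmd) {changed} refl st₁ 0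
        status : Outcome (D r) N (mem st₁) → Status (suc r) (mem (⟦ copies arcCmd ⟧ st₁))
        status (unchanged p q) = stable (trans spared p) q
        status (altered p q)   = improves (trans spared p) q

-- Reading the game from the input

module Parsing where
  open import Defs
  open Language
  open Algorithm
  open Games using (sgn; module OnePlayerGame)
  open Machine using (bound-function)
  open import Data.Fin using (Fin; zero; suc; toℕ; fromℕ<)
  open import Data.Integer as ℤ using (ℤ; +_; 0ℤ; 1ℤ)
  import Data.Integer.Properties as ℤ
  open import Data.List using (List; []; _∷_; _++_; map; length; concatMap; tabulate; allFin)
  open import Data.List.Properties using
    (++-assoc; ++-identityʳ; length-++; length-map; length-tabulate; map-++; map-tabulate; map-concatMap;
     concatMap-++; concatMap-cong)
  open import Data.List.Relation.Unary.All as All using (All; []; _∷_)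
  open import Data.List.Relation.Unary.All.Properties using (map⁺)
  open import Data.Rational using (ℚ)
  open import Data.Fin.Properties using (toℕ<n; toℕ-fromℕ<)
  open import Data.Maybe as Maybe using (Maybe; just; nothing)
  open import Data.Nat
  open import Data.Nat.Properties
  open import Data.Product using (_×_; _,_; proj₁; proj₂)
  open import Data.Unit using (⊤; tt)
  open import Function using (_∘_)
  open import Relation.Binary.PropositionalEquality hiding ([_])

  -- All owners coincide in a one-player game, so each is read into the same cell and the last one
  -- is kept.
  readOwners readEdge readEdges parse : Cmd
  readOwners = loop states (read player)
  readEdge =
    read active ⨾ edges [ ‵ ptr ]≔ ‵ active ⨾
    ifPos (‵ active)
      -- `player` is 1 or 2, so the test is positive for player 2 only, whose weights are negated;
      -- the same test later negates `num`.
      (read aux ⨾ ifPos (‵ player ⊖ lit 1ℤ) (weights [ ‵ ptr ]≔ lit 0ℤ ⊖ ‵ aux) (weights [ ‵ ptr ]≔ ‵ aux))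
      skip ⨾
    increment ptr
  readEdges = ptr ≔ lit 0ℤ ⨾ loop states (loop states readEdge)
  parse = readOwners ⨾ readEdges ⨾ ifPos (‵ player ⊖ lit 1ℤ) (num ≔ lit 0ℤ ⊖ ‵ num) skip

  Stored : Store → ℕ → List (Maybe ℤ) → Set
  Stored s q []       = ⊤
  Stored s q (c ∷ cs) = Encodes (s edges q) (s weights q) c × Stored s (suc q) cs

  stored-++ : ∀ s q cs {ds} → Stored s q cs → Stored s (q + length cs) ds → Stored s q (cs ++ ds)
  stored-++ s q []       {ds} _       T = subst (λ z → Stored s z ds) (+-identityʳ q) T
  stored-++ s q (c ∷ cs) {ds} (E , S) T =
    E , stored-++ s (suc q) cs S (subst (λ z → Stored s z ds) (+-suc q (length cs)) T)

  stored-drop : ∀ s q cs {ds} → Stored s q (cs ++ ds) → Stored s (q + length cs) ds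
  stored-drop s q []       {ds} T       = subst (λ z → Stored s z ds) (sym (+-identityʳ q)) T
  stored-drop s q (c ∷ cs) {ds} (_ , S) =
    subst (λ z → Stored s z ds) (sym (+-suc q (length cs))) (stored-drop s (suc q) cs S)

  stored-take : ∀ s q cs {ds} → Stored s q (cs ++ ds) → Stored s q cs
  stored-take s q []       _       = tt
  stored-take s q (c ∷ cs) (E , S) = E , stored-take s (suc q) cs S

  stored-cong : ∀ s s′ q cs → (∀ m → m < q + length cs → s′ edges m ≡ s edges m × s′ weights m ≡ s weights m) →
                Stored s q cs → Stored s′ q cs
  stored-cong s s′ q []       p _       = tt
  stored-cong s s′ q (c ∷ cs) p (E , S) =
    encodes-cong (proj₁ (p q q<)) (proj₂ (p q q<)) E ,
    stored-cong s s′ (suc q) cs (λ m m< → p m (subst (m <_) (sym (+-suc q (length cs))) m<)) S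
    where q< = m<m+n q z<s

  stored-tabulate : ∀ {n} s q (f : Fin n → Maybe ℤ) → Stored s q (tabulate f) →
                    ∀ b → Encodes (s edges (q + toℕ b)) (s weights (q + toℕ b)) (f b)
  stored-tabulate {suc n} s q f (E , S) zero rewrite +-identityʳ q = E
  stored-tabulate {suc n} s q f (E , S) (suc b) rewrite +-suc q (toℕ b) =
    stored-tabulate s (suc q) (f ∘ suc) S b

  stored-rows : ∀ {k} s q N (f : Fin k → List (Maybe ℤ)) → (∀ a → length (f a) ≡ N) →
                Stored s q (concatMap f (allFin k)) → ∀ a → Stored s (q + toℕ a * N) (f a)
  stored-rows {k} s q N f len S a = go (λ a → a) q S a
    where
    go : ∀ {m} (g : Fin m → Fin k) q → Stored s q (concatMap f (tabulate g)) →
         ∀ b → Stored s (q + toℕ b * N) (f (g b))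
    go {suc m} g q S zero = subst (λ z → Stored s z (f (g zero))) (sym (+-identityʳ q))
      (stored-take s q (f (g zero)) S)
    go {suc m} g q S (suc b) = subst (λ z → Stored s z (f (g (suc b)))) (+-assoc q N (toℕ b * N))
      (go (g ∘ suc) (q + N) (subst (λ z → Stored s (q + z) (concatMap f (tabulate (g ∘ suc)))) (len (g zero))
        (stored-drop s q (f (g zero)) S)) b)

  module Reading (β : Bound → ℕ) where
    open Reasoning β

    IsPlayer : Player → State → Set
    IsPlayer p st = mem st player 0 ≡ encodePlayer p

    -- `before` makes consecutive reads composable: later ones leave the cells stored so far intact.
    record Read (p : Player) (q : ℕ) (cs : List (Maybe ℤ)) (r : List ℤ) (st st′ : State) : Set where
      field
        input≡ : inp st′ ≡ just r
        ptr≡   : mem st′ ptr 0 ≡ + (q + length cs)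
        stored : Stored (mem st′) q (map (Maybe.map (sgn p ℤ.*_)) cs)
        before : ∀ m → m < q → mem st′ edges m ≡ mem st edges m × mem st′ weights m ≡ mem st weights m

    encodeCells : List (Maybe ℤ) → List ℤ
    encodeCells = concatMap encodeEdge

    readEdge-correct : ∀ p c r q s → s player 0 ≡ encodePlayer p → s ptr 0 ≡ + q →
      Read p q (c ∷ []) r (state s (just (encodeEdge c ++ r)))
        (⟦ readEdge ⟧ (state s (just (encodeEdge c ++ r))))
    readEdge-correct p nothing r q s P Q = record
      { input≡ = refl ; ptr≡ = cong (ℤ._+ 1ℤ) Q ; stored = flag , tt ; before = earlier }
      where
      st′ = ⟦ readEdge ⟧ (state s (just (0ℤ ∷ r)))
      flag : Encodes (mem st′ edges q) (mem st′ weights q) nothing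
      flag rewrite Q | ≡ᵇ-refl q = none refl
      earlier : ∀ m → m < q → mem st′ edges m ≡ s edges m × mem st′ weights m ≡ s weights m
      earlier m m< rewrite Q | ≢⇒≡ᵇ (<⇒≢ m<) = refl , refl
    readEdge-correct p (just x) r q s P Q = record
      { input≡ = unread p P ; ptr≡ = pointer p P ; stored = cell p P , tt ; before = earlier p P }
      where
      st′ = ⟦ readEdge ⟧ (state s (just (1ℤ ∷ x ∷ r)))
      unread : ∀ p → s player 0 ≡ encodePlayer p → inp st′ ≡ just r
      unread player₁ P rewrite P = refl
      unread player₂ P rewrite P = refl
      pointer : ∀ p → s player 0 ≡ encodePlayer p → mem st′ ptr 0 ≡ + (q + 1)
      pointer player₁ P rewrite P = cong (ℤ._+ 1ℤ) Q
      pointer player₂ P rewrite P = cong (ℤ._+ 1ℤ) Q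
      cell : ∀ p → s player 0 ≡ encodePlayer p → Encodes (mem st′ edges q) (mem st′ weights q) (just (sgn p ℤ.* x))
      cell player₁ P rewrite P | Q | ≡ᵇ-refl q = some refl (sym (ℤ.*-identityˡ x))
      cell player₂ P rewrite P | Q | ≡ᵇ-refl q = some refl (trans (ℤ.+-identityˡ (ℤ.- x)) (sym (ℤ.-1*i≡-i x)))
      earlier : ∀ p → s player 0 ≡ encodePlayer p → ∀ m → m < q →
                mem st′ edges m ≡ s edges m × mem st′ weights m ≡ s weights m
      earlier player₁ P m m< rewrite P | Q | ≢⇒≡ᵇ (<⇒≢ m<) = refl , refl
      earlier player₂ P m m< rewrite P | Q | ≢⇒≡ᵇ (<⇒≢ m<) = refl , refl

    read-nothing : ∀ {p q st r} → inp st ≡ just r → mem st ptr 0 ≡ + q → Read p q [] r st st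
    read-nothing {q = q} e Q = record
      { input≡ = e ; ptr≡ = trans Q (cong +_ (sym (+-identityʳ q))) ; stored = tt ; before = λ _ _ → refl , refl }

    read-trans : ∀ {p q cs ds r r′ st st′ st″} → Read p q cs r st st′ → Read p (q + length cs) ds r′ st′ st″ →
                 Read p q (cs ++ ds) r′ st st″
    read-trans {q = q} {cs} {ds} {st = st} {st′} {st″} R R′ = record
      { input≡ = Read.input≡ R′
      ; ptr≡ = trans (Read.ptr≡ R′) (cong +_ (trans (+-assoc q (length cs) (length ds))
                 (cong (λ z → q + z) (sym (length-++ cs)))))
      ; stored = subst (Stored (mem st″) q) (sym (map-++ _ cs ds))
          (stored-++ (mem st″) q (map _ cs)
            (stored-cong (mem st′) (mem st″) q (map _ cs)
              (λ m m< → Read.before R′ m (subst (λ z → m < q + z) (length-map _ cs) m<)) (Read.stored R))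
            (subst (λ z → Stored (mem st″) (q + z) (map _ ds)) (sym (length-map _ cs)) (Read.stored R′)))
      ; before = λ m m< →
          trans (proj₁ (Read.before R′ m (<-≤-trans m< (m≤m+n q _)))) (proj₁ (Read.before R m m<)) ,
          trans (proj₂ (Read.before R′ m (<-≤-trans m< (m≤m+n q _)))) (proj₂ (Read.before R m m<))
      }

    -- Abstracts from the unit that one turn of a loop reads; the inner loop uses it with a cell as
    -- the unit, the outer loop with a row.
    read-all : ∀ p {A : Set} (cmd : Cmd) (cells : A → List (Maybe ℤ)) → Preserves cmd player →
      (∀ a r q st → IsPlayer p st → mem st ptr 0 ≡ + q → inp st ≡ just (encodeCells (cells a) ++ r) →
         Read p q (cells a) r st (⟦ cmd ⟧ st)) →
      ∀ as r q st → IsPlayer p st → mem st ptr 0 ≡ + q →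
      inp st ≡ just (encodeCells (concatMap cells as) ++ r) →
      Read p q (concatMap cells as) r st (iter (length as) ⟦ cmd ⟧ st)
    read-all p cmd cells keep one []       r q st P Q e = read-nothing e Q
    read-all p cmd cells keep one (a ∷ as) r q st P Q e =
      read-trans R (read-all p cmd cells keep one as r (q + length (cells a)) (⟦ cmd ⟧ st)
        (trans (keep st 0) P) (Read.ptr≡ R) (Read.input≡ R))
      where
      R = one a (encodeCells (concatMap cells as) ++ r) q st P Q
        (trans e (cong just (trans (cong (_++ r) (concatMap-++ encodeEdge (cells a) (concatMap cells as)))
          (++-assoc (encodeCells (cells a)) _ r))))

    readOwners-correct : ∀ p xs r s → All (_≡ encodePlayer p) xs → 1 ≤ length xs →
      let st′ = iter (length xs) ⟦ read player ⟧ (state s (just (xs ++ r))) in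
      IsPlayer p st′ × inp st′ ≡ just r
    readOwners-correct p (x ∷ xs) r s (eq ∷ eqs) _ = go xs _ eqs eq
      where
      go : ∀ xs s → All (_≡ encodePlayer p) xs → s player 0 ≡ encodePlayer p →
        let st′ = iter (length xs) ⟦ read player ⟧ (state s (just (xs ++ r))) in
        IsPlayer p st′ × inp st′ ≡ just r
      go []       s []         P = P , refl
      go (x ∷ xs) s (eq ∷ eqs) P = go xs _ eqs eq

  concatMap-concatMap : ∀ {A B C : Set} (f : B → List C) (g : A → List B) xs →
                        concatMap f (concatMap g xs) ≡ concatMap (λ x → concatMap f (g x)) xs
  concatMap-concatMap f g []       = refl
  concatMap-concatMap f g (x ∷ xs) = trans (concatMap-++ f (g x) (concatMap g xs))
    (cong (concatMap f (g x) ++_) (concatMap-concatMap f g xs))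

  concatMap-singleton : ∀ {k} {A B : Set} (h : A → B) (g : Fin k → A) →
                        concatMap (λ b → h b ∷ []) (tabulate g) ≡ tabulate (h ∘ g)
  concatMap-singleton {zero}  h g = refl
  concatMap-singleton {suc k} h g = cong (h (g zero) ∷_) (concatMap-singleton h (g ∘ suc))

  module ParseGame (G : Game) (p : Player) (owned : ∀ s → Game.owner G s ≡ p) (s₀ : Game.State G)
                   (t : ℚ) (b : ℕ) where
    open Game G using (#states; owner; weight)
    open OnePlayerGame G p owned s₀ t using (W; W-toℕ)

    β : Bound → ℕ
    β = bound-function #states b

    open Reasoning β
    open Reading β

    -- A row is written as a concatenation of singletons, so that both levels of the matrix have the
    -- form that `read-all` expects.
    cells : Fin #states → List (Maybe ℤ)
    cells a = concatMap (λ b → weight a b ∷ []) (allFin #states)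

    repeated : ∀ c st → iter (length (allFin #states)) ⟦ c ⟧ st ≡ ⟦ loop states c ⟧ st
    repeated c st = trans (cong (λ z → iter z ⟦ c ⟧ st) (length-tabulate {n = #states} (λ z → z)))
                          (sym (repeat≡ #states ⟦ c ⟧ st))

    row-correct : ∀ a r q st → IsPlayer p st → mem st ptr 0 ≡ + q →
                  inp st ≡ just (encodeCells (cells a) ++ r) →
                  Read p q (cells a) r st (⟦ loop states readEdge ⟧ st)
    row-correct a r q st P Q e = subst (Read p q (cells a) r st) (repeated readEdge st)
      (read-all p readEdge (λ b → weight a b ∷ []) (preserves readEdge refl) one (allFin #states) r q st P Q e)
      where
      one : ∀ b r q st → IsPlayer p st → mem st ptr 0 ≡ + q →
            inp st ≡ just (encodeCells (weight a b ∷ []) ++ r) →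
            Read p q (weight a b ∷ []) r st (⟦ readEdge ⟧ st)
      one b r q (state s i) P Q e
        rewrite trans e (cong (λ z → just (z ++ r)) (++-identityʳ (encodeEdge (weight a b)))) =
        readEdge-correct p (weight a b) r q s P Q

    owners : List ℤ
    owners = map (encodePlayer ∘ owner) (allFin #states)

    rest : List ℤ
    rest = owners ++ concatMap (λ s → concatMap (λ s′ → encodeEdge (weight s s′)) (allFin #states))
                               (allFin #states)

    rest≡ : rest ≡ owners ++ (encodeCells (concatMap cells (allFin #states)) ++ [])
    rest≡ = cong (owners ++_) (sym (trans (++-identityʳ _)
      (trans (concatMap-concatMap encodeEdge cells (allFin #states))
        (concatMap-cong (λ a → trans (concatMap-concatMap encodeEdge (λ b → weight a b ∷ []) (allFin #states))
          (concatMap-cong (λ b → ++-identityʳ (encodeEdge (weight a b))) (allFin #states))) (allFin #states)))))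

    owners≡ : All (_≡ encodePlayer p) owners
    owners≡ = map⁺ (All.tabulate λ {s} _ → cong encodePlayer (owned s))

    length-owners : length owners ≡ #states
    length-owners = trans (length-map _ (allFin #states)) (length-tabulate (λ z → z))

    record Parsed (s : Store) (st : State) : Set where
      field
        consumed : inp st ≡ just []
        player≡  : IsPlayer p st
        num≡     : mem st num 0 ≡ sgn p ℤ.* s num 0
        table    : ∀ {i j} → i < #states → j < #states →
                   Encodes (mem st edges (i * #states + j)) (mem st weights (i * #states + j)) (W i j)

    parse-correct : ∀ s → Parsed s (⟦ parse ⟧ (state s (just rest)))
    parse-correct s = record
      { consumed = trans (silent signum refl st₂) (Read.input≡ R)
      ; player≡  = trans (preserves signum {player} refl st₂ 0) P₂
      ; num≡     = trans (signed p st₂ P₂) (cong (sgn p ℤ.*_)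
          (preserves (readOwners ⨾ readEdges) {num} refl (state s (just rest)) 0))
      ; table    = λ {i} {j} i< j< → subst₂
          (λ i j → Encodes (mem (⟦ signum ⟧ st₂) edges (i * #states + j))
                           (mem (⟦ signum ⟧ st₂) weights (i * #states + j)) (W i j))
          (toℕ-fromℕ< i<) (toℕ-fromℕ< j<)
          (entries (fromℕ< i<) (fromℕ< j<))
      }
      where
      signum = ifPos (‵ player ⊖ lit 1ℤ) (num ≔ lit 0ℤ ⊖ ‵ num) skip
      cs = concatMap cells (allFin #states)
      st₁ = ⟦ readOwners ⟧ (state s (just rest))
      st₂ = ⟦ readEdges ⟧ st₁

      nonempty : 1 ≤ #states
      nonempty = ≤-trans (s≤s z≤n) (toℕ<n s₀)

      O : IsPlayer p st₁ × inp st₁ ≡ just (encodeCells cs ++ [])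
      O = subst (λ st → IsPlayer p st × inp st ≡ just (encodeCells cs ++ []))
            (trans (cong₂ (λ n i → iter n ⟦ read player ⟧ (state s (just i))) length-owners (sym rest≡))
                   (sym (repeat≡ #states ⟦ read player ⟧ (state s (just rest)))))
            (readOwners-correct p owners (encodeCells cs ++ []) s owners≡
              (subst (1 ≤_) (sym length-owners) nonempty))

      R : Read p 0 cs [] (⟦ ptr ≔ lit 0ℤ ⟧ st₁) st₂
      R = subst (Read p 0 cs [] (⟦ ptr ≔ lit 0ℤ ⟧ st₁)) (repeated (loop states readEdge) (⟦ ptr ≔ lit 0ℤ ⟧ st₁))
        (read-all p (loop states readEdge) cells (preserves (loop states readEdge) refl) row-correct
          (allFin #states) [] 0 (⟦ ptr ≔ lit 0ℤ ⟧ st₁) (proj₁ O) refl (proj₂ O))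

      P₂ : IsPlayer p st₂
      P₂ = trans (preserves readEdges {player} refl st₁ 0) (proj₁ O)

      signed : ∀ p st → IsPlayer p st → mem (⟦ signum ⟧ st) num 0 ≡ sgn p ℤ.* mem st num 0
      signed player₁ st e rewrite e = sym (ℤ.*-identityˡ _)
      signed player₂ st e rewrite e = trans (ℤ.+-identityˡ _) (sym (ℤ.-1*i≡-i _))

      row≡ : ∀ a → map (Maybe.map (sgn p ℤ.*_)) (cells a) ≡ tabulate (λ b → Maybe.map (sgn p ℤ.*_) (weight a b))
      row≡ a = trans (cong (map _) (concatMap-singleton (weight a) (λ z → z))) (map-tabulate (weight a) _)

      rows : Stored (mem st₂) 0 (concatMap (λ a → tabulate (λ b → Maybe.map (sgn p ℤ.*_) (weight a b))) (allFin #states))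
      rows = subst (Stored (mem st₂) 0)
        (trans (map-concatMap _ cells (allFin #states)) (concatMap-cong row≡ (allFin #states))) (Read.stored R)

      entries : ∀ a b → Encodes (mem (⟦ signum ⟧ st₂) edges (toℕ a * #states + toℕ b))
                                (mem (⟦ signum ⟧ st₂) weights (toℕ a * #states + toℕ b)) (W (toℕ a) (toℕ b))
      entries a b = encodes-cong (preserves signum {edges} refl st₂ _) (preserves signum {weights} refl st₂ _)
        (subst (Encodes (mem st₂ edges (toℕ a * #states + toℕ b)) (mem st₂ weights (toℕ a * #states + toℕ b)))
          (sym (W-toℕ a b))
          (stored-tabulate (mem st₂) (toℕ a * #states) _
            (stored-rows (mem st₂) 0 #states _ (λ _ → length-tabulate _) rows a) b))

-- Weights for the second run: products without multiplication

module Preparation where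
  open import Defs using (Player; player₁; player₂; encodePlayer)
  open Language
  open Algorithm
  open Games using (bias)
  open import Data.Bool using (true; false)
  open import Data.Empty using (⊥-elim)
  open import Data.Integer as ℤ using (ℤ; +_; 0ℤ; 1ℤ; ∣_∣; +<+)
  import Data.Integer.Properties as ℤ
  open import Data.Integer.Tactic.RingSolver using (solve-∀)
  open import Data.Nat
  open import Data.Nat.Properties
  open import Data.Product using (_×_; _,_; proj₁; proj₂)
  open import Relation.Binary.PropositionalEquality hiding ([_])
  open import Relation.Nullary using (¬_; yes; no)

  storePower powers : Cmd
  storePower = power [ ‵ digits ]≔ ‵ aux ⨾ aux ≔ ‵ aux ⊕ ‵ aux ⨾ increment digits
  powers = aux ≔ lit 1ℤ ⨾ digits ≔ lit 0ℤ ⨾ loop bits storePower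

  -- accum := den * dist[col], by Horner's rule on the binary digits of den.
  startProduct takeDigit nextDigit product : Cmd
  startProduct = accum ≔ lit 0ℤ ⨾ remain ≔ ‵ den ⨾ digit ≔ ‵ digits
  -- The added 1 turns the test of positivity into `power` ≤ `remain`.
  takeDigit = ifPos (‵ remain ⊖ power [ ‵ digit ] ⊕ lit 1ℤ)
    (accum ≔ ‵ accum ⊕ dist [ ‵ col ] ⨾ remain ≔ ‵ remain ⊖ power [ ‵ digit ]) skip
  nextDigit = digit ≔ ‵ digit ⊖ lit 1ℤ ⨾ accum ≔ ‵ accum ⊕ ‵ accum ⨾ takeDigit
  product = startProduct ⨾ loop bits nextDigit

  -- Repeated addition is affordable here: the factor is the number of states, not a number given
  -- only in binary.
  addUp scaleUp : Cmd
  addUp = accum ≔ ‵ accum ⊕ ‵ aux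
  scaleUp = aux ≔ ‵ accum ⊖ ‵ num ⨾ accum ≔ lit 0ℤ ⨾ loop states addUp

  saveColumn prepareColumn prepare : Cmd
  -- Players are encoded as 1 and 2, so `player` - 2 is the negated bias.
  saveColumn = gain [ ‵ col ]≔ ‵ accum ⊕ ‵ player ⊖ lit (+ 2) ⨾
    height [ ‵ col ]≔ dist [ ‵ col ] ⨾ seen [ ‵ col ]≔ reach [ ‵ col ] ⨾
    -- These are the initial distances of the second run, 0 at every vertex.
    dist [ ‵ col ]≔ lit 0ℤ ⨾ reach [ ‵ col ]≔ lit 1ℤ ⨾ increment col
  prepareColumn = product ⨾ scaleUp ⨾ saveColumn
  prepare = col ≔ lit 0ℤ ⨾ loop states prepareColumn

  module Prepare (β : Bound → ℕ) where
    open Reasoning β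

    Powers : Store → Set
    Powers s = s digits 0 ≡ + β bits × ∀ m → m < β bits → s power m ≡ + (2 ^ m)

    record PowersUpTo (k : ℕ) (st : State) : Set where
      constructor upTo
      field
        digits≡ : mem st digits 0 ≡ + k
        aux≡    : mem st aux 0 ≡ + (2 ^ k)
        table   : ∀ m → m < k → mem st power m ≡ + (2 ^ m)

    powers-correct : ∀ st → Powers (mem (⟦ powers ⟧ st))
    powers-correct st = PowersUpTo.digits≡ I , PowersUpTo.table I
      where
      store-at : ∀ st k → mem st digits 0 ≡ + k → mem (⟦ storePower ⟧ st) power k ≡ mem st aux 0
      store-at st k p rewrite p | ≡ᵇ-refl k = refl

      store-other : ∀ st k m → mem st digits 0 ≡ + k → m ≢ k → mem (⟦ storePower ⟧ st) power m ≡ mem st power m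
      store-other st k m p q rewrite p | ≢⇒≡ᵇ q = refl

      step : ∀ k st → PowersUpTo k st → PowersUpTo (suc k) (⟦ storePower ⟧ st)
      step k st (upTo d a t) = upTo (suc≡ k d)
        (trans (cong₂ ℤ._+_ a a) (cong (λ z → + (2 ^ k + z)) (sym (+-identityʳ (2 ^ k))))) table
        where
        table : ∀ m → m < suc k → mem (⟦ storePower ⟧ st) power m ≡ + (2 ^ m)
        table m m< with m ≟ k
        ... | yes refl = trans (store-at st k d) a
        ... | no  m≢k  = trans (store-other st k m d m≢k) (t m (≤∧≢⇒< (≤-pred m<) m≢k))

      I = loop-invariant bits storePower PowersUpTo (λ k st′ _ _ → step k st′) (upTo refl refl λ _ ())

    -- The digits from position κ upwards have been read: they form q, the others ρ.
    record Partial (D : ℕ) (v : ℤ) (k : ℕ) (st : State) : Set where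
      field
        κ q ρ   : ℕ
        κ+k     : κ + k ≡ β bits
        digit≡  : mem st digit 0 ≡ + κ
        remain≡ : mem st remain 0 ≡ + ρ
        accum≡  : mem st accum 0 ≡ + q ℤ.* v
        split   : q * 2 ^ κ + ρ ≡ D
        small   : ρ < 2 ^ κ

    take-positive : ∀ st κ ρ → mem st digit 0 ≡ + κ → mem st power κ ≡ + (2 ^ κ) → mem st remain 0 ≡ + ρ →
      2 ^ κ ≤ ρ → positive (eval (‵ remain ⊖ power [ ‵ digit ] ⊕ lit 1ℤ) (mem st)) ≡ true
    take-positive st κ ρ d p r le rewrite d | p | r =
      trans (cong positive (lemma (+ ρ) (+ (2 ^ κ))))
        (positive-difference {+ (2 ^ κ)} {+ suc ρ} (+<+ (s≤s le)))
      where
      lemma : ∀ x y → x ℤ.- y ℤ.+ 1ℤ ≡ 1ℤ ℤ.+ x ℤ.- y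
      lemma = solve-∀

    take-nonpositive : ∀ st κ ρ → mem st digit 0 ≡ + κ → mem st power κ ≡ + (2 ^ κ) → mem st remain 0 ≡ + ρ →
      ¬ 2 ^ κ ≤ ρ → positive (eval (‵ remain ⊖ power [ ‵ digit ] ⊕ lit 1ℤ) (mem st)) ≡ false
    take-nonpositive st κ ρ d p r nle rewrite d | p | r =
      trans (cong positive (lemma (+ ρ) (+ (2 ^ κ))))
        (nonpositive-difference {+ (2 ^ κ)} {+ suc ρ} λ { (+<+ (s≤s le)) → nle le })
      where
      lemma : ∀ x y → x ℤ.- y ℤ.+ 1ℤ ≡ 1ℤ ℤ.+ x ℤ.- y
      lemma = solve-∀

    double : ∀ q p → (q + q) * p ≡ q * (2 * p)
    double q p = trans (*-distribʳ-+ p q q) (trans (sym (*-distribˡ-+ q p p))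
      (cong (λ z → q * (p + z)) (sym (+-identityʳ p))))

    nextDigit-correct : ∀ D j st k → k < β bits → Powers (mem st) → mem st col 0 ≡ + j →
      Partial D (mem st dist j) k st → Partial D (mem st dist j) (suc k) (⟦ nextDigit ⟧ st)
    -- Fewer than `β bits` digits have been read, so `κ` cannot be 0 yet.
    nextDigit-correct D j st k k< (_ , P) c≡ record
        { κ = zero ; κ+k = κ+k } = ⊥-elim (<⇒≢ k< κ+k)
    nextDigit-correct D j st k k< (_ , P) c≡ record
        { κ = suc κ ; q = q ; ρ = ρ ; κ+k = κ+k ; digit≡ = d ; remain≡ = r ; accum≡ = a ; split = s ; small = sm }
      with 2 ^ κ ≤? ρ
    ... | yes le = record
      { κ = κ ; q = q + q + 1 ; ρ = ρ ∸ 2 ^ κ ; κ+k = trans (+-suc κ k) κ+k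
      ; digit≡ = trans (cong (λ z → mem z digit 0) st′≡) digit₁
      ; remain≡ = trans (cong (λ z → mem z remain 0) st′≡) (trans (cong₂ ℤ._-_ r
          (trans (cong (λ z → mem st power ∣ z ∣) digit₁) power≡))
          (trans (ℤ.m-n≡m⊖n ρ (2 ^ κ)) (ℤ.⊖-≥ le)))
      ; accum≡ = trans (cong (λ z → mem z accum 0) st′≡) (trans (cong₂ ℤ._+_ (cong₂ ℤ._+_ a a)
          (cong (λ z → mem st dist ∣ z ∣) c≡)) (trans (lemma (+ q) (mem st dist j))
            (cong (λ z → z ℤ.* mem st dist j) (sym (trans (ℤ.pos-+ (q + q) 1) (cong (ℤ._+ 1ℤ) (ℤ.pos-+ q q)))))))
      ; split = trans (cong (λ z → z + (ρ ∸ 2 ^ κ)) (*-distribʳ-+ (2 ^ κ) (q + q) 1))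
          (trans (+-assoc ((q + q) * 2 ^ κ) (1 * 2 ^ κ) (ρ ∸ 2 ^ κ))
          (trans (cong₂ _+_ (double q (2 ^ κ)) (trans (cong (λ z → z + (ρ ∸ 2 ^ κ)) (+-identityʳ (2 ^ κ)))
            (m+[n∸m]≡n le))) s))
      ; small = +-cancelˡ-< (2 ^ κ) (ρ ∸ 2 ^ κ) (2 ^ κ)
          (subst₂ _<_ (sym (m+[n∸m]≡n le)) (cong (λ z → 2 ^ κ + z) (+-identityʳ (2 ^ κ))) sm)
      }
      where
      st₁ = ⟦ digit ≔ ‵ digit ⊖ lit 1ℤ ⨾ accum ≔ ‵ accum ⊕ ‵ accum ⟧ st
      digit₁ : mem st₁ digit 0 ≡ + κ
      digit₁ = cong (ℤ._- 1ℤ) d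
      power≡ : mem st power κ ≡ + (2 ^ κ)
      power≡ = P κ (<-≤-trans (m<m+n κ z<s) (≤-reflexive (trans (+-suc κ k) κ+k)))
      st′≡ : ⟦ nextDigit ⟧ st ≡ ⟦ accum ≔ ‵ accum ⊕ dist [ ‵ col ] ⨾ remain ≔ ‵ remain ⊖ power [ ‵ digit ] ⟧ st₁
      st′≡ rewrite take-positive st₁ κ ρ digit₁ power≡ r le = refl
      lemma : ∀ q v → q ℤ.* v ℤ.+ q ℤ.* v ℤ.+ v ≡ (q ℤ.+ q ℤ.+ 1ℤ) ℤ.* v
      lemma = solve-∀
    ... | no nle = record
      { κ = κ ; q = q + q ; ρ = ρ ; κ+k = trans (+-suc κ k) κ+k
      ; digit≡ = trans (cong (λ z → mem z digit 0) st′≡) digit₁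
      ; remain≡ = trans (cong (λ z → mem z remain 0) st′≡) r
      ; accum≡ = trans (cong (λ z → mem z accum 0) st′≡) (trans (cong₂ ℤ._+_ a a)
          (trans (sym (ℤ.*-distribʳ-+ (mem st dist j) (+ q) (+ q)))
            (cong (λ z → z ℤ.* mem st dist j) (sym (ℤ.pos-+ q q)))))
      ; split = trans (cong (λ z → z + ρ) (double q (2 ^ κ))) s
      ; small = ≰⇒> nle
      }
      where
      st₁ = ⟦ digit ≔ ‵ digit ⊖ lit 1ℤ ⨾ accum ≔ ‵ accum ⊕ ‵ accum ⟧ st
      digit₁ : mem st₁ digit 0 ≡ + κ
      digit₁ = cong (ℤ._- 1ℤ) d
      power≡ : mem st power κ ≡ + (2 ^ κ)
      power≡ = P κ (<-≤-trans (m<m+n κ z<s) (≤-reflexive (trans (+-suc κ k) κ+k)))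
      st′≡ : ⟦ nextDigit ⟧ st ≡ st₁
      st′≡ rewrite take-nonpositive st₁ κ ρ digit₁ power≡ r nle = refl

    product-correct : ∀ D j st → D < 2 ^ β bits → Powers (mem st) → mem st den 0 ≡ + D → mem st col 0 ≡ + j →
                      mem (⟦ product ⟧ st) accum 0 ≡ + D ℤ.* mem st dist j
    product-correct D j st D< P d≡ c≡ = finish I
      where
      st₁ = ⟦ startProduct ⟧ st
      I : Partial D (mem st dist j) (β bits) (⟦ product ⟧ st)
      I = loop-invariant bits nextDigit (Partial D (mem st dist j))
        (λ k st′ k< fr i → subst (λ z → Partial D z (suc k) (⟦ nextDigit ⟧ st′)) (fr dist (preserves nextDigit refl) j)
          (nextDigit-correct D j st′ k k<
            (trans (fr digits (preserves nextDigit refl) 0) (proj₁ P) ,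
             λ m m< → trans (fr power (preserves nextDigit refl) m) (proj₂ P m m<))
            (trans (fr col (preserves nextDigit refl) 0) c≡)
            (subst (λ z → Partial D z k st′) (sym (fr dist (preserves nextDigit refl) j)) i)))
        record { κ = β bits ; q = 0 ; ρ = D ; κ+k = +-identityʳ _ ; digit≡ = proj₁ P ; remain≡ = d≡
               ; accum≡ = refl ; split = refl ; small = D< }

      finish : Partial D (mem st dist j) (β bits) (⟦ product ⟧ st) →
               mem (⟦ product ⟧ st) accum 0 ≡ + D ℤ.* mem st dist j
      finish i = trans (Partial.accum≡ i) (cong (λ z → + z ℤ.* mem st dist j) q≡)
        where
        open Partial i
        κ≡0 : κ ≡ 0
        κ≡0 = +-cancelʳ-≡ (β bits) κ 0 κ+k
        q≡ : q ≡ D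
        q≡ = trans (sym (trans (cong₂ (λ x y → q * 2 ^ x + y) κ≡0 (n<1⇒n≡0 (subst (λ z → ρ < 2 ^ z) κ≡0 small)))
               (trans (+-identityʳ (q * 1)) (*-identityʳ q)))) split

    scaleUp-correct : ∀ st → mem (⟦ scaleUp ⟧ st) accum 0 ≡ + β states ℤ.* (mem st accum 0 ℤ.- mem st num 0)
    scaleUp-correct st = loop-invariant states addUp (λ k st′ → mem st′ accum 0 ≡ + k ℤ.* y)
      (λ k st′ _ fr a → trans (cong₂ ℤ._+_ a (fr aux (preserves addUp refl) 0)) (lemma (+ k) y)) refl
      where
      y = mem st accum 0 ℤ.- mem st num 0
      lemma : ∀ k y → k ℤ.* y ℤ.+ y ≡ (1ℤ ℤ.+ k) ℤ.* y
      lemma = solve-∀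

    record Setup (p : Player) (D : ℕ) (s : Store) : Set where
      field
        powers≡ : Powers s
        den≡    : s den 0 ≡ + D
        player≡ : s player 0 ≡ encodePlayer p

    gainAt : Player → ℕ → ℤ → ℤ → ℤ
    gainAt p D t v = + β states ℤ.* (+ D ℤ.* v ℤ.- t) ℤ.- bias p

    -- `dist` and `reach` are overwritten in place while they are being consumed; hence one
    -- description for columns below `k` and another from `k` on.
    record Prepared (p : Player) (D : ℕ) (s : Store) (k : ℕ) (st : State) : Set where
      field
        col≡     : mem st col 0 ≡ + k
        heights  : ∀ m → m < k → mem st height m ≡ s dist m
        seens    : ∀ m → m < k → mem st seen m ≡ s reach m
        gains    : ∀ m → m < k → mem st gain m ≡ gainAt p D (s num 0) (s dist m)
        dists    : ∀ m → m < k → mem st dist m ≡ 0ℤ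
        reaches  : ∀ m → m < k → mem st reach m ≡ 1ℤ
        dists′   : ∀ m → k ≤ m → mem st dist m ≡ s dist m
        reaches′ : ∀ m → k ≤ m → mem st reach m ≡ s reach m

    record RecordedAt (st st′ : State) (k : ℕ) : Set where
      field
        gain≡   : mem st′ gain k ≡ mem st accum 0 ℤ.+ mem st player 0 ℤ.- + 2
        height≡ : mem st′ height k ≡ mem st dist k
        seen≡   : mem st′ seen k ≡ mem st reach k
        dist≡   : mem st′ dist k ≡ 0ℤ
        reach≡  : mem st′ reach k ≡ 1ℤ

    record-at : ∀ st k → mem st col 0 ≡ + k → RecordedAt st (⟦ saveColumn ⟧ st) k
    record-at st k p = record { gain≡ = g ; height≡ = h ; seen≡ = s ; dist≡ = d ; reach≡ = r }
      where
      g : mem (⟦ saveColumn ⟧ st) gain k ≡ mem st accum 0 ℤ.+ mem st player 0 ℤ.- + 2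
      g rewrite p | ≡ᵇ-refl k = refl
      h : mem (⟦ saveColumn ⟧ st) height k ≡ mem st dist k
      h rewrite p | ≡ᵇ-refl k = refl
      s : mem (⟦ saveColumn ⟧ st) seen k ≡ mem st reach k
      s rewrite p | ≡ᵇ-refl k = refl
      d : mem (⟦ saveColumn ⟧ st) dist k ≡ 0ℤ
      d rewrite p | ≡ᵇ-refl k = refl
      r : mem (⟦ saveColumn ⟧ st) reach k ≡ 1ℤ
      r rewrite p | ≡ᵇ-refl k = refl

    record OtherAt (st st′ : State) (m : ℕ) : Set where
      field
        gain≡   : mem st′ gain m ≡ mem st gain m
        height≡ : mem st′ height m ≡ mem st height m
        seen≡   : mem st′ seen m ≡ mem st seen m
        dist≡   : mem st′ dist m ≡ mem st dist m
        reach≡  : mem st′ reach m ≡ mem st reach m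

    record-other : ∀ st k m → mem st col 0 ≡ + k → m ≢ k → OtherAt st (⟦ saveColumn ⟧ st) m
    record-other st k m p q = record { gain≡ = g ; height≡ = h ; seen≡ = s ; dist≡ = d ; reach≡ = r }
      where
      g : mem (⟦ saveColumn ⟧ st) gain m ≡ mem st gain m
      g rewrite p | ≢⇒≡ᵇ q = refl
      h : mem (⟦ saveColumn ⟧ st) height m ≡ mem st height m
      h rewrite p | ≢⇒≡ᵇ q = refl
      s : mem (⟦ saveColumn ⟧ st) seen m ≡ mem st seen m
      s rewrite p | ≢⇒≡ᵇ q = refl
      d : mem (⟦ saveColumn ⟧ st) dist m ≡ mem st dist m
      d rewrite p | ≢⇒≡ᵇ q = refl
      r : mem (⟦ saveColumn ⟧ st) reach m ≡ mem st reach m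
      r rewrite p | ≢⇒≡ᵇ q = refl

    earlier : ∀ {m k} → m < suc k → m ≢ k → m < k
    earlier m< m≢k = ≤∧≢⇒< (≤-pred m<) m≢k

    prepareColumn-correct : ∀ p D s st k → k < β states → D < 2 ^ β bits → Setup p D (mem st) →
      mem st num 0 ≡ s num 0 → Prepared p D s k st → Prepared p D s (suc k) (⟦ prepareColumn ⟧ st)
    prepareColumn-correct p D s st k k< D< S num≡ R = record
      { col≡ = suc≡ k col₂
      ; heights = heights ; seens = seens ; gains = gains ; dists = dists ; reaches = reaches
      ; dists′ = λ m m> → trans (OtherAt.dist≡ (record-other st₂ k m col₂ (>⇒≢ m>)))
          (trans (preserves pre {dist} refl st m) (Prepared.dists′ R m (<⇒≤ m>)))
      ; reaches′ = λ m m> → trans (OtherAt.reach≡ (record-other st₂ k m col₂ (>⇒≢ m>)))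
          (trans (preserves pre {reach} refl st m) (Prepared.reaches′ R m (<⇒≤ m>)))
      }
      where
      pre = product ⨾ scaleUp
      st₁ = ⟦ product ⟧ st
      st₂ = ⟦ pre ⟧ st
      st₃ = ⟦ prepareColumn ⟧ st
      col₂ : mem st₂ col 0 ≡ + k
      col₂ = trans (preserves pre {col} refl st 0) (Prepared.col≡ R)
      A = record-at st₂ k col₂

      dist-k : mem st dist k ≡ s dist k
      dist-k = Prepared.dists′ R k ≤-refl

      accum₂ : mem st₂ accum 0 ≡ + β states ℤ.* (+ D ℤ.* s dist k ℤ.- s num 0)
      accum₂ = trans (scaleUp-correct st₁) (cong (+ β states ℤ.*_) (cong₂ ℤ._-_
        (trans (product-correct D k st D< (Setup.powers≡ S) (Setup.den≡ S) (Prepared.col≡ R))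
               (cong (+ D ℤ.*_) dist-k))
        (trans (preserves product {num} refl st 0) num≡)))

      minus-bias : ∀ p x → x ℤ.+ encodePlayer p ℤ.- + 2 ≡ x ℤ.- bias p
      minus-bias player₁ x = ℤ.+-assoc x (+ 1) (ℤ.- + 2)
      minus-bias player₂ x = ℤ.+-assoc x (+ 2) (ℤ.- + 2)

      gain-k : mem st₃ gain k ≡ gainAt p D (s num 0) (s dist k)
      gain-k = trans (RecordedAt.gain≡ A) (trans (cong (ℤ._- + 2) (cong₂ ℤ._+_ accum₂
        (trans (preserves pre {player} refl st 0) (Setup.player≡ S)))) (minus-bias p (+ β states ℤ.* (+ D ℤ.* s dist k ℤ.- s num 0))))

      heights : ∀ m → m < suc k → mem st₃ height m ≡ s dist m
      heights m m< with m ≟ k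
      ... | yes refl = trans (RecordedAt.height≡ A) (trans (preserves pre {dist} refl st k) dist-k)
      ... | no m≢k = trans (OtherAt.height≡ (record-other st₂ k m col₂ m≢k))
          (trans (preserves pre {height} refl st m) (Prepared.heights R m (earlier m< m≢k)))

      seens : ∀ m → m < suc k → mem st₃ seen m ≡ s reach m
      seens m m< with m ≟ k
      ... | yes refl = trans (RecordedAt.seen≡ A)
          (trans (preserves pre {reach} refl st k) (Prepared.reaches′ R k ≤-refl))
      ... | no m≢k = trans (OtherAt.seen≡ (record-other st₂ k m col₂ m≢k))
          (trans (preserves pre {seen} refl st m) (Prepared.seens R m (earlier m< m≢k)))

      gains : ∀ m → m < suc k → mem st₃ gain m ≡ gainAt p D (s num 0) (s dist m)
      gains m m< with m ≟ k
      ... | yes refl = gain-k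
      ... | no m≢k = trans (OtherAt.gain≡ (record-other st₂ k m col₂ m≢k))
          (trans (preserves pre {gain} refl st m) (Prepared.gains R m (earlier m< m≢k)))

      dists : ∀ m → m < suc k → mem st₃ dist m ≡ 0ℤ
      dists m m< with m ≟ k
      ... | yes refl = RecordedAt.dist≡ A
      ... | no m≢k = trans (OtherAt.dist≡ (record-other st₂ k m col₂ m≢k))
          (trans (preserves pre {dist} refl st m) (Prepared.dists R m (earlier m< m≢k)))

      reaches : ∀ m → m < suc k → mem st₃ reach m ≡ 1ℤ
      reaches m m< with m ≟ k
      ... | yes refl = RecordedAt.reach≡ A
      ... | no m≢k = trans (OtherAt.reach≡ (record-other st₂ k m col₂ m≢k))
          (trans (preserves pre {reach} refl st m) (Prepared.reaches R m (earlier m< m≢k)))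

    prepare-correct : ∀ p D st → D < 2 ^ β bits → Setup p D (mem st) →
                      Prepared p D (mem st) (β states) (⟦ prepare ⟧ st)
    prepare-correct p D st D< S = loop-invariant states prepareColumn (Prepared p D (mem st))
      (λ k st′ k< fr R → prepareColumn-correct p D (mem st) st′ k k< D<
        (record
          { powers≡ = trans (fr digits (preserves prepareColumn refl) 0) (proj₁ (Setup.powers≡ S)) ,
                      λ m m< → trans (fr power (preserves prepareColumn refl) m) (proj₂ (Setup.powers≡ S) m m<)
          ; den≡ = trans (fr den (preserves prepareColumn refl) 0) (Setup.den≡ S)
          ; player≡ = trans (fr player (preserves prepareColumn refl) 0) (Setup.player≡ S) })
        (fr num (preserves prepareColumn refl) 0) R)
      record { col≡ = refl ; heights = λ _ () ; seens = λ _ () ; gains = λ _ () ; dists = λ _ ()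
             ; reaches = λ _ () ; dists′ = λ _ _ → refl ; reaches′ = λ _ _ → refl }

-- The decision procedure and its correctness

module Decision where
  open import Defs
  open Graphs
  open Games
  open Language
  open Machine using (start; Decides)
  open Algorithm
  open Parsing
  open Preparation
  open import Data.Bool using (true; false; _∨_)
  open import Data.Empty using (⊥-elim)
  open import Data.Fin using (Fin; toℕ)
  open import Data.Fin.Properties using (toℕ<n)
  open import Data.Integer as ℤ using (ℤ; +_; 0ℤ; 1ℤ; ∣_∣; +<+)
  import Data.Integer.Properties as ℤ
  open import Data.List using (List; []; _++_; map; concatMap; allFin)
  open import Data.Maybe as Maybe using (Maybe; just)
  open import Data.Nat
  open import Data.Nat.Properties
  open import Data.Product using (_×_; _,_; proj₁; proj₂; ∃-syntax)
  open import Data.Rational using (ℚ; ↥_; ↧ₙ_)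
  open import Data.Sum using (inj₁; inj₂)
  open import Function using (_⇔_; _∘_)
  open import Function.Bundles using (mk⇔)
  open import Relation.Binary.PropositionalEquality hiding ([_])
  open import Relation.Nullary using (¬_; yes; no)

  -- `changed` carries the verdict. A negative cycle in the first run settles the question, so the
  -- second phase is skipped and leaves the flag set. For player 2 a cycle means that player 1
  -- loses, hence the complement in `answer`.
  markSource firstPhase secondPhase answer main : Cmd
  markSource  = reach [ ‵ source ]≔ lit 1ℤ
  firstPhase  = bellmanFord edgeArc
  secondPhase = ifPos (‵ changed) skip (prepare ⨾ bellmanFord tightArc)
  answer      = ifPos (‵ player ⊖ lit 1ℤ) (result ≔ lit 1ℤ ⊖ ‵ changed) (result ≔ ‵ changed)
  main        = parse ⨾ powers ⨾ markSource ⨾ firstPhase ⨾ secondPhase ⨾ answer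

  -- The game is passed by components with `suc M` states, so that the size used in the analysis and
  -- the loop bound of the machine agree by computation.
  module Deciding (M : ℕ) (owner : Fin (suc M) → Player) (weight : Fin (suc M) → Fin (suc M) → Maybe ℤ)
             (total : ∀ s → ∃[ s′ ] Maybe.Is-just (weight s s′))
             (p : Player) (owned : ∀ s → owner s ≡ p) (s₀ : Fin (suc M)) (t : ℚ) (b : ℕ)
             (enough : ↧ₙ t < 2 ^ b) where

    G : Game
    G = record { #states = suc M ; owner = owner ; weight = weight ; total = total }

    N D : ℕ
    N = suc M
    D = ↧ₙ t

    module A = OnePlayerGame G p owned s₀ t
    module P = ParseGame G p owned s₀ t b
    open P using (β)
    open Reasoning β
    open Prepare β

    EdgeTable : Store → Set
    EdgeTable s = ∀ {i j} → i < N → j < N → Encodes (s edges (i * N + j)) (s weights (i * N + j)) (A.W i j)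

    Context₁ Context₂ : Store → Set
    Context₁ s = s order 0 ≡ + N × EdgeTable s
    Context₂ s = Context₁ s × (∀ i → i < N → Encodes (s seen i) (s height i) (A.height i)) ×
                 (∀ j v → j < N → A.height j ≡ just v → s gain j ≡ A.gain v)

    agree₁ : ∀ {s s′} → Context₁ s → Agree s s′ → Context₁ s′
    agree₁ (o , E) f = trans (f order 0 is-order) o ,
      λ i< j< → encodes-cong (f edges _ is-edges) (f weights _ is-weights) (E i< j<)

    keep₁ : ∀ c → Preserves c order → Preserves c edges → Preserves c weights →
            ∀ st → Context₁ (mem st) → Context₁ (mem (⟦ c ⟧ st))
    keep₁ c o e w st (O , E) = trans (o st 0) O , λ i< j< → encodes-cong (e st _) (w st _) (E i< j<)

    agree₂ : ∀ {s s′} → Context₂ s → Agree s s′ → Context₂ s′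
    agree₂ (C , H , K) f = agree₁ C f ,
      (λ i i< → encodes-cong (f seen i is-seen) (f height i is-height) (H i i<)) ,
      λ j v j< e → trans (f gain j is-gain) (K j v j< e)

    edgeArc-correct : ∀ st i j → i < N → j < N → Context₁ (mem st) →
      mem st row 0 ≡ + i → mem st col 0 ≡ + j → mem st ptr 0 ≡ + (i * N + j) →
      Encodes (mem (⟦ edgeArc ⟧ st) active 0) (mem (⟦ edgeArc ⟧ st) arc 0) (A.W i j)
    edgeArc-correct st i j i< j< (_ , E) _ _ q =
      encodes-cong (cong (λ z → mem st edges ∣ z ∣) q) (cong (λ z → mem st weights ∣ z ∣) q) (E i< j<)

    -- Stated for arbitrary `w`, `u` and `v`, so that `tightened` reduces by matching on the
    -- encodings rather than on lookups in the tables.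
    tightArc-cases : ∀ st i j q {w u v} → mem st row 0 ≡ + i → mem st col 0 ≡ + j → mem st ptr 0 ≡ + q →
      Encodes (mem st edges q) (mem st weights q) w → Encodes (mem st seen i) (mem st height i) u →
      Encodes (mem st seen j) (mem st height j) v → (∀ x → v ≡ just x → mem st gain j ≡ A.gain x) →
      Encodes (mem (⟦ tightArc ⟧ st) active 0) (mem (⟦ tightArc ⟧ st) arc 0) (A.tightened w u v)
    tightArc-cases st i j q r c p (none e) _ _ _ rewrite r | c | p | e = none refl
    tightArc-cases st i j q r c p (some e _) (none f) _ _ rewrite r | c | p | e | f = none refl
    tightArc-cases st i j q r c p (some e _) (some f _) (none g) _ rewrite r | c | p | e | f | g = none refl
    tightArc-cases st i j q r c p (some e refl) (some f refl) (some g refl) K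
      rewrite r | c | p | e | f | g
      with 0ℤ ℤ.<? mem st height i ℤ.+ mem st weights q ℤ.- mem st height j
    ... | yes z rewrite positive-true z = none refl
    ... | no  z rewrite positive-false (ℤ.≮⇒≥ z) = some refl (K _ refl)

    tightArc-correct : ∀ st i j → i < N → j < N → Context₂ (mem st) →
      mem st row 0 ≡ + i → mem st col 0 ≡ + j → mem st ptr 0 ≡ + (i * N + j) →
      Encodes (mem (⟦ tightArc ⟧ st) active 0) (mem (⟦ tightArc ⟧ st) arc 0) (A.W₂ i j)
    tightArc-correct st i j i< j< ((_ , E) , H , K) r c q =
      tightArc-cases st i j (i * N + j) r c q (E i< j<) (H i i<) (H j j<) (λ x → K j x j<)

    edgeArc-keeps : ∀ a → isArc a ≡ false → Preserves edgeArc a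
    edgeArc-keeps a p = preserves edgeArc p

    tightArc-keeps : ∀ a → isArc a ≡ false → Preserves tightArc a
    tightArc-keeps a p = preserves tightArc (lemma (code a ≡ᵇ code active) (code a ≡ᵇ code arc) p)
      where
      -- The conclusion has the shape of `writes tightArc a` unfolded: `active` is written at the
      -- start and again in the innermost branch.
      lemma : ∀ x y → x ∨ y ≡ false → x ∨ (y ∨ (((false ∨ x) ∨ false) ∨ false) ∨ false) ≡ false
      lemma false false _ = refl

    module R₁ = Rounds β A.W A.D₀ A.W-bounded edgeArc edgeArc-keeps Context₁ agree₁ proj₁ edgeArc-correct
    module R₂ = Rounds β A.W₂ (λ _ → just 0ℤ) A.W₂-bounded tightArc tightArc-keeps Context₂ agree₂
                  (λ C → proj₁ (proj₁ C)) tightArc-correct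

    data Verdict (s : Store) : Set where
      found  : s changed 0 ≡ 1ℤ → A.Low → Verdict s
      absent : s changed 0 ≡ 0ℤ → A.High → Verdict s

    prepared-context : ∀ s st → Prepared p D s N st → s num 0 ≡ sgn p ℤ.* ↥ t → R₁.Holds A.height s →
                       Context₁ (mem st) → Context₂ (mem st)
    prepared-context s st Q num≡ H C = C ,
      (λ i i< → encodes-cong (Prepared.seens Q i i<) (Prepared.heights Q i i<) (H i i<)) , gain≡
      where
      dist≡ : ∀ {f x v} → Encodes f x (just v) → x ≡ v
      dist≡ (some _ q) = q
      gain≡ : ∀ j v → j < N → A.height j ≡ just v → mem st gain j ≡ A.gain v
      gain≡ j v j< e = trans (Prepared.gains Q j j<)
        (trans (cong (λ z → gainAt p D z (s dist j)) num≡)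
               (cong A.gain (dist≡ (subst (Encodes (s reach j) (s dist j)) e (H j j<)))))

    tight-verdict : ∀ st → R₁.Stable M → R₂.Status N (mem st) → Verdict (mem st)
    tight-verdict st stable₁ (R₂.improves c i)       = found c (A.tight-cycle⇒low stable₁ (A.B₂.negative-cycle refl i))
    tight-verdict st stable₁ (R₂.stable c stable₂) = absent c (A.high stable₁ (toℕ<n s₀) stable₂)

    afterPrepare : ∀ s st → R₁.Stable M → Prepared p D s N st → s num 0 ≡ sgn p ℤ.* ↥ t →
                   R₁.Holds A.height s → Context₁ (mem st) → Verdict (mem (⟦ bellmanFord tightArc ⟧ st))
    afterPrepare s st stable₁ Q num≡ H C = tight-verdict (⟦ bellmanFord tightArc ⟧ st) stable₁
      (proj₂ (proj₂ (R₂.bellmanFord-correct {st} (prepared-context s st Q num≡ H C)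
        (λ i i< → some (Prepared.reaches Q i i<) (Prepared.dists Q i i<)))))

    secondPhase-correct : ∀ st → Setup p D (mem st) → mem st num 0 ≡ sgn p ℤ.* ↥ t →
      Context₁ (mem st) → R₁.Holds A.height (mem st) → R₁.Status N (mem st) →
      Verdict (mem (⟦ secondPhase ⟧ st))
    secondPhase-correct st S num≡ C H (R₁.improves c i) =
      subst (λ z → Verdict (mem z)) (sym (branch-true (‵ changed) skip (prepare ⨾ bellmanFord tightArc) st (cong positive c)))
        (found c (A.negative-cycle⇒low (A.B₁.negative-cycle refl i)))
    secondPhase-correct st S num≡ C H (R₁.stable c stable₁) =
      subst (λ z → Verdict (mem z)) (sym (branch-false (‵ changed) skip (prepare ⨾ bellmanFord tightArc) st (cong positive c)))
        (afterPrepare (mem st) (⟦ prepare ⟧ st) stable₁ (prepare-correct p D st enough S) num≡ H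
          (keep₁ prepare (preserves prepare {order} refl) (preserves prepare {edges} refl) (preserves prepare {weights} refl) st C))

    -- Memory starts at 0, which already encodes distance +∞ everywhere and the value 0 at the
    -- source; only the flag of the source has to be set.
    mark : ∀ st i → mem st source 0 ≡ + toℕ s₀ → mem st reach i ≡ 0ℤ → mem st dist i ≡ 0ℤ →
           Encodes (mem (⟦ markSource ⟧ st) reach i) (mem (⟦ markSource ⟧ st) dist i) (A.D₀ i)
    mark st i s r d rewrite s with i ≡ᵇ toℕ s₀
    ... | true  = some refl d
    ... | false = none r

    st₀ : State
    st₀ = state (start (↥ t) D (toℕ s₀) N) (just P.rest)

    unaltered : ∀ c {st st′} → ⟦ c ⟧ st ≡ st′ → ∀ a → writes c a ≡ false → ∀ n → mem st′ a n ≡ mem st a n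
    unaltered c refl a q n = preserves c q _ n

    quiet : ∀ c {st st′} → ⟦ c ⟧ st ≡ st′ → reads c ≡ false → inp st′ ≡ inp st
    quiet c refl q = silent c q _

    run-six : ∀ c₁ c₂ c₃ c₄ c₅ c₆ {st st₁ st₂ st₃ st₄ st₅ st₆} → ⟦ c₁ ⟧ st ≡ st₁ → ⟦ c₂ ⟧ st₁ ≡ st₂ →
              ⟦ c₃ ⟧ st₂ ≡ st₃ → ⟦ c₄ ⟧ st₃ ≡ st₄ → ⟦ c₅ ⟧ st₄ ≡ st₅ → ⟦ c₆ ⟧ st₅ ≡ st₆ →
              execute β (c₁ ⨾ c₂ ⨾ c₃ ⨾ c₄ ⨾ c₅ ⨾ c₆) st ≡ st₆
    run-six c₁ c₂ c₃ c₄ c₅ c₆ refl refl refl refl refl refl = execute≡ β _ _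

    -- The intermediate states are variables here: unfolding them is too expensive.
    module Assembly {st₁ st₂ st₃ st₄ st₅ st₆} (e₁ : ⟦ parse ⟧ st₀ ≡ st₁) (e₂ : ⟦ powers ⟧ st₁ ≡ st₂)
        (e₃ : ⟦ markSource ⟧ st₂ ≡ st₃) (e₄ : ⟦ firstPhase ⟧ st₃ ≡ st₄)
        (e₅ : ⟦ secondPhase ⟧ st₄ ≡ st₅) (e₆ : ⟦ answer ⟧ st₅ ≡ st₆) where

      parsed : P.Parsed (mem st₀) st₁
      parsed = subst (P.Parsed (mem st₀)) e₁ (P.parse-correct (mem st₀))

      open P.Parsed parsed

      from₀ : ∀ a → writes parse a ≡ false → writes powers a ≡ false → ∀ n → mem st₂ a n ≡ mem st₀ a n
      from₀ a p q n = trans (unaltered powers e₂ a q n) (unaltered parse e₁ a p n)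

      later : ∀ a → writes markSource a ≡ false → writes firstPhase a ≡ false → ∀ n → mem st₄ a n ≡ mem st₂ a n
      later a p q n = trans (unaltered firstPhase e₄ a q n) (unaltered markSource e₃ a p n)

      sourceDistance : R₁.Holds A.D₀ (mem st₃)
      sourceDistance i i< = subst (λ st → Encodes (mem st reach i) (mem st dist i) (A.D₀ i)) e₃
        (mark st₂ i (from₀ source refl refl 0) (from₀ reach refl refl i) (from₀ dist refl refl i))

      context₁ : Context₁ (mem st₃)
      context₁ = trans (unaltered markSource e₃ order refl 0) (from₀ order refl refl 0) ,
        λ i< j< → encodes-cong (trans (unaltered markSource e₃ edges refl _) (unaltered powers e₂ edges refl _))
                               (trans (unaltered markSource e₃ weights refl _) (unaltered powers e₂ weights refl _)) (table i< j<)

      first : Context₁ (mem st₄) × R₁.Holds A.height (mem st₄) × R₁.Status N (mem st₄)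
      first = subst (λ st → Context₁ (mem st) × R₁.Holds A.height (mem st) × R₁.Status N (mem st)) e₄
        (R₁.bellmanFord-correct {st₃} context₁ sourceDistance)

      powers₂ : Powers (mem st₂)
      powers₂ = subst (λ st → Powers (mem st)) e₂ (powers-correct st₁)

      setup : Setup p D (mem st₄)
      setup = record
        { powers≡ = trans (later digits refl refl 0) (proj₁ powers₂) ,
                    λ m m< → trans (later power refl refl m) (proj₂ powers₂ m m<)
        ; den≡ = trans (later den refl refl 0) (from₀ den refl refl 0)
        ; player≡ = trans (later player refl refl 0) (trans (unaltered powers e₂ player refl 0) player≡)
        }

      verdict : Verdict (mem st₅)
      verdict = subst (λ st → Verdict (mem st)) e₅ (secondPhase-correct st₄ setup
        (trans (later num refl refl 0) (trans (unaltered powers e₂ num refl 0) num≡))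
        (proj₁ first) (proj₁ (proj₂ first)) (proj₂ (proj₂ first)))

      player₅ : mem st₅ player 0 ≡ encodePlayer p
      player₅ = trans (unaltered secondPhase e₅ player refl 0) (Setup.player≡ setup)

      whole : execute β main st₀ ≡ st₆
      whole = run-six parse powers markSource firstPhase secondPhase answer e₁ e₂ e₃ e₄ e₅ e₆

      consumes : inp st₆ ≡ just []
      consumes = trans (quiet answer e₆ refl) (trans (quiet secondPhase e₅ refl) (trans (quiet firstPhase e₄ refl)
        (trans (quiet markSource e₃ refl) (trans (quiet powers e₂ refl) consumed))))

      answered : (∀ st → mem st player 0 ≡ encodePlayer p → Verdict (mem st) → 0ℤ ℤ.< mem (⟦ answer ⟧ st) result 0 ⇔ A.Won) →
                 Decides main (↥ t) D (toℕ s₀) N P.rest A.Won b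
      answered f = record
        { reads   = trans (cong inp whole) consumes
        ; correct = subst (λ st → 0ℤ ℤ.< mem st result 0 ⇔ A.Won) (trans e₆ (sym whole)) (f st₅ player₅ verdict)
        }

    decided : (∀ st → mem st player 0 ≡ encodePlayer p → Verdict (mem st) → 0ℤ ℤ.< mem (⟦ answer ⟧ st) result 0 ⇔ A.Won) →
              Decides main (↥ t) D (toℕ s₀) N P.rest A.Won b
    decided = Assembly.answered refl refl refl refl refl refl

  answer₁ : ∀ β st → mem st player 0 ≡ + 1 → mem (Semantics.⟦_⟧ β answer st) result 0 ≡ mem st changed 0
  answer₁ β st p rewrite p = refl

  answer₂ : ∀ β st → mem st player 0 ≡ + 2 → mem (Semantics.⟦_⟧ β answer st) result 0 ≡ 1ℤ ℤ.- mem st changed 0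
  answer₂ β st p rewrite p = refl

  accepts : ∀ {x} {Yes : Set} → x ≡ 1ℤ → Yes → 0ℤ ℤ.< x ⇔ Yes
  accepts refl y = mk⇔ (λ _ → y) λ _ → +<+ z<s

  rejects : ∀ {x} {Yes : Set} → x ≡ 0ℤ → ¬ Yes → 0ℤ ℤ.< x ⇔ Yes
  rejects refl n = mk⇔ (λ { (+<+ ()) }) λ y → ⊥-elim (n y)

  gameInput : Game → List ℤ
  gameInput G = map (encodePlayer ∘ owner) (allFin #states) ++
    concatMap (λ s → concatMap (λ s′ → encodeEdge (weight s s′)) (allFin #states)) (allFin #states)
    where open Game G

  decides : (G : Game) → OnePlayer G → (s₀ : Game.State G) (t : ℚ) (b : ℕ) → ↧ₙ t < 2 ^ b →
            Decides main (↥ t) (↧ₙ t) (toℕ s₀) (Game.#states G) (gameInput G)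
              (∃[ σ₁ ] Game.Winning G (AvgEnergy G t) s₀ σ₁) b
  decides record { #states = zero } _ ()
  decides G@record { #states = suc M ; owner = owner ; weight = weight ; total = total } (inj₂ owned) s₀ t b enough =
    decided conclude
    where
    open Deciding M owner weight total player₁ owned s₀ t b enough using (decided; Verdict; found; absent; module P)
    conclude : ∀ st → mem st player 0 ≡ + 1 → Verdict (mem st) →
               0ℤ ℤ.< mem (Semantics.⟦_⟧ P.β answer st) result 0 ⇔ (∃[ σ₁ ] Game.Winning G (AvgEnergy G t) s₀ σ₁)
    conclude st e (found c l)  = accepts (trans (answer₁ P.β st e) c) (Player₁.low⇒won G owned s₀ t l)
    conclude st e (absent c h) = rejects (trans (answer₁ P.β st e) c) (Player₁.high⇒lost G owned s₀ t h)
  decides G@record { #states = suc M ; owner = owner ; weight = weight ; total = total } (inj₁ owned) s₀ t b enough =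
    decided conclude
    where
    open Deciding M owner weight total player₂ owned s₀ t b enough using (decided; Verdict; found; absent; module P)
    conclude : ∀ st → mem st player 0 ≡ + 2 → Verdict (mem st) →
               0ℤ ℤ.< mem (Semantics.⟦_⟧ P.β answer st) result 0 ⇔ (∃[ σ₁ ] Game.Winning G (AvgEnergy G t) s₀ σ₁)
    conclude st e (found c l)  = rejects (trans (answer₂ P.β st e) (cong (λ z → 1ℤ ℤ.- z) c)) (Player₂.low⇒lost G owned s₀ t l)
    conclude st e (absent c h) = accepts (trans (answer₂ P.β st e) (cong (λ z → 1ℤ ℤ.- z) c)) (Player₂.high⇒won G owned s₀ t h)

-- Membership in PTIME

open import Defs
open import Data.Fin using (toℕ)
open import Data.List using (length; map; allFin)
open import Data.List.Properties using (length-map; length-tabulate; length-++)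
open import Data.Nat using (_≤_)
open import Data.Nat.Properties using (≤-reflexive; ≤-trans; m≤m+n)
open import Data.Rational using (↥_; ↧ₙ_)
open import Function using (id; _∘_)
open import Relation.Binary.PropositionalEquality using (refl; sym; trans)
open Machine using (in-PTIME)
open Decision using (main; gameInput; decides)

-- The list of owners alone contributes one entry per state.
states≤input : ∀ G → Game.#states G ≤ length (gameInput G)
states≤input G = ≤-trans
  (≤-reflexive (sym (trans (length-map (encodePlayer ∘ owner) (allFin #states)) (length-tabulate {n = #states} id))))
  (≤-trans (m≤m+n _ _) (≤-reflexive (sym (length-++ (map (encodePlayer ∘ owner) (allFin #states))))))
  where open Game G

theorem4 : InPTIME encodeInstance AverageEnergyProblem
theorem4 = in-PTIME main encodeInstance AverageEnergyProblem
  (λ I → ↥ threshold I) (λ I → ↧ₙ threshold I) (λ I → toℕ (init I)) (λ I → Game.#states (game I))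
  (λ I → gameInput (game I)) (λ _ → refl) (λ I → states≤input (game I))
  (λ I b → decides (game I) (onePlayer I) (init I) (threshold I) b)
  where open Instance
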